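{- For any function $f:\mathbb S^k\times \mathbb O \to \mathbb S$, $f$ is $\Sigma^b_1$-representable in $\textsf{\textbf{RS}}^1_2$ if and only if $f\in\mathcal{POR}$.
   Context: $\mathbb S$ is the set of finite binary strings and $\mathbb O=\mathbb B^{\mathbb S}$ the set of oracles (functions from strings to bits). $\mathcal{POR}$ is the smallest class of functions $f:\mathbb S^k\times\mathbb O\to\mathbb S$ containing the empty function, projections, word-successors $x\mapsto x\mathbb{b}$, the conditional function, and the query function $Q(x,\eta)=\eta(x)$, and closed under composition and bounded recursion on notation. $\textsf{\textbf{RS}}^1_2$ is the bounded theory in the word language $\mathcal{RL}$ (constants $\epsilon,\mathtt 0,\mathtt 1$, concatenation, self-concatenation $\times$, predicates $=$, $\subseteq$ (prefix) and a unary predicate $\mathtt{Flip}$), with Ferreira-style basic axioms for strings and induction on notation restricted to $\Sigma^b_1$-formulas. For a formula $F$ of $\mathcal{RL}$, its (quantitative) interpretation is the measurable set of oracles $\eta\in\mathbb O$ such that $F$ is true in the standard model of strings when $\mathtt{Flip}(t)$ is interpreted as "$\eta(t)=\mathbb 1$". A function $f$ is $\Sigma^b_1$-representable in $\textsf{\textbf{RS}}^1_2$ if there is a $\Sigma^b_1$-formula $F(\vec x,y)$ such that (1) $\textsf{\textbf{RS}}^1_2\vdash(\forall\vec x)(\exists y)F(\vec x,y)$, (2) $\textsf{\textbf{RS}}^1_2\vdash(\forall\vec x)(\forall y)(\forall z)(F(\vec x,y)\wedge F(\vec x,z)\to y=z)$, and (3) for all strings $\sigma_1,\dots,\sigma_j,\tau$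 and $\eta\in\mathbb O$, $f(\sigma_1,\dots,\sigma_j,\eta)=\tau$ iff $\eta$ belongs to the interpretation of $F(\overline{\sigma_1},\dots,\overline{\sigma_j},\overline{\tau})$, i.e. iff $F(\overline{\sigma_1},\dots,\overline{\sigma_j},\overline{\tau})$ is true when $\mathtt{Flip}(t)$ is read as $\eta(t)=\mathbb 1$. -}

module Defs where

open import Data.Nat using (ℕ; zero; suc; _∸_)
open import Data.Bool using (Bool; true; false)
open import Data.Fin using (Fin; zero; suc)
open import Data.Vec using (Vec; []; _∷_; lookup; tabulate; init; last; _∷ʳ_)
open import Data.List using (List; []; _∷_; map)
open import Data.List.Membership.Propositional using (_∈_)
open import Data.Product using (Σ; _×_; _,_)
open import Data.Sum using (_⊎_)
open import Data.Empty using (⊥)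
open import Relation.Binary.PropositionalEquality using (_≡_)

-- Strings 𝕊 (bits appended on the right), bits 𝔹 = Bool (false = 0,
-- true = 1), oracles 𝕆 = 𝔹^𝕊.

infixl 6 _·_
data Str : Set where
  ε   : Str
  _·_ : Str → Bool → Str

Oracle : Set
Oracle = Str → Bool

_⌢_ : Str → Str → Str
x ⌢ ε       = x
x ⌢ (y · b) = (x ⌢ y) · b

_⊗_ : Str → Str → Str
x ⊗ ε       = ε
x ⊗ (y · b) = (x ⊗ y) ⌢ x

Prefix : Str → Str → Set
Prefix x y = Σ Str (λ z → x ⌢ z ≡ y)

len : Str → ℕ
len ε       = zero
len (x · b) = suc (len x)

dropLast : ℕ → Str → Str
dropLast zero    x       = x
dropLast (suc k) ε       = ε
dropLast (suc k) (x · b) = dropLast k x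

trunc : Str → Str → Str
trunc x y = dropLast (len x ∸ len y) x

data Tm (n : ℕ) : Set where
  var      : Fin n → Tm n
  eps      : Tm n
  zeroᵗ    : Tm n
  oneᵗ     : Tm n
  _⌢ᵗ_     : Tm n → Tm n → Tm n
  _×ᵗ_     : Tm n → Tm n → Tm n

bitᵗ : ∀ {n} → Bool → Tm n
bitᵗ false = zeroᵗ
bitᵗ true  = oneᵗ

infix  8 _≐_ _⊑_
infixr 7 _∧ᶠ_
infixr 6 _∨ᶠ_
infixr 5 _⇒_ _⇔ᶠ_
infixl 9 _⌢ᵗ_ _×ᵗ_

data Fm (n : ℕ) : Set where
  _≐_  : Tm n → Tm n → Fm n
  _⊑_  : Tm n → Tm n → Fm n
  flip : Tm n → Fm n
  ⊥ᶠ   : Fm n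
  _∧ᶠ_ : Fm n → Fm n → Fm n
  _∨ᶠ_ : Fm n → Fm n → Fm n
  _⇒_  : Fm n → Fm n → Fm n
  ∀ᶠ   : Fm (suc n) → Fm n
  ∃ᶠ   : Fm (suc n) → Fm n

¬ᶠ : ∀ {n} → Fm n → Fm n
¬ᶠ A = A ⇒ ⊥ᶠ

_⇔ᶠ_ : ∀ {n} → Fm n → Fm n → Fm n
A ⇔ᶠ B = (A ⇒ B) ∧ᶠ (B ⇒ A)

liftR : ∀ {m n} → (Fin m → Fin n) → Fin (suc m) → Fin (suc n)
liftR ρ zero    = zero
liftR ρ (suc i) = suc (ρ i)

renT : ∀ {m n} → (Fin m → Fin n) → Tm m → Tm n
renT ρ (var i)  = var (ρ i)
renT ρ eps      = eps
renT ρ zeroᵗ    = zeroᵗ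
renT ρ oneᵗ     = oneᵗ
renT ρ (s ⌢ᵗ t) = renT ρ s ⌢ᵗ renT ρ t
renT ρ (s ×ᵗ t) = renT ρ s ×ᵗ renT ρ t

renF : ∀ {m n} → (Fin m → Fin n) → Fm m → Fm n
renF ρ (s ≐ t)  = renT ρ s ≐ renT ρ t
renF ρ (s ⊑ t)  = renT ρ s ⊑ renT ρ t
renF ρ (flip t) = flip (renT ρ t)
renF ρ ⊥ᶠ       = ⊥ᶠ
renF ρ (A ∧ᶠ B) = renF ρ A ∧ᶠ renF ρ B
renF ρ (A ∨ᶠ B) = renF ρ A ∨ᶠ renF ρ B
renF ρ (A ⇒ B)  = renF ρ A ⇒ renF ρ B
renF ρ (∀ᶠ A)   = ∀ᶠ (renF (liftR ρ) A)
renF ρ (∃ᶠ A)   = ∃ᶠ (renF (liftR ρ) A)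

wkT : ∀ {n} → Tm n → Tm (suc n)
wkT = renT suc

wkF : ∀ {n} → Fm n → Fm (suc n)
wkF = renF suc

liftS : ∀ {m n} → (Fin m → Tm n) → Fin (suc m) → Tm (suc n)
liftS σ zero    = var zero
liftS σ (suc i) = wkT (σ i)

subT : ∀ {m n} → (Fin m → Tm n) → Tm m → Tm n
subT σ (var i)  = σ i
subT σ eps      = eps
subT σ zeroᵗ    = zeroᵗ
subT σ oneᵗ     = oneᵗ
subT σ (s ⌢ᵗ t) = subT σ s ⌢ᵗ subT σ t
subT σ (s ×ᵗ t) = subT σ s ×ᵗ subT σ t

subF : ∀ {m n} → (Fin m → Tm n) → Fm m → Fm n
subF σ (s ≐ t)  = subT σ s ≐ subT σ t
subF σ (s ⊑ t)  = subT σ s ⊑ subT σ t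
subF σ (flip t) = flip (subT σ t)
subF σ ⊥ᶠ       = ⊥ᶠ
subF σ (A ∧ᶠ B) = subF σ A ∧ᶠ subF σ B
subF σ (A ∨ᶠ B) = subF σ A ∨ᶠ subF σ B
subF σ (A ⇒ B)  = subF σ A ⇒ subF σ B
subF σ (∀ᶠ A)   = ∀ᶠ (subF (liftS σ) A)
subF σ (∃ᶠ A)   = ∃ᶠ (subF (liftS σ) A)

_[_] : ∀ {n} → Fm (suc n) → Tm n → Fm n
A [ t ] = subF (λ { zero → t ; (suc i) → var i }) A

num : ∀ {n} → Str → Tm n
num ε       = eps
num (x · b) = num x ⌢ᵗ bitᵗ b

data Σb0 (n : ℕ) : Set where
  eqᵇ   : Tm n → Tm n → Σb0 n
  preᵇ  : Tm n → Tm n → Σb0 n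
  flipᵇ : Tm n → Σb0 n
  notᵇ  : Σb0 n → Σb0 n
  andᵇ  : Σb0 n → Σb0 n → Σb0 n
  orᵇ   : Σb0 n → Σb0 n → Σb0 n
  impᵇ  : Σb0 n → Σb0 n → Σb0 n
  allSub : Tm n → Σb0 (suc n) → Σb0 n
  exSub  : Tm n → Σb0 (suc n) → Σb0 n

data Σb1 (n : ℕ) : Set where
  base : Σb0 n → Σb1 n
  exLe : Tm n → Σb1 (suc n) → Σb1 n

-- x ⊆* t  abbreviates  ∃w ⊆ t (w ⌢ x ⊆ t), i.e. ∃w (w ⊆ t ∧ w⌢x ⊆ t);
-- here x = var 0 and t lives in the outer context.
subwordOf : ∀ {n} → Tm n → Fm (suc n)
subwordOf t =
  ∃ᶠ ((var zero ⊑ wkT (wkT t)) ∧ᶠ ((var zero ⌢ᵗ var (suc zero)) ⊑ wkT (wkT t)))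

leq : ∀ {n} → Tm n → Tm n → Fm n
leq s t = (oneᵗ ×ᵗ s) ⊑ (oneᵗ ×ᵗ t)

⌜_⌝₀ : ∀ {n} → Σb0 n → Fm n
⌜ eqᵇ s t ⌝₀    = s ≐ t
⌜ preᵇ s t ⌝₀   = s ⊑ t
⌜ flipᵇ t ⌝₀    = flip t
⌜ notᵇ A ⌝₀     = ¬ᶠ ⌜ A ⌝₀
⌜ andᵇ A B ⌝₀   = ⌜ A ⌝₀ ∧ᶠ ⌜ B ⌝₀
⌜ orᵇ A B ⌝₀    = ⌜ A ⌝₀ ∨ᶠ ⌜ B ⌝₀
⌜ impᵇ A B ⌝₀   = ⌜ A ⌝₀ ⇒ ⌜ B ⌝₀
⌜ allSub t A ⌝₀ = ∀ᶠ (subwordOf t ⇒ ⌜ A ⌝₀)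
⌜ exSub t A ⌝₀  = ∃ᶠ (subwordOf t ∧ᶠ ⌜ A ⌝₀)

⌜_⌝₁ : ∀ {n} → Σb1 n → Fm n
⌜ base G ⌝₁   = ⌜ G ⌝₀
⌜ exLe t A ⌝₁ = ∃ᶠ (leq (var zero) (wkT t) ∧ᶠ ⌜ A ⌝₁)

-- The theory RS^1_2: Ferreira-style basic axioms (as schemata over
-- arbitrary terms, equivalent to universally closed axioms) and
-- induction on notation for Σ^b_1 formulas (with parameters).

atSucc : ∀ {n} → Bool → Fm (suc n) → Fm (suc n)
atSucc b B = subF (λ { zero → var zero ⌢ᵗ bitᵗ b ; (suc i) → var (suc i) }) B

indInst : ∀ {n} → Fm (suc n) → Fm n
indInst B =
  ((B [ eps ]) ∧ᶠ ∀ᶠ (B ⇒ (atSucc false B ∧ᶠ atSucc true B))) ⇒ ∀ᶠ B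

data Axiom {n : ℕ} : Fm n → Set where
  B1 : ∀ x → Axiom ((x ⌢ᵗ eps) ≐ x)
  B2 : ∀ x y b → Axiom ((x ⌢ᵗ (y ⌢ᵗ bitᵗ b)) ≐ ((x ⌢ᵗ y) ⌢ᵗ bitᵗ b))
  B3 : ∀ x → Axiom ((x ×ᵗ eps) ≐ eps)
  B4 : ∀ x y b → Axiom ((x ×ᵗ (y ⌢ᵗ bitᵗ b)) ≐ ((x ×ᵗ y) ⌢ᵗ x))
  B5 : ∀ x → Axiom ((x ⊑ eps) ⇔ᶠ (x ≐ eps))
  B6 : ∀ x y b → Axiom ((x ⊑ (y ⌢ᵗ bitᵗ b)) ⇔ᶠ ((x ⊑ y) ∨ᶠ (x ≐ (y ⌢ᵗ bitᵗ b))))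
  B7 : ∀ x y b → Axiom (((x ⌢ᵗ bitᵗ b) ≐ (y ⌢ᵗ bitᵗ b)) ⇒ (x ≐ y))
  B8 : ∀ x y → Axiom (¬ᶠ ((x ⌢ᵗ zeroᵗ) ≐ (y ⌢ᵗ oneᵗ)))
  B9 : ∀ x b → Axiom (¬ᶠ ((x ⌢ᵗ bitᵗ b) ≐ eps))
  IND : (B : Σb1 (suc n)) → Axiom (indInst ⌜ B ⌝₁)

infix 3 _⊢_
data _⊢_ : {n : ℕ} → List (Fm n) → Fm n → Set where
  ax   : ∀ {n} {Γ : List (Fm n)} {A} → Axiom A → Γ ⊢ A
  hyp  : ∀ {n} {Γ : List (Fm n)} {A} → A ∈ Γ → Γ ⊢ A
  ⇒I   : ∀ {n} {Γ : List (Fm n)} {A B} → (A ∷ Γ) ⊢ B → Γ ⊢ A ⇒ B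
  ⇒E   : ∀ {n} {Γ : List (Fm n)} {A B} → Γ ⊢ A ⇒ B → Γ ⊢ A → Γ ⊢ B
  ∧I   : ∀ {n} {Γ : List (Fm n)} {A B} → Γ ⊢ A → Γ ⊢ B → Γ ⊢ A ∧ᶠ B
  ∧E₁  : ∀ {n} {Γ : List (Fm n)} {A B} → Γ ⊢ A ∧ᶠ B → Γ ⊢ A
  ∧E₂  : ∀ {n} {Γ : List (Fm n)} {A B} → Γ ⊢ A ∧ᶠ B → Γ ⊢ B
  ∨I₁  : ∀ {n} {Γ : List (Fm n)} {A B} → Γ ⊢ A → Γ ⊢ A ∨ᶠ B
  ∨I₂  : ∀ {n} {Γ : List (Fm n)} {A B} → Γ ⊢ B → Γ ⊢ A ∨ᶠ B
  ∨E   : ∀ {n} {Γ : List (Fm n)} {A B C} →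
         Γ ⊢ A ∨ᶠ B → (A ∷ Γ) ⊢ C → (B ∷ Γ) ⊢ C → Γ ⊢ C
  ⊥E   : ∀ {n} {Γ : List (Fm n)} {A} → Γ ⊢ ⊥ᶠ → Γ ⊢ A
  raa  : ∀ {n} {Γ : List (Fm n)} {A} → (¬ᶠ A ∷ Γ) ⊢ ⊥ᶠ → Γ ⊢ A
  ∀I   : ∀ {n} {Γ : List (Fm n)} {A} → map wkF Γ ⊢ A → Γ ⊢ ∀ᶠ A
  ∀E   : ∀ {n} {Γ : List (Fm n)} {A} → Γ ⊢ ∀ᶠ A → (t : Tm n) → Γ ⊢ A [ t ]
  ∃I   : ∀ {n} {Γ : List (Fm n)} {A} → (t : Tm n) → Γ ⊢ A [ t ] → Γ ⊢ ∃ᶠ A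
  ∃E   : ∀ {n} {Γ : List (Fm n)} {A C} →
         Γ ⊢ ∃ᶠ A → (A ∷ map wkF Γ) ⊢ wkF C → Γ ⊢ C
  ≐refl  : ∀ {n} {Γ : List (Fm n)} (t : Tm n) → Γ ⊢ t ≐ t
  ≐subst : ∀ {n} {Γ : List (Fm n)} (A : Fm (suc n)) {s t : Tm n} →
           Γ ⊢ s ≐ t → Γ ⊢ A [ s ] → Γ ⊢ A [ t ]

RS : Fm 0 → Set
RS A = [] ⊢ A

evalT : ∀ {n} → Vec Str n → Tm n → Str
evalT ρ (var i)  = lookup ρ i
evalT ρ eps      = ε
evalT ρ zeroᵗ    = ε · false
evalT ρ oneᵗ     = ε · true
evalT ρ (s ⌢ᵗ t) = evalT ρ s ⌢ evalT ρ t
evalT ρ (s ×ᵗ t) = evalT ρ s ⊗ evalT ρ t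

Sat : ∀ {n} → Oracle → Vec Str n → Fm n → Set
Sat η ρ (s ≐ t)  = evalT ρ s ≡ evalT ρ t
Sat η ρ (s ⊑ t)  = Prefix (evalT ρ s) (evalT ρ t)
Sat η ρ (flip t) = η (evalT ρ t) ≡ true
Sat η ρ ⊥ᶠ       = ⊥
Sat η ρ (A ∧ᶠ B) = Sat η ρ A × Sat η ρ B
Sat η ρ (A ∨ᶠ B) = Sat η ρ A ⊎ Sat η ρ B
Sat η ρ (A ⇒ B)  = Sat η ρ A → Sat η ρ B
Sat η ρ (∀ᶠ A)   = (x : Str) → Sat η (x ∷ ρ) A
Sat η ρ (∃ᶠ A)   = Σ Str (λ x → Sat η (x ∷ ρ) A)

InInterp : Oracle → Fm 0 → Set
InInterp η A = Sat η [] A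

data POR : ℕ → Set where
  E    : ∀ {n} → POR n
  P    : ∀ {n} → Fin n → POR n
  S    : Bool → POR 1
  C    : POR 4
  Q    : POR 1
  comp : ∀ {m n} → POR m → (Fin m → POR n) → POR n
  rec  : ∀ {n} → POR n → (Bool → POR (suc (suc n))) → Tm (suc n) → POR (suc n)

cond : Str → Str → Str → Str → Str
cond ε       y z₀ z₁ = y
cond (x · false) y z₀ z₁ = z₀
cond (x · true)  y z₀ z₁ = z₁

mutual
  ⟦_⟧ : ∀ {n} → POR n → Vec Str n → Oracle → Str
  ⟦ E ⟧ v η                          = ε
  ⟦ P i ⟧ v η                        = lookup v i
  ⟦ S b ⟧ (x ∷ []) η                 = x · b
  ⟦ C ⟧ (x ∷ y ∷ z₀ ∷ z₁ ∷ []) η     = cond x y z₀ z₁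
  ⟦ Q ⟧ (x ∷ []) η                   = ε · η x
  ⟦ comp h g ⟧ v η                   = ⟦ h ⟧ (tabulate (λ i → ⟦ g i ⟧ v η)) η
  ⟦ rec g h t ⟧ v η                  = recSem g h t (init v) (last v) η

  recSem : ∀ {n} → POR n → (Bool → POR (suc (suc n))) → Tm (suc n) →
           Vec Str n → Str → Oracle → Str
  recSem g h t xs ε η       = ⟦ g ⟧ xs η
  recSem g h t xs (y · b) η =
    trunc (⟦ h b ⟧ ((xs ∷ʳ y) ∷ʳ recSem g h t xs y η) η) (evalT (xs ∷ʳ y) t)

InPOR : ∀ {k} → (Vec Str k → Oracle → Str) → Set
InPOR {k} f = Σ (POR k) (λ p → (v : Vec Str k) (η : Oracle) → ⟦ p ⟧ v η ≡ f v η)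

-- Σ^b_1-representability.  F : Σb1 (suc k), variable 0 is y, variable
-- (suc i) is x_i.

allN : ∀ k → Fm k → Fm 0
allN zero    A = A
allN (suc k) A = allN k (∀ᶠ A)

Totality : ∀ {k} → Σb1 (suc k) → Fm 0
Totality {k} F = allN k (∃ᶠ ⌜ F ⌝₁)

Uniqueness : ∀ {k} → Σb1 (suc k) → Fm 0
Uniqueness {k} F =
  allN k (∀ᶠ (∀ᶠ ((renF ρy ⌜ F ⌝₁ ∧ᶠ renF ρz ⌜ F ⌝₁) ⇒ (var (suc zero) ≐ var zero))))
  where
  ρy : Fin (suc k) → Fin (suc (suc k))
  ρy zero    = suc zero
  ρy (suc i) = suc (suc i)
  ρz : Fin (suc k) → Fin (suc (suc k))
  ρz zero    = zero
  ρz (suc i) = suc (suc i)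

instF : ∀ {k} → Σb1 (suc k) → Vec Str k → Str → Fm 0
instF F σ τ = subF (λ { zero → num τ ; (suc i) → num (lookup σ i) }) ⌜ F ⌝₁

Represents : ∀ {k} → (Vec Str k → Oracle → Str) → Σb1 (suc k) → Set
Represents {k} f F =
  RS (Totality F) ×
  RS (Uniqueness F) ×
  ((σ : Vec Str k) (τ : Str) (η : Oracle) →
     (f σ η ≡ τ → InInterp η (instF F σ τ)) ×
     (InInterp η (instF F σ τ) → f σ η ≡ τ))

Representable : ∀ {k} → (Vec Str k → Oracle → Str) → Set
Representable {k} f = Σ (Σb1 (suc k)) (λ F → Represents f F)

{-# OPTIONS --safe #-}

-- From representability to POR, the totality proof is interpreted in a Kripke
-- model whose worlds consist of generic strings and an assumption of the form
-- "no string satisfies χ", χ decidable in POR; falsity is forced when a POR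
-- function computes a counterexample to the assumption.  Σb0 formulas are forced
-- iff they are true up to counterexamples, a forced Σb1 formula yields a POR
-- witness (assume that there is none), and so induction on notation is realized
-- by bounded recursion.  Classical logic costs nothing because ∨ and ∃ are
-- interpreted negatively.
--
-- From POR to representability, RS is only asked to prove that for every Σb0
-- formula φ and every length there is exactly one string each of whose bits is
-- given by φ from the bits before it.  A POR function is then represented by
-- "the unique subword z of this string such that D holds, and ε if there is none
-- or more than one": totality and uniqueness of such descriptions are pure logic.
-- That every POR function is computed in this way is a purely semantic statement,
-- proved by concatenating bit sequences.

module Submission where

open import Defs
open import Data.Nat using (ℕ; zero; suc; _+_; _*_; _∸_; _≤_; _<_; z≤n; s≤s)
open import Data.Nat.Properties
open import Data.Bool using (Bool; true; false; if_then_else_; not; _∧_; _∨_)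
open import Data.Fin using (Fin; zero; suc; _↑ʳ_; _↑ˡ_; inject₁; fromℕ)
open import Data.Fin.Patterns using (1F; 2F; 3F; 4F)
open import Data.Vec using (Vec; []; _∷_; lookup; tabulate; init; last; initLast; _∷ʳ_; head; tail; _++_)
open import Data.Vec.Properties using (lookup∘tabulate; tabulate∘lookup; tabulate-cong; init-∷ʳ;
    last-∷ʳ; lookup-++ˡ; lookup-++ʳ)
open import Data.List using (List; []; _∷_; map)
open import Data.List.Membership.Propositional using (_∈_)
open import Data.List.Membership.Propositional.Properties using (∈-map⁻; ∈-map⁺)
open import Data.List.Relation.Unary.Any using (here; there)
open import Data.Product using (Σ; _×_; _,_; proj₁; proj₂)
open import Data.Sum using (_⊎_; inj₁; inj₂)
import Data.Sum
open import Data.Empty using (⊥; ⊥-elim)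
open import Relation.Nullary using (¬_)
open import Relation.Binary.PropositionalEquality hiding ([_])
open import Function using (_∘_)

-- Strings

-- The model is a Friedman translation in which falsity is not one fixed formula: every world brings
-- its own set of violations, and a further one is added whenever a particular witness is wanted.
-- Violations have to be computed uniformly in the generic strings and the oracle, and the tests
-- that combine them must be POR as well; this is why forcing, truth and witnesses are all
-- accompanied by POR membership, and why the realizer of induction needs a term bounding its
-- values. In the converse direction the obstacle is that recursion equations are laborious to
-- derive in RS. Representability asks RS for totality and uniqueness only; agreement with the
-- function is a statement about the standard model. Hence the formula may be total and
-- single-valued for reasons unrelated to the function, and that its default case never arises is
-- checked outside RS. Subword quantifiers reach only what is already written down, so a whole
-- computation is laid out in one bit sequence, and each part must be located in it by its length or
-- by a marker.

len-⌢ : ∀ x y → len (x ⌢ y) ≡ len x + len y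
len-⌢ x ε       = sym (+-identityʳ (len x))
len-⌢ x (y · b) = trans (cong suc (len-⌢ x y)) (sym (+-suc (len x) (len y)))

len-⊗ : ∀ x y → len (x ⊗ y) ≡ len y * len x
len-⊗ x ε       = refl
len-⊗ x (y · b) = trans (len-⌢ (x ⊗ y) x)
                 (trans (cong (_+ len x) (len-⊗ x y)) (+-comm (len y * len x) (len x)))

⌢-assoc : ∀ x y z → (x ⌢ y) ⌢ z ≡ x ⌢ (y ⌢ z)
⌢-assoc x y ε       = refl
⌢-assoc x y (z · b) = cong (_· b) (⌢-assoc x y z)

⌢-identityˡ : ∀ x → ε ⌢ x ≡ x
⌢-identityˡ ε       = refl
⌢-identityˡ (x · b) = cong (_· b) (⌢-identityˡ x)

·-injectiveˡ : ∀ {x y b c} → x · b ≡ y · c → x ≡ y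
·-injectiveˡ refl = refl

·-injectiveʳ : ∀ {x y b c} → x · b ≡ y · c → b ≡ c
·-injectiveʳ refl = refl

⌢-injective : ∀ x y a b → x ⌢ a ≡ y ⌢ b → len x ≡ len y → x ≡ y × a ≡ b
⌢-injective x y ε ε e l = e , refl
⌢-injective x y (a · c) (b · d) e l
  with ⌢-injective x y a b (·-injectiveˡ e) l | ·-injectiveʳ e
... | p , q | r = p , cong₂ _·_ q r
⌢-injective x y ε (b · d) e l =
  ⊥-elim (m+1+n≢m (len y) (trans (sym (len-⌢ y (b · d))) (trans (cong len (sym e)) l)))
⌢-injective x y (a · c) ε e l =
  ⊥-elim (m+1+n≢m (len x) (trans (sym (len-⌢ x (a · c))) (trans (cong len e) (sym l))))

Prefix-refl : ∀ x → Prefix x x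
Prefix-refl x = ε , refl

Prefix-ε : ∀ x → Prefix ε x
Prefix-ε x = x , ⌢-identityˡ x

Prefix-trans : ∀ {x y z} → Prefix x y → Prefix y z → Prefix x z
Prefix-trans {x} (a , refl) (b , refl) = (a ⌢ b) , sym (⌢-assoc x a b)

Prefix-len : ∀ {x y} → Prefix x y → len x ≤ len y
Prefix-len {x} (a , refl) = ≤-trans (m≤m+n (len x) (len a)) (≤-reflexive (sym (len-⌢ x a)))

Prefix-unique : ∀ {x y z} → Prefix x z → Prefix y z → len x ≡ len y → x ≡ y
Prefix-unique {x} {y} (a , p) (b , q) l = proj₁ (⌢-injective x y a b (trans p (sym q)) l)

Prefix-snoc : ∀ {x y b} → Prefix x (y · b) → Prefix x y ⊎ (x ≡ y · b)
Prefix-snoc (ε , e)     = inj₂ e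
Prefix-snoc (a · c , e) = inj₁ (a , ·-injectiveˡ e)

Prefix-·ʳ : ∀ {x y} b → Prefix x y → Prefix x (y · b)
Prefix-·ʳ b (a , e) = (a · b) , cong (_· b) e

Prefix-·ˡ : ∀ {x y b} → Prefix (x · b) y → Prefix x y
Prefix-·ˡ {x} {b = b} = Prefix-trans ((ε · b) , refl)

Sub : Str → Str → Set
Sub x t = Σ Str λ w → Prefix w t × Prefix (w ⌢ x) t

Prefix⇒Sub : ∀ {x y} → Prefix x y → Sub x y
Prefix⇒Sub {x} {y} p = ε , Prefix-ε y , subst (λ z → Prefix z y) (sym (⌢-identityˡ x)) p

Suffix⇒Sub : ∀ x y → Sub y (x ⌢ y)
Suffix⇒Sub x y = x , (y , refl) , Prefix-refl (x ⌢ y)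

Sub-ε : ∀ x → Sub ε x
Sub-ε x = Prefix⇒Sub (Prefix-ε x)

Sub-Prefix : ∀ {x y z} → Sub x y → Prefix y z → Sub x z
Sub-Prefix (w , p , q) r = w , Prefix-trans p r , Prefix-trans q r

Sub-⌢ : ∀ {x y} z → Sub x y → Sub x (z ⌢ y)
Sub-⌢ {x} z (w , (a , refl) , (b , e)) =
  (z ⌢ w) , (a , ⌢-assoc z w a) ,
  (b , trans (cong (_⌢ b) (⌢-assoc z w x)) (trans (⌢-assoc z (w ⌢ x) b) (cong (z ⌢_) e)))

Sub-len : ∀ {x y} → Sub x y → len x ≤ len y
Sub-len {x} (w , _ , p) = ≤-trans (≤-trans (m≤n+m (len x) (len w)) (≤-reflexive (sym (len-⌢ w x))))
    (Prefix-len p)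

-- Length in unary: the language has no length function, and `leq` and `lenᵇ` compare lengths
-- through this product.
ones : Str → Str
ones x = (ε · true) ⊗ x

len-ones : ∀ x → len (ones x) ≡ len x
len-ones x = trans (len-⊗ (ε · true) x) (*-identityʳ (len x))

ones-cong : ∀ x y → len x ≡ len y → ones x ≡ ones y
ones-cong ε ε e = refl
ones-cong (x · b) (y · c) e = cong (_· true) (ones-cong x y (suc-injective e))

ones-inj : ∀ x y → ones x ≡ ones y → len x ≡ len y
ones-inj x y e = trans (sym (len-ones x)) (trans (cong len e) (len-ones y))

leq⇒≤ : ∀ x y → Prefix (ones x) (ones y) → len x ≤ len y
leq⇒≤ x y p = subst₂ _≤_ (len-ones x) (len-ones y) (Prefix-len p)

≤⇒leq : ∀ x y → len x ≤ len y → Prefix (ones x) (ones y)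
≤⇒leq x ε p = subst (λ z → Prefix z ε) (sym (ones-cong x ε (n≤0⇒n≡0 p))) (Prefix-refl ε)
≤⇒leq x (y · b) p with m≤n⇒m<n∨m≡n p
... | inj₁ (s≤s q) = Prefix-·ʳ true (≤⇒leq x y q)
... | inj₂ q       = subst (λ z → Prefix z (ones (y · b))) (sym (ones-cong x (y · b) q)) (Prefix-refl _)

-- Substitution

infixr 1 _⟺_
_⟺_ : Set → Set → Set
A ⟺ B = (A → B) × (B → A)

subT-cong : ∀ {m n} {σ τ : Fin m → Tm n} → (∀ i → σ i ≡ τ i) → ∀ t → subT σ t ≡ subT τ t
subT-cong e (var i)  = e i
subT-cong e eps      = refl
subT-cong e zeroᵗ    = refl
subT-cong e oneᵗ     = refl
subT-cong e (s ⌢ᵗ t) = cong₂ _⌢ᵗ_ (subT-cong e s) (subT-cong e t)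
subT-cong e (s ×ᵗ t) = cong₂ _×ᵗ_ (subT-cong e s) (subT-cong e t)

renT-subT : ∀ {m n} (ρ : Fin m → Fin n) t → renT ρ t ≡ subT (var ∘ ρ) t
renT-subT ρ (var i)  = refl
renT-subT ρ eps      = refl
renT-subT ρ zeroᵗ    = refl
renT-subT ρ oneᵗ     = refl
renT-subT ρ (s ⌢ᵗ t) = cong₂ _⌢ᵗ_ (renT-subT ρ s) (renT-subT ρ t)
renT-subT ρ (s ×ᵗ t) = cong₂ _×ᵗ_ (renT-subT ρ s) (renT-subT ρ t)

subT-subT : ∀ {k m n} (σ : Fin k → Tm m) (τ : Fin m → Tm n) t →
            subT τ (subT σ t) ≡ subT (subT τ ∘ σ) t
subT-subT σ τ (var i)  = refl
subT-subT σ τ eps      = refl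
subT-subT σ τ zeroᵗ    = refl
subT-subT σ τ oneᵗ     = refl
subT-subT σ τ (s ⌢ᵗ t) = cong₂ _⌢ᵗ_ (subT-subT σ τ s) (subT-subT σ τ t)
subT-subT σ τ (s ×ᵗ t) = cong₂ _×ᵗ_ (subT-subT σ τ s) (subT-subT σ τ t)

subT-var : ∀ {n} (t : Tm n) → subT var t ≡ t
subT-var (var i)  = refl
subT-var eps      = refl
subT-var zeroᵗ    = refl
subT-var oneᵗ     = refl
subT-var (s ⌢ᵗ t) = cong₂ _⌢ᵗ_ (subT-var s) (subT-var t)
subT-var (s ×ᵗ t) = cong₂ _×ᵗ_ (subT-var s) (subT-var t)

subT-wkT : ∀ {m n} (σ : Fin (suc m) → Tm n) t → subT σ (wkT t) ≡ subT (σ ∘ suc) t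
subT-wkT σ t = trans (cong (subT σ) (renT-subT suc t)) (subT-subT (var ∘ suc) σ t)

wkT-subT : ∀ {m n} (σ : Fin m → Tm n) t → wkT (subT σ t) ≡ subT (wkT ∘ σ) t
wkT-subT σ t = trans (renT-subT suc (subT σ t))
              (trans (subT-subT σ (var ∘ suc) t) (subT-cong (λ i → sym (renT-subT suc (σ i))) t))

liftS-cong : ∀ {m n} {σ τ : Fin m → Tm n} → (∀ i → σ i ≡ τ i) → ∀ i → liftS σ i ≡ liftS τ i
liftS-cong e zero    = refl
liftS-cong e (suc i) = cong wkT (e i)

liftS-liftS : ∀ {k m n} (σ : Fin k → Tm m) (τ : Fin m → Tm n) i →
              subT (liftS τ) (liftS σ i) ≡ liftS (subT τ ∘ σ) i
liftS-liftS σ τ zero    = refl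
liftS-liftS σ τ (suc i) = trans (subT-wkT (liftS τ) (σ i)) (sym (wkT-subT τ (σ i)))

subF-cong : ∀ {m n} {σ τ : Fin m → Tm n} → (∀ i → σ i ≡ τ i) → ∀ A → subF σ A ≡ subF τ A
subF-cong e (s ≐ t)  = cong₂ _≐_ (subT-cong e s) (subT-cong e t)
subF-cong e (s ⊑ t)  = cong₂ _⊑_ (subT-cong e s) (subT-cong e t)
subF-cong e (flip t) = cong flip (subT-cong e t)
subF-cong e ⊥ᶠ       = refl
subF-cong e (A ∧ᶠ B) = cong₂ _∧ᶠ_ (subF-cong e A) (subF-cong e B)
subF-cong e (A ∨ᶠ B) = cong₂ _∨ᶠ_ (subF-cong e A) (subF-cong e B)
subF-cong e (A ⇒ B)  = cong₂ _⇒_ (subF-cong e A) (subF-cong e B)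
subF-cong e (∀ᶠ A)   = cong ∀ᶠ (subF-cong (liftS-cong e) A)
subF-cong e (∃ᶠ A)   = cong ∃ᶠ (subF-cong (liftS-cong e) A)

liftS-var : ∀ {m n} (ρ : Fin m → Fin n) i → var (liftR ρ i) ≡ liftS (var ∘ ρ) i
liftS-var ρ zero    = refl
liftS-var ρ (suc i) = refl

renF-subF : ∀ {m n} (ρ : Fin m → Fin n) A → renF ρ A ≡ subF (var ∘ ρ) A
renF-subF ρ (s ≐ t)  = cong₂ _≐_ (renT-subT ρ s) (renT-subT ρ t)
renF-subF ρ (s ⊑ t)  = cong₂ _⊑_ (renT-subT ρ s) (renT-subT ρ t)
renF-subF ρ (flip t) = cong flip (renT-subT ρ t)
renF-subF ρ ⊥ᶠ       = refl
renF-subF ρ (A ∧ᶠ B) = cong₂ _∧ᶠ_ (renF-subF ρ A) (renF-subF ρ B)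
renF-subF ρ (A ∨ᶠ B) = cong₂ _∨ᶠ_ (renF-subF ρ A) (renF-subF ρ B)
renF-subF ρ (A ⇒ B)  = cong₂ _⇒_ (renF-subF ρ A) (renF-subF ρ B)
renF-subF ρ (∀ᶠ A)   = cong ∀ᶠ (trans (renF-subF (liftR ρ) A) (subF-cong (liftS-var ρ) A))
renF-subF ρ (∃ᶠ A)   = cong ∃ᶠ (trans (renF-subF (liftR ρ) A) (subF-cong (liftS-var ρ) A))

subF-subF : ∀ {k m n} (σ : Fin k → Tm m) (τ : Fin m → Tm n) A →
            subF τ (subF σ A) ≡ subF (subT τ ∘ σ) A
subF-subF σ τ (s ≐ t)  = cong₂ _≐_ (subT-subT σ τ s) (subT-subT σ τ t)
subF-subF σ τ (s ⊑ t)  = cong₂ _⊑_ (subT-subT σ τ s) (subT-subT σ τ t)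
subF-subF σ τ (flip t) = cong flip (subT-subT σ τ t)
subF-subF σ τ ⊥ᶠ       = refl
subF-subF σ τ (A ∧ᶠ B) = cong₂ _∧ᶠ_ (subF-subF σ τ A) (subF-subF σ τ B)
subF-subF σ τ (A ∨ᶠ B) = cong₂ _∨ᶠ_ (subF-subF σ τ A) (subF-subF σ τ B)
subF-subF σ τ (A ⇒ B)  = cong₂ _⇒_ (subF-subF σ τ A) (subF-subF σ τ B)
subF-subF σ τ (∀ᶠ A)   = cong ∀ᶠ (trans (subF-subF (liftS σ) (liftS τ) A) (subF-cong (liftS-liftS σ τ) A))
subF-subF σ τ (∃ᶠ A)   = cong ∃ᶠ (trans (subF-subF (liftS σ) (liftS τ) A) (subF-cong (liftS-liftS σ τ) A))

subF-var : ∀ {n} (A : Fm n) → subF var A ≡ A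
subF-var (s ≐ t)  = cong₂ _≐_ (subT-var s) (subT-var t)
subF-var (s ⊑ t)  = cong₂ _⊑_ (subT-var s) (subT-var t)
subF-var (flip t) = cong flip (subT-var t)
subF-var ⊥ᶠ       = refl
subF-var (A ∧ᶠ B) = cong₂ _∧ᶠ_ (subF-var A) (subF-var B)
subF-var (A ∨ᶠ B) = cong₂ _∨ᶠ_ (subF-var A) (subF-var B)
subF-var (A ⇒ B)  = cong₂ _⇒_ (subF-var A) (subF-var B)
subF-var (∀ᶠ A)   = cong ∀ᶠ (trans (subF-cong (λ { zero → refl ; (suc i) → refl }) A) (subF-var A))
subF-var (∃ᶠ A)   = cong ∃ᶠ (trans (subF-cong (λ { zero → refl ; (suc i) → refl }) A) (subF-var A))

-- Evaluation and satisfaction under substitution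

evalT-subT : ∀ {m n} {v : Vec Str n} {v′ : Vec Str m} (σ : Fin m → Tm n) →
             (∀ i → lookup v′ i ≡ evalT v (σ i)) → ∀ t → evalT v (subT σ t) ≡ evalT v′ t
evalT-subT σ e (var i)  = sym (e i)
evalT-subT σ e eps      = refl
evalT-subT σ e zeroᵗ    = refl
evalT-subT σ e oneᵗ     = refl
evalT-subT σ e (s ⌢ᵗ t) = cong₂ _⌢_ (evalT-subT σ e s) (evalT-subT σ e t)
evalT-subT σ e (s ×ᵗ t) = cong₂ _⊗_ (evalT-subT σ e s) (evalT-subT σ e t)

evalT-wkT : ∀ {n} x (v : Vec Str n) t → evalT (x ∷ v) (wkT t) ≡ evalT v t
evalT-wkT x v t = trans (cong (evalT (x ∷ v)) (renT-subT suc t)) (evalT-subT (var ∘ suc) (λ i → refl) t)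

evalT-liftS : ∀ {m n} {v : Vec Str n} {v′ : Vec Str m} (σ : Fin m → Tm n) →
              (∀ i → lookup v′ i ≡ evalT v (σ i)) →
              ∀ x i → lookup (x ∷ v′) i ≡ evalT (x ∷ v) (liftS σ i)
evalT-liftS σ e x zero            = refl
evalT-liftS {v = v} σ e x (suc i) = trans (e i) (sym (evalT-wkT x v (σ i)))

-- Concatenation adds lengths and the product multiplies them. Thus arguments may be replaced by
-- their bounds inside a term, and term bounds compose.
evalT-mono : ∀ {n} (v w : Vec Str n) → (∀ i → len (lookup v i) ≤ len (lookup w i)) →
             ∀ t → len (evalT v t) ≤ len (evalT w t)
evalT-mono v w e (var i)  = e i
evalT-mono v w e eps      = ≤-refl
evalT-mono v w e zeroᵗ    = ≤-refl
evalT-mono v w e oneᵗ     = ≤-refl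
evalT-mono v w e (s ⌢ᵗ t)
  rewrite len-⌢ (evalT v s) (evalT v t) | len-⌢ (evalT w s) (evalT w t) =
  +-mono-≤ (evalT-mono v w e s) (evalT-mono v w e t)
evalT-mono v w e (s ×ᵗ t)
  rewrite len-⊗ (evalT v s) (evalT v t) | len-⊗ (evalT w s) (evalT w t) =
  *-mono-≤ (evalT-mono v w e t) (evalT-mono v w e s)

-- The two environments are related only pointwise, so that instances, renamings and permutations of
-- variables are all covered, mostly with `refl` as the hypothesis.
Sat-subF : ∀ {η m n} {v : Vec Str n} {v′ : Vec Str m} (σ : Fin m → Tm n) →
           (∀ i → lookup v′ i ≡ evalT v (σ i)) → ∀ A → Sat η v (subF σ A) ⟺ Sat η v′ A
Sat-subF σ e (s ≐ t) rewrite evalT-subT σ e s | evalT-subT σ e t = (λ z → z) , (λ z → z)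
Sat-subF σ e (s ⊑ t) rewrite evalT-subT σ e s | evalT-subT σ e t = (λ z → z) , (λ z → z)
Sat-subF σ e (flip t) rewrite evalT-subT σ e t = (λ z → z) , (λ z → z)
Sat-subF σ e ⊥ᶠ = (λ z → z) , (λ z → z)
Sat-subF σ e (A ∧ᶠ B) with Sat-subF σ e A | Sat-subF σ e B
... | a , a′ | b , b′ = (λ (x , y) → a x , b y) , (λ (x , y) → a′ x , b′ y)
Sat-subF σ e (A ∨ᶠ B) with Sat-subF σ e A | Sat-subF σ e B
... | a , a′ | b , b′ = Data.Sum.map a b , Data.Sum.map a′ b′
Sat-subF σ e (A ⇒ B) with Sat-subF σ e A | Sat-subF σ e B
... | a , a′ | b , b′ = (λ f x → b (f (a′ x))) , (λ f x → b′ (f (a x)))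
Sat-subF σ e (∀ᶠ A) =
  (λ f x → proj₁ (Sat-subF (liftS σ) (evalT-liftS σ e x) A) (f x)) ,
  (λ f x → proj₂ (Sat-subF (liftS σ) (evalT-liftS σ e x) A) (f x))
Sat-subF σ e (∃ᶠ A) =
  (λ (x , p) → x , proj₁ (Sat-subF (liftS σ) (evalT-liftS σ e x) A) p) ,
  (λ (x , p) → x , proj₂ (Sat-subF (liftS σ) (evalT-liftS σ e x) A) p)

-- Representing formulas must be given as syntax in `Σb0` and `Σb1`, so substitution is repeated at
-- that level and compared with `subF` afterwards.
sub₀ : ∀ {m n} → (Fin m → Tm n) → Σb0 m → Σb0 n
sub₀ σ (eqᵇ s t)    = eqᵇ (subT σ s) (subT σ t)
sub₀ σ (preᵇ s t)   = preᵇ (subT σ s) (subT σ t)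
sub₀ σ (flipᵇ t)    = flipᵇ (subT σ t)
sub₀ σ (notᵇ A)     = notᵇ (sub₀ σ A)
sub₀ σ (andᵇ A B)   = andᵇ (sub₀ σ A) (sub₀ σ B)
sub₀ σ (orᵇ A B)    = orᵇ (sub₀ σ A) (sub₀ σ B)
sub₀ σ (impᵇ A B)   = impᵇ (sub₀ σ A) (sub₀ σ B)
sub₀ σ (allSub t A) = allSub (subT σ t) (sub₀ (liftS σ) A)
sub₀ σ (exSub t A)  = exSub (subT σ t) (sub₀ (liftS σ) A)

subT-liftS²-wkT² : ∀ {m n} (σ : Fin m → Tm n) t →
                   subT (liftS (liftS σ)) (wkT (wkT t)) ≡ wkT (wkT (subT σ t))
subT-liftS²-wkT² σ t =
  trans (subT-wkT (liftS (liftS σ)) (wkT t))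
 (trans (subT-wkT (wkT ∘ liftS σ) t)
 (sym (trans (cong wkT (wkT-subT σ t)) (wkT-subT (wkT ∘ σ) t))))

subF-subwordOf : ∀ {m n} (σ : Fin m → Tm n) t →
                 subF (liftS σ) (subwordOf t) ≡ subwordOf (subT σ t)
subF-subwordOf σ t rewrite subT-liftS²-wkT² σ t = refl

⌜sub₀⌝ : ∀ {m n} (σ : Fin m → Tm n) A → ⌜ sub₀ σ A ⌝₀ ≡ subF σ ⌜ A ⌝₀
⌜sub₀⌝ σ (eqᵇ s t)    = refl
⌜sub₀⌝ σ (preᵇ s t)   = refl
⌜sub₀⌝ σ (flipᵇ t)    = refl
⌜sub₀⌝ σ (notᵇ A)     = cong (_⇒ ⊥ᶠ) (⌜sub₀⌝ σ A)
⌜sub₀⌝ σ (andᵇ A B)   = cong₂ _∧ᶠ_ (⌜sub₀⌝ σ A) (⌜sub₀⌝ σ B)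
⌜sub₀⌝ σ (orᵇ A B)    = cong₂ _∨ᶠ_ (⌜sub₀⌝ σ A) (⌜sub₀⌝ σ B)
⌜sub₀⌝ σ (impᵇ A B)   = cong₂ _⇒_ (⌜sub₀⌝ σ A) (⌜sub₀⌝ σ B)
⌜sub₀⌝ σ (allSub t A) = cong ∀ᶠ (cong₂ _⇒_ (sym (subF-subwordOf σ t)) (⌜sub₀⌝ (liftS σ) A))
⌜sub₀⌝ σ (exSub t A)  = cong ∃ᶠ (cong₂ _∧ᶠ_ (sym (subF-subwordOf σ t)) (⌜sub₀⌝ (liftS σ) A))

Sat₀ : ∀ {n} → Oracle → Vec Str n → Σb0 n → Set
Sat₀ η v A = Sat η v ⌜ A ⌝₀

Sat-sub₀ : ∀ {η m n} {v : Vec Str n} {v′ : Vec Str m} (σ : Fin m → Tm n) →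
           (∀ i → lookup v′ i ≡ evalT v (σ i)) → ∀ A → Sat₀ η v (sub₀ σ A) ⟺ Sat₀ η v′ A
Sat-sub₀ σ e A rewrite ⌜sub₀⌝ σ A = Sat-subF σ e ⌜ A ⌝₀

-- Closure properties of POR

Fn : ℕ → Set
Fn n = Vec Str n → Oracle → Str

Map : ℕ → ℕ → Set
Map n m = Vec Str n → Oracle → Vec Str m

record InPORs {n m} (ρ : Map n m) : Set where
  constructor components
  field component : (i : Fin m) → InPOR (λ v η → lookup (ρ v η) i)
open InPORs

opaque
  InPOR-ext : ∀ {n} {f g : Fn n} → (∀ v η → f v η ≡ g v η) → InPOR f → InPOR g
  InPOR-ext e (p , q) = p , λ v η → trans (q v η) (e v η)

  por-var : ∀ {n} (i : Fin n) → InPOR (λ v η → lookup v i)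
  por-var i = P i , λ v η → refl

  por-ε : ∀ {n} → InPOR {n} (λ v η → ε)
  por-ε = E , λ v η → refl

  por-comp : ∀ {n m} {h : Fn m} {ρ : Map n m} → InPOR h → InPORs ρ → InPOR (λ v η → h (ρ v η) η)
  por-comp {ρ = ρ} (p , e) q = comp p (λ i → proj₁ (component q i)) , λ v η →
    trans (cong (λ w → ⟦ p ⟧ w η)
            (trans (tabulate-cong (λ i → proj₂ (component q i) v η)) (tabulate∘lookup (ρ v η))))
          (e _ η)

infixr 5 _∷ᵖ_
[]ᵖ : ∀ {n} → InPORs {n} (λ v η → [])
[]ᵖ = components λ ()

_∷ᵖ_ : ∀ {n m} {f : Fn n} {ρ : Map n m} → InPOR f → InPORs ρ → InPORs (λ v η → f v η ∷ ρ v η)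
p ∷ᵖ q = components λ { zero → p ; (suc i) → component q i }

pors-comp : ∀ {n m k} {ρ : Map m k} {σ : Map n m} → InPORs ρ → InPORs σ →
            InPORs (λ v η → ρ (σ v η) η)
pors-comp {ρ = ρ} p q = components λ i → por-comp (component p i) q

pors-id : ∀ {n} → InPORs {n} (λ v η → v)
pors-id = components por-var

pors-tail : ∀ {n m} {ρ : Map n (suc m)} → InPORs ρ → InPORs (λ v η → tail (ρ v η))
pors-tail {ρ = ρ} p = components λ i → InPOR-ext (λ v η → lem i (ρ v η)) (component p (suc i))
  where
  lem : ∀ i w → lookup w (suc i) ≡ lookup (tail w) i
  lem i (x ∷ w) = refl

por-head : ∀ {n} → InPOR {suc n} (λ v η → head v)
por-head = InPOR-ext (λ { (x ∷ v) η → refl }) (por-var zero)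

pors-1 : ∀ {n} {f : Fn n} → InPOR f → InPORs (λ v η → f v η ∷ [])
pors-1 {f = f} p = _∷ᵖ_ p []ᵖ

opaque
  por-snoc : ∀ {n} b {f : Fn n} → InPOR f → InPOR (λ v η → f v η · b)
  por-snoc b {f} p = por-comp {h = λ v η → head v · b} {ρ = λ v η → f v η ∷ []}
                      (S b , λ { (x ∷ []) η → refl }) (pors-1 {f = f} p)

  por-query : ∀ {n} {f : Fn n} → InPOR f → InPOR (λ v η → ε · η (f v η))
  por-query {f = f} p = por-comp {h = λ v η → ε · η (head v)} {ρ = λ v η → f v η ∷ []}
                         (Q , λ { (x ∷ []) η → refl }) (pors-1 {f = f} p)

  por-cond : ∀ {n} {f g h k : Fn n} → InPOR f → InPOR g → InPOR h → InPOR k →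
             InPOR (λ v η → cond (f v η) (g v η) (h v η) (k v η))
  por-cond (p , e) (q , e′) (r , e″) (s , e‴) =
    comp C (λ { zero → p ; 1F → q ; 2F → r ; 3F → s }) ,
    λ v η → lem (e v η) (e′ v η) (e″ v η) (e‴ v η)
    where
    lem : ∀ {x x′ y y′ z z′ w w′} → x ≡ x′ → y ≡ y′ → z ≡ z′ → w ≡ w′ → cond x y z w ≡ cond x′ y′ z′ w′
    lem refl refl refl refl = refl

-- Bounded recursion on the first argument

lookup-inject₁ : ∀ {n} (v : Vec Str n) y i → lookup (v ∷ʳ y) (inject₁ i) ≡ lookup v i
lookup-inject₁ (x ∷ v) y zero    = refl
lookup-inject₁ (x ∷ v) y (suc i) = lookup-inject₁ v y i

lookup-fromℕ : ∀ {n} (v : Vec Str n) y → lookup (v ∷ʳ y) (fromℕ n) ≡ y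
lookup-fromℕ []      y = refl
lookup-fromℕ (x ∷ v) y = lookup-fromℕ v y

-- The recursion argument is the last one in Defs and the first one here;
-- rotate and unrotate translate between the two orders.
rotate : ∀ {n} → Fin (suc n) → Fin (suc n)
rotate {zero}  zero    = zero
rotate {suc n} zero    = suc zero
rotate {suc n} (suc i) with rotate i
... | zero  = zero
... | suc j = suc (suc j)

lookup-rotate : ∀ {n} (v : Vec Str n) y i → lookup (y ∷ v) (rotate i) ≡ lookup (v ∷ʳ y) i
lookup-rotate []      y zero    = refl
lookup-rotate (x ∷ v) y zero    = refl
lookup-rotate (x ∷ v) y (suc i) with rotate i | lookup-rotate v y i
... | zero  | e = e
... | suc j | e = e

unrotate : ∀ {n} → Fin (suc n) → Fin (suc n)
unrotate zero    = fromℕ _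
unrotate (suc i) = inject₁ i

lookup-unrotate : ∀ {n} (v : Vec Str n) y i → lookup (v ∷ʳ y) (unrotate i) ≡ lookup (y ∷ v) i
lookup-unrotate v y zero    = lookup-fromℕ v y
lookup-unrotate v y (suc i) = lookup-inject₁ v y i

tabulate-rotate : ∀ {n} (v : Vec Str n) y → tabulate (λ i → lookup (y ∷ v) (rotate i)) ≡ v ∷ʳ y
tabulate-rotate v y = trans (tabulate-cong (lookup-rotate v y)) (tabulate∘lookup (v ∷ʳ y))

trunc-id : ∀ x y → len x ≤ len y → trunc x y ≡ x
trunc-id x y l rewrite m≤n⇒m∸n≡0 l = refl

opaque
  -- The function is given beforehand, together with its recursion equations and a bound. The bound
  -- makes every truncation in `recSem` the identity, so no later construction has to deal with
  -- truncated values.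
  por-rec : ∀ {n} (F : Str → Fn n) (H : Bool → Fn (2 + n)) (t : Tm (suc n)) →
            InPOR (F ε) → (∀ b → InPOR (H b)) →
            (∀ y b v η → F (y · b) v η ≡ H b (F y v η ∷ y ∷ v) η) →
            (∀ y b v η → len (F (y · b) v η) ≤ len (evalT (y ∷ v) t)) →
            InPOR (λ v η → F (head v) (tail v) η)
  por-rec {n} F H t (g , g≡) h eq bd = comp (rec g h′ t′) (λ i → P (rotate i)) , main
    where
    σ : Fin (2 + n) → POR (2 + n)
    σ zero          = P (unrotate zero)
    σ 1F    = P (inject₁ (unrotate zero))
    σ (suc (suc i)) = P (inject₁ (inject₁ i))
    h′ : Bool → POR (2 + n)
    h′ b = comp (proj₁ (h b)) σ
    t′ : Tm (suc n)
    t′ = subT (var ∘ unrotate) t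
    σ≡ : ∀ v y s η → tabulate (λ i → ⟦ σ i ⟧ ((v ∷ʳ y) ∷ʳ s) η) ≡ s ∷ y ∷ v
    σ≡ v y s η = trans (tabulate-cong lem) (tabulate∘lookup (s ∷ y ∷ v))
      where
      lem : ∀ i → ⟦ σ i ⟧ ((v ∷ʳ y) ∷ʳ s) η ≡ lookup (s ∷ y ∷ v) i
      lem zero          = lookup-fromℕ (v ∷ʳ y) s
      lem 1F    = trans (lookup-inject₁ (v ∷ʳ y) s _) (lookup-fromℕ v y)
      lem (suc (suc i)) = trans (lookup-inject₁ (v ∷ʳ y) s _) (lookup-inject₁ v y i)
    t≡ : ∀ v y → evalT (v ∷ʳ y) t′ ≡ evalT (y ∷ v) t
    t≡ v y = evalT-subT (var ∘ unrotate) (λ i → sym (lookup-unrotate v y i)) t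
    run : ∀ v y η → recSem g h′ t′ v y η ≡ F y v η
    run v ε η = g≡ v η
    run v (y · b) η rewrite run v y η | σ≡ v y (F y v η) η | t≡ v y
      | proj₂ (h b) (F y v η ∷ y ∷ v) η | sym (eq y b v η) = trunc-id _ _ (bd y b v η)
    main : ∀ v η → ⟦ comp (rec g h′ t′) (λ i → P (rotate i)) ⟧ v η ≡ F (head v) (tail v) η
    main (y ∷ v) η rewrite tabulate-rotate v y | init-∷ʳ y v | last-∷ʳ y v = run v y η

por-rec-at : ∀ {n m} (F : Str → Fn m) → InPOR (λ v η → F (head v) (tail v) η) →
             {f : Fn n} {ρ : Map n m} → InPOR f → InPORs ρ → InPOR (λ v η → F (f v η) (ρ v η) η)
por-rec-at F p {f} {ρ} q r = por-comp p
                              (_∷ᵖ_ q r)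

v0 : ∀ {n} → Tm (suc n)
v0 = var zero
v1 : ∀ {n} → Tm (2 + n)
v1 = var 1F
v2 : ∀ {n} → Tm (3 + n)
v2 = var 2F

por-⌢ : ∀ {n} {f g : Fn n} → InPOR f → InPOR g → InPOR (λ v η → f v η ⌢ g v η)
por-⌢ {f = f} p q = por-rec-at (λ y v η → lookup v zero ⌢ y)
  -- The bound is evaluated at `y` although the value is taken at `y · b`; `oneᵗ` pays for the extra
  -- bit.
  (por-rec (λ y v η → lookup v zero ⌢ y) (λ b v η → lookup v zero · b) (v1 ⌢ᵗ v0 ⌢ᵗ oneᵗ)
    (por-var zero) (λ b → por-snoc b (por-var zero)) (λ y b v η → refl)
    (λ y b v η → ≤-refl)) q (pors-1 p)

por-⊗ : ∀ {n} {f g : Fn n} → InPOR f → InPOR g → InPOR (λ v η → f v η ⊗ g v η)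
por-⊗ {f = f} p q = por-rec-at (λ y v η → lookup v zero ⊗ y)
  (por-rec (λ y v η → lookup v zero ⊗ y) (λ b v η → lookup v zero ⌢ lookup v 2F) (v1 ×ᵗ v0 ⌢ᵗ v1)
    por-ε (λ b → por-⌢ (por-var zero) (por-var 2F)) (λ y b v η → refl)
    (λ y b v η → ≤-refl)) q (pors-1 p)

por-term : ∀ {n} (t : Tm n) → InPOR (λ v η → evalT v t)
por-term (var i)  = por-var i
por-term eps      = por-ε
por-term zeroᵗ    = por-snoc false por-ε
por-term oneᵗ     = por-snoc true por-ε
por-term (s ⌢ᵗ t) = por-⌢ (por-term s) (por-term t)
por-term (s ×ᵗ t) = por-⊗ (por-term s) (por-term t)

-- Decidable predicates with characteristic function in POR

Dc : ℕ → Set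
Dc n = Vec Str n → Oracle → Bool

-- Truth values are one-bit strings, the form in which `Q` answers and on which `cond` branches.
InPORᵈ : ∀ {n} → Dc n → Set
InPORᵈ d = InPOR (λ v η → ε · d v η)

opaque
  por-if : ∀ {n} {d : Dc n} {f g : Fn n} → InPORᵈ d → InPOR f → InPOR g →
           InPOR (λ v η → if d v η then f v η else g v η)
  por-if {d = d} {f} {g} p q r = InPOR-ext (λ v η → lem (d v η)) (por-cond p por-ε r q)
    where
    lem : ∀ {x y} b → cond (ε · b) ε x y ≡ (if b then y else x)
    lem true  = refl
    lem false = refl

  por-ifᵈ : ∀ {n} {c d e : Dc n} → InPORᵈ c → InPORᵈ d → InPORᵈ e →
            InPORᵈ (λ v η → if c v η then d v η else e v η)
  por-ifᵈ {c = c} {d} {e} p q r = InPOR-ext (λ v η → lem (c v η)) (por-if p q r)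
    where
    lem : ∀ {x y} b → (if b then ε · x else ε · y) ≡ ε · (if b then x else y)
    lem true  = refl
    lem false = refl

  por-const : ∀ {n} b → InPORᵈ {n} (λ v η → b)
  por-const b = por-snoc b por-ε

  por-∧ : ∀ {n} {c d : Dc n} → InPORᵈ c → InPORᵈ d → InPORᵈ (λ v η → c v η ∧ d v η)
  por-∧ {c = c} {d} p q = InPOR-ext (λ v η → lem (c v η)) (por-ifᵈ p q (por-const false))
    where
    lem : ∀ {x} b → ε · (if b then x else false) ≡ ε · (b ∧ x)
    lem true  = refl
    lem false = refl

  por-∨ : ∀ {n} {c d : Dc n} → InPORᵈ c → InPORᵈ d → InPORᵈ (λ v η → c v η ∨ d v η)
  por-∨ {c = c} {d} p q = InPOR-ext (λ v η → lem (c v η)) (por-ifᵈ p (por-const true) q)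
    where
    lem : ∀ {x} b → ε · (if b then true else x) ≡ ε · (b ∨ x)
    lem true  = refl
    lem false = refl

  por-not : ∀ {n} {c : Dc n} → InPORᵈ c → InPORᵈ (λ v η → not (c v η))
  por-not {c = c} p = InPOR-ext (λ v η → lem (c v η)) (por-ifᵈ p (por-const false) (por-const true))
    where
    lem : ∀ b → ε · (if b then false else true) ≡ ε · not b
    lem true  = refl
    lem false = refl

  por-compᵈ : ∀ {n m} {d : Dc m} {ρ : Map n m} → InPORᵈ d → InPORs ρ → InPORᵈ (λ v η → d (ρ v η) η)
  por-compᵈ {d = d} {ρ} p q = por-comp p q

∧-true : ∀ {a b} → a ∧ b ≡ true → a ≡ true × b ≡ true
∧-true {true} e = refl , e

∧-intro : ∀ {a b} → a ≡ true → b ≡ true → a ∧ b ≡ true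
∧-intro refl refl = refl

∨-true : ∀ {a b} → a ∨ b ≡ true → a ≡ true ⊎ b ≡ true
∨-true {true} e  = inj₁ refl
∨-true {false} e = inj₂ e

∨-introʳ : ∀ {a b} → b ≡ true → a ∨ b ≡ true
∨-introʳ {true}  e = refl
∨-introʳ {false} e = e

∨-introˡ : ∀ {a b} → a ≡ true → a ∨ b ≡ true
∨-introˡ refl = refl

true⊎ : ∀ b → b ≡ true ⊎ b ≡ false
true⊎ true  = inj₁ refl
true⊎ false = inj₂ refl

true≢false : ∀ {b} {A : Set} → b ≡ true → b ≡ false → A
true≢false refl ()

-- Prefix and equality tests

por-pred : ∀ {n} {f : Fn n} → InPOR f → InPOR (λ v η → dropLast 1 (f v η))
por-pred {f = f} p = por-rec-at (λ y v η → dropLast 1 y)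
  (por-rec {n = 0} (λ y v η → dropLast 1 y) (λ b v η → lookup v 1F) v0
    por-ε (λ b → por-var 1F) (λ y b v η → refl) (λ y b v η → ≤-refl)) p []ᵖ

dropLast-suc : ∀ k x → dropLast (suc k) x ≡ dropLast 1 (dropLast k x)
dropLast-suc zero    x       = refl
dropLast-suc (suc k) ε       = refl
dropLast-suc (suc k) (x · b) = dropLast-suc k x

len-dropLast : ∀ k x → len (dropLast k x) ≡ len x ∸ k
len-dropLast zero    x       = refl
len-dropLast (suc k) ε       = refl
len-dropLast (suc k) (x · b) = len-dropLast k x

dropLast-⌢ : ∀ x y → dropLast (len y) (x ⌢ y) ≡ x
dropLast-⌢ x ε       = refl
dropLast-⌢ x (y · b) = dropLast-⌢ x y

dropLast-Prefix : ∀ k x → Prefix (dropLast k x) x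
dropLast-Prefix zero    x       = Prefix-refl x
dropLast-Prefix (suc k) ε       = Prefix-refl ε
dropLast-Prefix (suc k) (x · b) = Prefix-·ʳ b (dropLast-Prefix k x)

por-dropLast : ∀ {n} {f g : Fn n} → InPOR f → InPOR g → InPOR (λ v η → dropLast (len (g v η)) (f v η))
por-dropLast {f = f} p q = por-rec-at (λ y v η → dropLast (len y) (lookup v zero))
  (por-rec (λ y v η → dropLast (len y) (lookup v zero)) (λ b v η → dropLast 1 (lookup v zero)) v1
    (por-var zero) (λ b → por-pred (por-var zero)) (λ y b v η → dropLast-suc (len y) (lookup v zero))
    (λ y b v η → ≤-trans (≤-reflexive (len-dropLast (suc (len y)) (lookup v zero)))
        (m∸n≤m _ (suc (len y))))) q (pors-1 p)

-- Strings grow on the right, whereas a prefix test reads from the left. The first string argument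
-- serves only as a length, the number of bits not yet read: dropping all but one of them makes the
-- next bit the last one.
nextIs : Bool → Str → Str → Bool
nextIs b ε       x = false
nextIs b (k · _) x with dropLast (len k) x
... | ε     = false
... | _ · c = if b then c else not c

pre : Str → Str → Bool
pre ε       x = true
pre (y · b) x = pre y x ∧ nextIs b (dropLast (len y) x) x

por-nextIs : ∀ {n} b {f g : Fn n} → InPOR f → InPOR g → InPORᵈ (λ v η → nextIs b (f v η) (g v η))
por-nextIs b {f} {g} p q = InPOR-ext (λ v η → lem b (f v η) (g v η))
  (por-cond p (por-const false) (t b) (t b))
  where
  t : ∀ b → InPOR (λ v η → cond (dropLast (len (dropLast 1 (f v η))) (g v η)) (ε · false) (ε · not b) (ε · b))
  t b = por-cond (por-dropLast q (por-pred p)) (por-const false) (por-const (not b)) (por-const b)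
  lem : ∀ b x y → cond x (ε · false) (cond (dropLast (len (dropLast 1 x)) y) (ε · false) (ε · not b) (ε · b))
                  (cond (dropLast (len (dropLast 1 x)) y) (ε · false) (ε · not b) (ε · b)) ≡ ε · nextIs b x y
  lem b ε y = refl
  lem b (x · false) y with dropLast (len x) y
  lem b (x · false) y | ε = refl
  lem true  (x · false) y | _ · true = refl
  lem true  (x · false) y | _ · false = refl
  lem false (x · false) y | _ · true = refl
  lem false (x · false) y | _ · false = refl
  lem b (x · true) y with dropLast (len x) y
  lem b (x · true) y | ε = refl
  lem true  (x · true) y | _ · true = refl
  lem true  (x · true) y | _ · false = refl
  lem false (x · true) y | _ · true = refl
  lem false (x · true) y | _ · false = refl

uncons : ∀ a c → Σ Bool λ d → Σ Str λ a′ → (a · c ≡ (ε · d) ⌢ a′) × len a ≡ len a′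
uncons ε c = c , ε , refl , refl
uncons (a · b) c with uncons a b
... | d , a′ , e , l = d , (a′ · c) , cong (_· c) e , cong suc l

nextIs-spec : ∀ b y a → nextIs b (dropLast (len y) (y ⌢ a)) (y ⌢ a) ≡ true ⟺ Prefix (y · b) (y ⌢ a)
nextIs-spec b y a with dropLast (len y) (y ⌢ a) in eq
nextIs-spec b y ε | ε = (λ ()) , λ p → ⊥-elim (1+n≰n (Prefix-len p))
nextIs-spec b y (a · c) | ε with trans
    (sym (trans (sym (len-dropLast (len y) (y ⌢ (a · c)))) (cong len eq)))
        (trans (cong (_∸ len y) (len-⌢ y (a · c))) (m+n∸m≡n (len y) (suc (len a))))
... | ()
nextIs-spec b y ε | k · d with trans (sym (cong len eq)) (trans (len-dropLast (len y) y) (n∸n≡0 (len y)))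
... | ()
nextIs-spec b y (a · c) | k · d with uncons a c
... | e , a′ , p , l = subst (λ z → nextIs b (k · d) z ≡ true ⟺ Prefix (y · b) z) (sym xeq) go
  where
  xeq : y ⌢ (a · c) ≡ (y · e) ⌢ a′
  xeq = trans (cong (y ⌢_) p) (sym (⌢-assoc y (ε · e) a′))
  kl : len k ≡ len a′
  kl = suc-injective (trans (trans (sym (cong len eq)) (trans (len-dropLast (len y) (y ⌢ (a · c)))
         (trans (cong (_∸ len y) (len-⌢ y (a · c))) (m+n∸m≡n (len y) (suc (len a)))))) (cong suc l))
  go : nextIs b (k · d) ((y · e) ⌢ a′) ≡ true ⟺ Prefix (y · b) ((y · e) ⌢ a′)
  go rewrite trans (cong (λ z → dropLast z ((y · e) ⌢ a′)) kl) (dropLast-⌢ (y · e) a′) =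
    (λ q → subst (λ z → Prefix (y · z) ((y · e) ⌢ a′)) (sym (t b e q)) (a′ , refl)) ,
    (λ q → f b e (·-injectiveʳ (Prefix-unique q (a′ , refl) refl)))
    where
    t : ∀ b e → (if b then e else not e) ≡ true → b ≡ e
    t true  true  q = refl
    t false false q = refl
    t true  false ()
    t false true ()
    f : ∀ b e → b ≡ e → (if b then e else not e) ≡ true
    f true  .true  refl = refl
    f false .false refl = refl

pre-spec : ∀ y x → pre y x ≡ true ⟺ Prefix y x
pre-spec ε x = (λ _ → Prefix-ε x) , (λ _ → refl)
pre-spec (y · b) x = to , from
  where
  to : pre (y · b) x ≡ true → Prefix (y · b) x
  to q with ∧-true q
  ... | q₁ , q₂ with proj₁ (pre-spec y x) q₁
  ... | a , refl = proj₁ (nextIs-spec b y a) q₂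
  from : Prefix (y · b) x → pre (y · b) x ≡ true
  from p with Prefix-·ˡ p
  ... | a , refl = ∧-intro (proj₂ (pre-spec y x) (a , refl)) (proj₂ (nextIs-spec b y a) p)

por-pre : ∀ {n} {f g : Fn n} → InPOR f → InPOR g → InPORᵈ (λ v η → pre (f v η) (g v η))
por-pre {g = g} p q = por-rec-at (λ y v η → ε · pre y (lookup v zero))
  (por-rec (λ y v η → ε · pre y (lookup v zero))
    (λ b v η → cond (lookup v zero) (ε · false) (ε · false)
                 (ε · nextIs b (dropLast (len (lookup v 1F)) (lookup v 2F)) (lookup v 2F)))
    oneᵗ (por-const true)
    (λ b → por-cond (por-var zero) (por-const false) (por-const false)
             (por-nextIs b (por-dropLast (por-var 2F) (por-var 1F)) (por-var 2F)))
    (λ y b v η → lem (pre y (lookup v zero)))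
    (λ y b v η → ≤-refl)) p (pors-1 q)
  where
  lem : ∀ {x} b → ε · (b ∧ x) ≡ cond (ε · b) (ε · false) (ε · false) (ε · x)
  lem true  = refl
  lem false = refl

eqˢ : Str → Str → Bool
eqˢ x y = pre x y ∧ pre y x

eqˢ-spec : ∀ x y → eqˢ x y ≡ true ⟺ x ≡ y
eqˢ-spec x y = to , from
  where
  to : eqˢ x y ≡ true → x ≡ y
  to q with ∧-true q
  ... | a , b = Prefix-unique (proj₁ (pre-spec x y) a) (Prefix-refl y)
                 (≤-antisym (Prefix-len (proj₁ (pre-spec x y) a)) (Prefix-len (proj₁ (pre-spec y x) b)))
  from : x ≡ y → eqˢ x y ≡ true
  from refl = ∧-intro (proj₂ (pre-spec x x) (Prefix-refl x)) (proj₂ (pre-spec x x) (Prefix-refl x))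

por-eqˢ : ∀ {n} {f g : Fn n} → InPOR f → InPOR g → InPORᵈ (λ v η → eqˢ (f v η) (g v η))
por-eqˢ p q = por-∧ (por-pre p q) (por-pre q p)

-- Search through prefixes and subwords

-- Prefixes are tried by increasing length and the first hit is kept. Without a hit the whole string
-- is returned, so the value is always a prefix and the recursion is bounded; testing the result
-- tells whether the search succeeded.
preSearch : (Str → Bool) → Str → Str
preSearch p ε       = ε
preSearch p (u · b) = if p (preSearch p u) then preSearch p u else u · b

preSearch-Prefix : ∀ p t → Prefix (preSearch p t) t
preSearch-Prefix p ε = Prefix-refl ε
preSearch-Prefix p (u · b) with p (preSearch p u)
... | true  = Prefix-·ʳ b (preSearch-Prefix p u)
... | false = Prefix-refl _

preSearch-spec : ∀ (p : Str → Bool) u t → Prefix u t → p u ≡ true → p (preSearch p t) ≡ true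
preSearch-spec p u ε (ε , refl) q = q
preSearch-spec p u (t · b) r q with true⊎ (p (preSearch p t))
... | inj₁ e rewrite e = e
... | inj₂ e with Prefix-snoc r
... | inj₁ r′   = true≢false (preSearch-spec p u t r′ q) e
... | inj₂ refl rewrite e = q

por-preSearch : ∀ {n m} {d : Dc (suc m)} {f : Fn n} {ρ : Map n m} → InPORᵈ d → InPOR f → InPORs ρ →
                InPOR (λ v η → preSearch (λ u → d (u ∷ ρ v η) η) (f v η))
por-preSearch {d = d} {f} {ρ} p q r = por-rec-at F
  (por-rec F (λ b v η → if d (lookup v zero ∷ tail (tail v)) η then lookup v zero else lookup v 1F · b)
    (v0 ⌢ᵗ oneᵗ) por-ε
    (λ b → por-if
              (por-compᵈ p
                (_∷ᵖ_ (por-var zero)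
                   (pors-tail (pors-tail pors-id))))
              (por-var zero) (por-snoc b (por-var 1F)))
    (λ y b v η → refl)
    (λ y b v η → Prefix-len (preSearch-Prefix (λ u → d (u ∷ v) η) (y · b)))) q r
  where
  F : Str → Fn _
  F y v η = preSearch (λ u → d (u ∷ v) η) y

-- Copying begins with the first bit after `w`: a bit is kept only if `w` is a prefix of what stands
-- before it.
drop : Str → Str → Str
drop w ε       = ε
drop w (u · b) = if pre w u then drop w u · b else ε

drop-⌢ : ∀ w x → drop w (w ⌢ x) ≡ x
drop-⌢ ε ε = refl
drop-⌢ (w · b) ε with pre (w · b) w in eq
... | true  = ⊥-elim (1+n≰n (Prefix-len (proj₁ (pre-spec (w · b) w) eq)))
... | false = refl
drop-⌢ w (x · b) rewrite proj₂ (pre-spec w (w ⌢ x)) (x , refl) = cong (_· b) (drop-⌢ w x)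

drop-Sub : ∀ w u → Sub (drop w u) u
drop-Sub w u with pre w u in eq
drop-Sub w u | true with proj₁ (pre-spec w u) eq
... | x , refl rewrite drop-⌢ w x = Suffix⇒Sub w x
drop-Sub w ε | false = Sub-ε ε
drop-Sub w (u · b) | false with pre w u in eq′
... | true  = true≢false (proj₂ (pre-spec w (u · b)) (Prefix-·ʳ b (proj₁ (pre-spec w u) eq′))) eq
... | false = Sub-ε _

drop-len : ∀ w u → len (drop w u) ≤ len u
drop-len w u = Sub-len (drop-Sub w u)

por-drop : ∀ {n} {f g : Fn n} → InPOR f → InPOR g → InPOR (λ v η → drop (f v η) (g v η))
por-drop {f = f} p q = por-rec-at F
  (por-rec F (λ b v η → if pre (lookup v 2F) (lookup v 1F) then lookup v zero · b else ε)
    (v0 ⌢ᵗ oneᵗ) por-ε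
    (λ b → por-if (por-pre (por-var 2F) (por-var 1F)) (por-snoc b (por-var zero)) por-ε)
    (λ y b v η → refl) (λ y b v η → drop-len (lookup v zero) (y · b))) q (pors-1 p)
  where
  F : Str → Fn 1
  F y v η = drop (lookup v zero) y

sufSearch : (Str → Bool) → Str → Str
sufSearch p u = drop (preSearch (λ w → p (drop w u)) u) u

-- A subword is a suffix of a prefix, and a suffix is determined by the prefix cut off before it;
-- hence two nested prefix searches cover all subwords.
subSearch : (Str → Bool) → Str → Str
subSearch p t = sufSearch p (preSearch (λ u → p (sufSearch p u)) t)

subSearch-Sub : ∀ p t → Sub (subSearch p t) t
subSearch-Sub p t = Sub-Prefix (drop-Sub _ _) (preSearch-Prefix _ t)

subSearch-spec : ∀ p x t → Sub x t → p x ≡ true → p (subSearch p t) ≡ true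
subSearch-spec p x t (w , _ , r) q =
  preSearch-spec (λ u → p (sufSearch p u)) (w ⌢ x) t r
    (preSearch-spec (λ w′ → p (drop w′ (w ⌢ x))) w (w ⌢ x) (x , refl)
       (trans (cong p (drop-⌢ w x)) q))

por-sufSearch : ∀ {n m} {d : Dc (suc m)} {f : Fn n} {ρ : Map n m} → InPORᵈ d → InPOR f → InPORs ρ →
                InPOR (λ v η → sufSearch (λ u → d (u ∷ ρ v η) η) (f v η))
por-sufSearch {m = m} {d = d} {f} {ρ} p q r =
  por-drop (por-preSearch {d = λ v η → d (drop (lookup v zero) (lookup v 1F) ∷ tail (tail v)) η}
                          {f = f} {ρ = λ v η → f v η ∷ ρ v η}
    (por-compᵈ p
       (_∷ᵖ_
         (por-drop (por-var zero) (por-var 1F))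
         (pors-tail (pors-tail pors-id))))
    q (_∷ᵖ_ q r)) q

por-subSearch : ∀ {n m} {d : Dc (suc m)} {f : Fn n} {ρ : Map n m} → InPORᵈ d → InPOR f → InPORs ρ →
                InPOR (λ v η → subSearch (λ u → d (u ∷ ρ v η) η) (f v η))
por-subSearch {m = m} {d = d} {f} {ρ} p q r =
  por-sufSearch {d = d}
    {f = λ v η → preSearch (λ u → d (sufSearch (λ w → d (w ∷ ρ v η) η) u ∷ ρ v η) η) (f v η)} {ρ = ρ} p
    (por-preSearch
      (por-compᵈ p
         (_∷ᵖ_
            (por-sufSearch p (por-var zero)
               (pors-tail pors-id))
            (pors-tail pors-id)))
      q r)
    r

-- Pairing

-- Self-delimiting code: each bit of the first component is announced by `true`, and the `false`
-- added in `pair` announces the second component. The length stays linear, so codes can be bounded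
-- by terms.
dbl : Str → Str
dbl ε       = ε
dbl (x · b) = dbl x · true · b

pair : Str → Str → Str
pair x y = (dbl x · false) ⌢ y

-- State of a left-to-right scan of a pair: ε before a control bit,
-- ε · true before a bit of the first component, ε · false in the second one.
mode : Str → Str
mode ε       = ε
mode (z · b) = cond (mode z) (ε · b) (ε · false) ε

fst : Str → Str
fst ε       = ε
fst (z · b) = cond (mode z) (fst z) (fst z) (fst z · b)

snd : Str → Str
snd ε       = ε
snd (z · b) = cond (mode z) (snd z) (snd z · b) (snd z)

scan-dbl : ∀ x → mode (dbl x) ≡ ε × fst (dbl x) ≡ x × snd (dbl x) ≡ ε
scan-dbl ε = refl , refl , refl
scan-dbl (x · b) with scan-dbl x
... | p , q , r rewrite p | q | r = refl , refl , refl

scan-pair : ∀ x y → mode (pair x y) ≡ ε · false × fst (pair x y) ≡ x × snd (pair x y) ≡ y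
scan-pair x ε with scan-dbl x
... | p , q , r rewrite p | q | r = refl , refl , refl
scan-pair x (y · b) with scan-pair x y
... | p , q , r rewrite p | q | r = refl , refl , refl

fst-pair : ∀ x y → fst (pair x y) ≡ x
fst-pair x y = proj₁ (proj₂ (scan-pair x y))

snd-pair : ∀ x y → snd (pair x y) ≡ y
snd-pair x y = proj₂ (proj₂ (scan-pair x y))

len-dbl : ∀ x → len (dbl x) ≡ len x + len x
len-dbl ε = refl
len-dbl (x · b) = cong suc (trans (cong suc (len-dbl x)) (sym (+-suc (len x) (len x))))

len-pair : ∀ x y → len (pair x y) ≡ suc (len x + len x) + len y
len-pair x y = trans (len-⌢ (dbl x · false) y) (cong (λ z → suc z + len y) (len-dbl x))

cond-len : ∀ x {y z w n} → len y ≤ n → len z ≤ n → len w ≤ n → len (cond x y z w) ≤ n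
cond-len ε           a b c = a
cond-len (x · false) a b c = b
cond-len (x · true)  a b c = c

fst-len : ∀ z → len (fst z) ≤ len z
fst-len ε = z≤n
fst-len (z · b) = cond-len (mode z) (m≤n⇒m≤1+n (fst-len z)) (m≤n⇒m≤1+n (fst-len z)) (s≤s (fst-len z))

snd-len : ∀ z → len (snd z) ≤ len z
snd-len ε = z≤n
snd-len (z · b) = cond-len (mode z) (m≤n⇒m≤1+n (snd-len z)) (s≤s (snd-len z)) (m≤n⇒m≤1+n (snd-len z))

por-mode : ∀ {n} {f : Fn n} → InPOR f → InPOR (λ v η → mode (f v η))
por-mode p = por-rec-at (λ y v η → mode y)
  (por-rec (λ y v η → mode y) (λ b v η → cond (lookup v zero) (ε · b) (ε · false) ε) oneᵗ
    por-ε (λ b → por-cond (por-var zero) (por-const b) (por-const false) por-ε) (λ y b v η → refl)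
    (λ y b v η → cond-len (mode y) ≤-refl ≤-refl z≤n)) p []ᵖ

por-fst : ∀ {n} {f : Fn n} → InPOR f → InPOR (λ v η → fst (f v η))
por-fst p = por-rec-at (λ y v η → fst y)
  (por-rec (λ y v η → fst y)
    (λ b v η → cond (mode (lookup v 1F)) (lookup v zero) (lookup v zero) (lookup v zero · b)) (v0 ⌢ᵗ oneᵗ)
    por-ε (λ b → por-cond (por-mode (por-var 1F)) (por-var zero) (por-var zero) (por-snoc b (por-var zero)))
    (λ y b v η → refl) (λ y b v η → fst-len (y · b))) p []ᵖ

por-snd : ∀ {n} {f : Fn n} → InPOR f → InPOR (λ v η → snd (f v η))
por-snd p = por-rec-at (λ y v η → snd y)
  (por-rec (λ y v η → snd y)
    (λ b v η → cond (mode (lookup v 1F)) (lookup v zero) (lookup v zero · b) (lookup v zero)) (v0 ⌢ᵗ oneᵗ)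
    por-ε (λ b → por-cond (por-mode (por-var 1F)) (por-var zero) (por-snoc b (por-var zero)) (por-var zero))
    (λ y b v η → refl) (λ y b v η → snd-len (y · b))) p []ᵖ

por-dbl : ∀ {n} {f : Fn n} → InPOR f → InPOR (λ v η → dbl (f v η))
por-dbl p = por-rec-at (λ y v η → dbl y)
  (por-rec (λ y v η → dbl y) (λ b v η → lookup v zero · true · b) (v0 ⌢ᵗ v0 ⌢ᵗ oneᵗ ⌢ᵗ oneᵗ)
    por-ε (λ b → por-snoc b (por-snoc true (por-var zero))) (λ y b v η → refl)
    (λ y b v η → s≤s (s≤s (≤-reflexive (trans (len-dbl y) (sym (len-⌢ y y))))))) p []ᵖ

por-pair : ∀ {n} {f g : Fn n} → InPOR f → InPOR g → InPOR (λ v η → pair (f v η) (g v η))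
por-pair p q = por-⌢ (por-snoc false (por-dbl p)) q

-- Term bounds for POR functions

trunc-len : ∀ x y → len (trunc x y) ≤ len y
trunc-len x y = ≤-trans (≤-reflexive (len-dropLast (len x ∸ len y) x)) (le (len x) (len y))
  where
  le : ∀ m n → m ∸ (m ∸ n) ≤ n
  le m n with ≤-total m n
  ... | inj₁ p = ≤-trans (m∸n≤m m (m ∸ n)) p
  ... | inj₂ p = ≤-reflexive (m∸[m∸n]≡n p)

-- Only recursion could produce excessive growth, and there the values are truncated. The bounds are
-- needed for the recursion that realizes induction, whose ingredients are arbitrary POR functions.
por-bound : ∀ {n} (p : POR n) → Σ (Tm n) λ t → ∀ v η → len (⟦ p ⟧ v η) ≤ len (evalT v t)
por-bound E = eps , λ v η → z≤n
por-bound (P i) = var i , λ v η → ≤-refl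
por-bound (S b) = v0 ⌢ᵗ oneᵗ , λ { (x ∷ []) η → ≤-refl }
por-bound C = var 1F ⌢ᵗ v2 ⌢ᵗ var 3F , λ { (x ∷ y ∷ z ∷ w ∷ []) η → lem x y z w }
  where
  lem : ∀ x y z w → len (cond x y z w) ≤ len ((y ⌢ z) ⌢ w)
  lem x y z w rewrite len-⌢ (y ⌢ z) w | len-⌢ y z =
    cond-len x (≤-trans (m≤m+n (len y) (len z)) (m≤m+n _ (len w)))
               (≤-trans (m≤n+m (len z) (len y)) (m≤m+n _ (len w))) (m≤n+m (len w) _)
por-bound Q = oneᵗ , λ { (x ∷ []) η → ≤-refl }
por-bound {n} (comp p q) = subT σ t , bd
  where
  t = proj₁ (por-bound p)
  σ : ∀ i → Tm n
  σ i = proj₁ (por-bound (q i))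
  bd : ∀ v η → len (⟦ comp p q ⟧ v η) ≤ len (evalT v (subT σ t))
  bd v η rewrite evalT-subT {v = v} {v′ = tabulate (λ i → evalT v (σ i))} σ (lookup∘tabulate _) t =
    ≤-trans (proj₂ (por-bound p) _ η)
      (evalT-mono (tabulate λ i → ⟦ q i ⟧ v η) (tabulate λ i → evalT v (σ i)) le t)
    where
    le : ∀ i → len (lookup (tabulate λ i → ⟦ q i ⟧ v η) i) ≤ len (lookup (tabulate λ i → evalT v (σ i)) i)
    le i rewrite lookup∘tabulate (λ i → ⟦ q i ⟧ v η) i | lookup∘tabulate (λ i → evalT v (σ i)) i =
      proj₂ (por-bound (q i)) v η
por-bound {suc n} (rec g h t) = T , λ v η → bd v (init v) (last v) (unsnoc v) η
  where
  tg = proj₁ (por-bound g)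
  T : Tm (suc n)
  -- The value comes from `g` at `ε` and is truncated to the length of `t` otherwise; the truncation
  -- uses the predecessor of the last argument, which is shorter.
  T = subT (var ∘ inject₁) tg ⌢ᵗ t
  unsnoc : ∀ v → v ≡ init v ∷ʳ last v
  unsnoc v = proj₂ (proj₂ (initLast v))
  mono : ∀ {m} (xs : Vec Str m) y b i → len (lookup (xs ∷ʳ y) i) ≤ len (lookup (xs ∷ʳ (y · b)) i)
  mono []       y b zero    = n≤1+n _
  mono (x ∷ xs) y b zero    = ≤-refl
  mono (x ∷ xs) y b (suc i) = mono xs y b i
  bd : ∀ v xs y → v ≡ xs ∷ʳ y → ∀ η → len (recSem g h t xs y η) ≤ len (evalT v T)
  bd v xs ε refl η
    rewrite len-⌢ (evalT v (subT (var ∘ inject₁) tg)) (evalT v t)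
          | evalT-subT {v = v} (var ∘ inject₁) (λ i → sym (lookup-inject₁ xs ε i)) tg =
    ≤-trans (proj₂ (por-bound g) xs η) (m≤m+n _ _)
  bd v xs (y · b) refl η
    rewrite len-⌢ (evalT v (subT (var ∘ inject₁) tg)) (evalT v t) =
    ≤-trans (≤-trans (trunc-len _ _) (evalT-mono (xs ∷ʳ y) v (mono xs y b) t)) (m≤n+m _ _)

opaque
  InPOR-bound : ∀ {n} {f : Fn n} → InPOR f → Σ (Tm n) λ t → ∀ v η → len (f v η) ≤ len (evalT v t)
  InPOR-bound (p , e) = proj₁ (por-bound p) , λ v η → subst (λ z → len z ≤ _) (e v η)
      (proj₂ (por-bound p) v η)

-- Forcing

-- A world has dim generic strings and a POR predicate χ; it stands for the
-- assumption that no string s (with generic strings v) satisfies χ (s ∷ v).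
record World : Set where
  constructor world
  field
    dim  : ℕ
    χ    : Dc (suc dim)
    χᵖ   : InPORᵈ χ
open World

-- A later world replaces the generic strings by POR functions and assumes at least as much. The
-- violating string itself is unchanged, so a function computing violations at `w` does so at `w′`
-- after composition with `fun`.
record _≼_ (w′ w : World) : Set where
  constructor mor
  field
    fun  : Map (dim w′) (dim w)
    funᵖ : InPORs fun
    pres : ∀ s v η → χ w (s ∷ fun v η) η ≡ true → χ w′ (s ∷ v) η ≡ true
open _≼_

id≼ : ∀ {w} → w ≼ w
id≼ = mor (λ v η → v) pors-id (λ s v η e → e)

infixr 9 _∘≼_
_∘≼_ : ∀ {w w′ w″} → w′ ≼ w → w″ ≼ w′ → w″ ≼ w
m ∘≼ m′ = mor (λ v η → fun m (fun m′ v η) η) (pors-comp (funᵖ m) (funᵖ m′))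
              (λ s v η e → pres m′ s v η (pres m s (fun m′ v η) η e))

infixl 10 _⟨_⟩
_⟨_⟩ : ∀ {w w′ k} → Map (dim w) k → w′ ≼ w → Map (dim w′) k
(ρ ⟨ m ⟩) v η = ρ (fun m v η) η

infixr 8 _◂_
_◂_ : ∀ {n k} → Fn n → Map n k → Map n (suc k)
(f ◂ ρ) v η = f v η ∷ ρ v η

-- φ holds at w up to a violation computed by a POR function.
record Holds (w : World) (φ : Vec Str (dim w) → Oracle → Set) : Set where
  constructor holds
  field
    viol  : Fn (dim w)
    violᵖ : InPOR viol
    true⊎viol : ∀ v η → φ v η ⊎ χ w (viol v η ∷ v) η ≡ true
open Holds

Bot : World → Set
Bot w = Holds w (λ v η → ⊥)

-- Variables stand for POR functions of the generic strings, and the quantifiers range over such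
-- functions at all later worlds.
Forces : ∀ {k} → Fm k → (w : World) → Map (dim w) k → Set
Forces (s ≐ t)  w ρ = Holds w (λ v η → evalT (ρ v η) s ≡ evalT (ρ v η) t)
Forces (s ⊑ t)  w ρ = Holds w (λ v η → Prefix (evalT (ρ v η) s) (evalT (ρ v η) t))
Forces (flip t) w ρ = Holds w (λ v η → η (evalT (ρ v η) t) ≡ true)
Forces ⊥ᶠ       w ρ = Bot w
Forces (A ∧ᶠ B) w ρ = Forces A w ρ × Forces B w ρ
Forces (A ∨ᶠ B) w ρ = ∀ w′ (m : w′ ≼ w) →
  (∀ w″ (m′ : w″ ≼ w′) → Forces A w″ (ρ ⟨ m ⟩ ⟨ m′ ⟩) → Bot w″) →
  (∀ w″ (m′ : w″ ≼ w′) → Forces B w″ (ρ ⟨ m ⟩ ⟨ m′ ⟩) → Bot w″) → Bot w′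
Forces (A ⇒ B)  w ρ = ∀ w′ (m : w′ ≼ w) → Forces A w′ (ρ ⟨ m ⟩) → Forces B w′ (ρ ⟨ m ⟩)
Forces (∀ᶠ A)   w ρ = ∀ w′ (m : w′ ≼ w) (f : Fn (dim w′)) → InPOR f → Forces A w′ (f ◂ ρ ⟨ m ⟩)
Forces (∃ᶠ A)   w ρ = ∀ w′ (m : w′ ≼ w) →
  (∀ w″ (m′ : w″ ≼ w′) (f : Fn (dim w″)) → InPOR f → Forces A w″ (f ◂ ρ ⟨ m ⟩ ⟨ m′ ⟩) → Bot w″) → Bot w′

Holds-map : ∀ {w φ ψ} → (∀ v η → φ v η → ψ v η) → Holds w φ → Holds w ψ
Holds-map h (holds f p q) = holds f p λ v η → Data.Sum.map₁ (h v η) (q v η)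

-- Two candidate violations are merged into one by testing the first against `χ`, which is possible
-- because `χ` has a POR characteristic function.
Holds-map₂ : ∀ {w φ ψ θ} → (∀ v η → φ v η → ψ v η → θ v η) → Holds w φ → Holds w ψ → Holds w θ
Holds-map₂ {w} {φ} {ψ} {θ} h (holds f p q) (holds g p′ q′) = holds k kᵖ spec
  where
  k : Fn (dim w)
  k v η = if χ w (f v η ∷ v) η then f v η else g v η
  kᵖ : InPOR k
  kᵖ = por-if (por-compᵈ (χᵖ w) (p ∷ᵖ pors-id)) p p′
  spec : ∀ v η → θ v η ⊎ χ w (k v η ∷ v) η ≡ true
  spec v η with χ w (f v η ∷ v) η in eq
  ... | true = inj₂ eq
  ... | false with q v η | q′ v η
  ... | inj₂ a | _      = true≢false a eq
  ... | inj₁ a | inj₂ b = inj₂ b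
  ... | inj₁ a | inj₁ b = inj₁ (h v η a b)

Holds-pure : ∀ {w φ} → (∀ v η → φ v η) → Holds w φ
Holds-pure h = holds (λ v η → ε) por-ε λ v η → inj₁ (h v η)

Holds-mono : ∀ {w w′ φ} → Holds w φ → (m : w′ ≼ w) → Holds w′ (λ v η → φ (fun m v η) η)
Holds-mono (holds f p q) m = holds (λ v η → f (fun m v η) η) (por-comp p (funᵖ m)) λ v η →
  Data.Sum.map₂ (pres m _ v η) (q (fun m v η) η)

Holds-viol : ∀ {w φ} → (∀ v η → φ v η → ∀ s → χ w (s ∷ v) η ≡ true) → Holds w φ → Bot w
Holds-viol {w} h (holds f p q) = holds f p λ v η → inj₂ (lem v η (q v η))
  where
  lem : ∀ v η → _ ⊎ _ → χ w (f v η ∷ v) η ≡ true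
  lem v η (inj₁ a) = h v η a _
  lem v η (inj₂ b) = b

Forces-mono : ∀ {k} (A : Fm k) {w w′ ρ} → Forces A w ρ → (m : w′ ≼ w) → Forces A w′ (ρ ⟨ m ⟩)
Forces-mono (s ≐ t)  h m = Holds-mono h m
Forces-mono (s ⊑ t)  h m = Holds-mono h m
Forces-mono (flip t) h m = Holds-mono h m
Forces-mono ⊥ᶠ       h m = Holds-mono h m
Forces-mono (A ∧ᶠ B) (a , b) m = Forces-mono A a m , Forces-mono B b m
Forces-mono (A ∨ᶠ B) h m = λ w′ m′ → h w′ (m ∘≼ m′)
Forces-mono (A ⇒ B)  h m = λ w′ m′ → h w′ (m ∘≼ m′)
Forces-mono (∀ᶠ A)   h m = λ w′ m′ → h w′ (m ∘≼ m′)
Forces-mono (∃ᶠ A)   h m = λ w′ m′ → h w′ (m ∘≼ m′)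

extend : (w : World) (e : Dc (suc (dim w))) → InPORᵈ e → World
extend w e p = world (dim w) (λ v η → χ w v η ∨ e v η) (por-∨ (χᵖ w) p)

extend≼ : ∀ {w} e p → extend w e p ≼ w
extend≼ e p = mor (λ v η → v) pors-id (λ s v η → ∨-introˡ)

-- The world in which d is assumed to be false.
refute : (w : World) (d : Dc (dim w)) → InPORᵈ d → World
refute w d p = extend w (λ v η → d (tail v) η)
                 (por-compᵈ p (pors-tail pors-id))

refute≼ : ∀ {w} d p → refute w d p ≼ w
refute≼ d p = extend≼ _ _

-- A violation of the enlarged assumption is either a violation at `w` or evidence for `d`.
refute-elim : ∀ {w φ} d p → Holds (refute w d p) φ → Holds w (λ v η → d v η ≡ true ⊎ φ v η)
refute-elim {w} d p (holds f q h) = holds f q λ v η → lem (h v η)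
  where
  lem : ∀ {A : Set} {a b} → A ⊎ a ∨ b ≡ true → (b ≡ true ⊎ A) ⊎ a ≡ true
  lem (inj₁ x) = inj₁ (inj₂ x)
  lem (inj₂ y) with ∨-true y
  ... | inj₁ z = inj₂ z
  ... | inj₂ z = inj₁ (inj₁ z)

refute-viol : ∀ {w} d p {w″} (m : w″ ≼ refute w d p) → Holds w″ (λ v η → d (fun m v η) η ≡ true) → Bot w″
refute-viol d p m = Holds-viol (λ v η e s → pres m s v η (∨-introʳ e))

-- Truth and forcing

-- Being decided in POR is what connects truth and forcing: the negation of a decidable formula can
-- itself be made the assumption of a world.
record Absolute {k} (A : Fm k) : Set where
  field
    dec   : Dc k
    decᵖ  : InPORᵈ dec
    dec✓  : ∀ v η → dec v η ≡ true ⟺ Sat η v A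
    intro : ∀ {w ρ} → InPORs ρ → Holds w (λ v η → Sat η (ρ v η) A) → Forces A w ρ
    elim  : ∀ {w ρ} → InPORs ρ → Forces A w ρ → Holds w (λ v η → Sat η (ρ v η) A)
open Absolute

module _ {k} {A : Fm k} (a : Absolute A) {w : World} {ρ : Map (dim w) k} (ρᵖ : InPORs ρ) where
  dec-at : Dc (dim w)
  dec-at v η = dec a (ρ v η) η

  dec-atᵖ : InPORᵈ dec-at
  dec-atᵖ = por-compᵈ (decᵖ a) ρᵖ

dec-false : ∀ {k} {A : Fm k} (a : Absolute A) v η → dec a v η ≡ false → ¬ Sat η v A
dec-false a v η e s = true≢false (proj₂ (dec✓ a v η) s) e

dec⊎ : ∀ {k} {A : Fm k} (a : Absolute A) v η → Sat η v A ⊎ ¬ Sat η v A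
dec⊎ a v η with true⊎ (dec a v η)
... | inj₁ e = inj₁ (proj₁ (dec✓ a v η) e)
... | inj₂ e = inj₂ (dec-false a v η e)

abs-≐ : ∀ {k} (s t : Tm k) → Absolute (s ≐ t)
abs-≐ s t = record
  { dec = λ v η → eqˢ (evalT v s) (evalT v t) ; decᵖ = por-eqˢ (por-term s) (por-term t)
  ; dec✓ = λ v η → eqˢ-spec (evalT v s) (evalT v t) ; intro = λ _ h → h ; elim = λ _ h → h }

abs-⊑ : ∀ {k} (s t : Tm k) → Absolute (s ⊑ t)
abs-⊑ s t = record
  { dec = λ v η → pre (evalT v s) (evalT v t) ; decᵖ = por-pre (por-term s) (por-term t)
  ; dec✓ = λ v η → pre-spec (evalT v s) (evalT v t) ; intro = λ _ h → h ; elim = λ _ h → h }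

abs-flip : ∀ {k} (t : Tm k) → Absolute (flip t)
abs-flip t = record
  { dec = λ v η → η (evalT v t) ; decᵖ = por-query (por-term t)
  ; dec✓ = λ v η → (λ z → z) , (λ z → z) ; intro = λ _ h → h ; elim = λ _ h → h }

abs-⊥ : ∀ {k} → Absolute {k} ⊥ᶠ
abs-⊥ = record
  { dec = λ v η → false ; decᵖ = por-const false
  ; dec✓ = λ v η → (λ ()) , (λ ()) ; intro = λ _ h → h ; elim = λ _ h → h }

abs-∧ : ∀ {k} {A B : Fm k} → Absolute A → Absolute B → Absolute (A ∧ᶠ B)
abs-∧ a b = record
  { dec = λ v η → dec a v η ∧ dec b v η ; decᵖ = por-∧ (decᵖ a) (decᵖ b)
  ; dec✓ = λ v η → (λ e → let (x , y) = ∧-true e in proj₁ (dec✓ a v η) x , proj₁ (dec✓ b v η) y)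
                  , (λ (x , y) → ∧-intro (proj₂ (dec✓ a v η) x) (proj₂ (dec✓ b v η) y))
  ; intro = λ p h → intro a p (Holds-map (λ v η → proj₁) h) , intro b p (Holds-map (λ v η → proj₂) h)
  ; elim = λ p (x , y) → Holds-map₂ (λ v η → _,_) (elim a p x) (elim b p y) }

-- For `elim`, the formula `¬ A` is refuted: in the resulting world `A` holds up to a violation,
-- hence `B` is forced, and `refute-elim` turns this into `¬ A` or `B` at the original world.
abs-⇒ : ∀ {k} {A B : Fm k} → Absolute A → Absolute B → Absolute (A ⇒ B)
abs-⇒ {A = A} {B} a b = record
  { dec = λ v η → if dec a v η then dec b v η else true ; decᵖ = por-ifᵈ (decᵖ a) (decᵖ b) (por-const true)
  ; dec✓ = ✓
  ; intro = λ p h w′ m x → intro b (pors-comp p (funᵖ m))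
              (Holds-map₂ (λ v η f y → f y) (Holds-mono h m) (elim a (pors-comp p (funᵖ m)) x))
  ; elim = el }
  where
  ✓ : ∀ v η → (if dec a v η then dec b v η else true) ≡ true ⟺ (Sat η v A → Sat η v B)
  ✓ v η with true⊎ (dec a v η)
  ... | inj₁ e rewrite e = (λ f _ → proj₁ (dec✓ b v η) f) , λ f → proj₂ (dec✓ b v η)
      (f (proj₁ (dec✓ a v η) e))
  ... | inj₂ e rewrite e = (λ _ x → ⊥-elim (dec-false a v η e x)) , λ _ → refl
  el : ∀ {w ρ} → InPORs ρ → Forces (A ⇒ B) w ρ → Holds w (λ v η → Sat η (ρ v η) A → Sat η (ρ v η) B)
  el {w} {ρ} p h = Holds-map (λ { v η (inj₁ e) x → ⊥-elim (true≢false (proj₂ (dec✓ a _ η) x) (not-true e))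
                                ; v η (inj₂ y) x → y })
    (refute-elim d dᵖ (elim b p (h _ (refute≼ d dᵖ) (intro a p assumption))))
    where
    d : Dc (dim w)
    d v η = not (dec a (ρ v η) η)
    dᵖ : InPORᵈ d
    dᵖ = por-not (dec-atᵖ a {w = w} p)
    not-true : ∀ {b} → not b ≡ true → b ≡ false
    not-true {false} e = refl
    assumption : Holds (refute w d dᵖ) (λ v η → Sat η (ρ v η) A)
    assumption = holds (λ v η → ε) por-ε λ v η → Data.Sum.map (proj₁ (dec✓ a _ η))
        (λ e → ∨-introʳ (cong not e)) (true⊎ (dec a (ρ v η) η))

-- The disjunction is obtained by refuting it, which makes both disjuncts
-- contradictory.
abs-∨ : ∀ {k} {A B : Fm k} → Absolute A → Absolute B → Absolute (A ∨ᶠ B)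
abs-∨ {A = A} {B} a b = record
  { dec = dd ; decᵖ = ddᵖ ; dec✓ = ✓ ; intro = λ p h → int p h ; elim = λ p h → el p h }
  where
  dd : Dc _
  dd v η = dec a v η ∨ dec b v η
  ddᵖ : InPORᵈ dd
  ddᵖ = por-∨ (decᵖ a) (decᵖ b)
  ✓ : ∀ v η → dec a v η ∨ dec b v η ≡ true ⟺ (Sat η v A ⊎ Sat η v B)
  ✓ v η = (λ e → Data.Sum.map (proj₁ (dec✓ a v η)) (proj₁ (dec✓ b v η)) (∨-true e)) ,
          (λ { (inj₁ x) → ∨-introˡ (proj₂ (dec✓ a v η) x) ; (inj₂ x) → ∨-introʳ (proj₂ (dec✓ b v η) x) })
  neg : ∀ {C : Fm _} (c : Absolute C) {w ρ} → InPORs ρ →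
        (∀ w″ (m′ : w″ ≼ w) → Forces C w″ (ρ ⟨ m′ ⟩) → Bot w″) → Holds w (λ v η → ¬ Sat η (ρ v η) C)
  neg c p n = elim (abs-⇒ c abs-⊥) p n
  int : ∀ {w ρ} → InPORs ρ → Holds w (λ v η → Sat η (ρ v η) A ⊎ Sat η (ρ v η) B) → Forces (A ∨ᶠ B) w ρ
  int p h w′ m na nb = Holds-map₂ (λ v η na f → f na) (neg a (pors-comp p (funᵖ m)) na)
    (Holds-map₂ (λ v η nb s na → Data.Sum.[ na , nb ] s) (neg b (pors-comp p (funᵖ m)) nb) (Holds-mono h m))
  el : ∀ {w ρ} → InPORs ρ → Forces (A ∨ᶠ B) w ρ → Holds w (λ v η → Sat η (ρ v η) A ⊎ Sat η (ρ v η) B)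
  el {w} {ρ} p h = Holds-map (λ { v η (inj₁ e) → proj₁ (✓ (ρ v η) η) e ; v η (inj₂ ()) })
      (refute-elim d dᵖ (h _ (refute≼ d dᵖ)
      (λ w″ m x → refute-viol {w} d dᵖ m
          (Holds-map (λ v η y → proj₂ (✓ (ρ (fun m v η) η) η) (inj₁ y)) (elim a (pors-comp p (funᵖ m)) x)))
      (λ w″ m x → refute-viol {w} d dᵖ m
          (Holds-map (λ v η y → proj₂ (✓ (ρ (fun m v η) η) η) (inj₂ y)) (elim b (pors-comp p (funᵖ m)) x)))))
    where
    d : Dc (dim w)
    d v η = dd (ρ v η) η
    dᵖ : InPORᵈ d
    dᵖ = por-compᵈ ddᵖ p

◂ᵖ : ∀ {n k} {f : Fn n} {ρ : Map n k} → InPOR f → InPORs ρ → InPORs (f ◂ ρ)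
◂ᵖ {f = f} {ρ} p q = _∷ᵖ_ p q

-- A choice function in POR reduces the quantifier to one instance: its value decides the formula
-- and is the instance offered in `intro`. For `elim` the formula is refuted, so that every forced
-- instance becomes contradictory.
abs-∃ : ∀ {k} {A : Fm (suc k)} → Absolute A → (μ : Fn k) → InPOR μ →
        (∀ v η x → Sat η (x ∷ v) A → Sat η (μ v η ∷ v) A) → Absolute (∃ᶠ A)
abs-∃ {k} {A} a μ μᵖ sk = record { dec = dd ; decᵖ = ddᵖ ; dec✓ = ✓ ; intro = λ p h →
    int p h ; elim = λ p h → el p h }
  where
  dd : Dc k
  dd v η = dec a (μ v η ∷ v) η
  ddᵖ : InPORᵈ dd
  ddᵖ = por-compᵈ (decᵖ a) (◂ᵖ μᵖ pors-id)
  ✓ : ∀ v η → dd v η ≡ true ⟺ (Σ Str λ x → Sat η (x ∷ v) A)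
  ✓ v η = (λ e → _ , proj₁ (dec✓ a _ η) e) , (λ (x , s) → proj₂ (dec✓ a _ η) (sk v η x s))
  int : ∀ {w ρ} → InPORs ρ → Holds w (λ v η → Σ Str λ x → Sat η (x ∷ ρ v η) A) → Forces (∃ᶠ A) w ρ
  int {w} {ρ} p h w′ m n = n w′ id≼ f fᵖ (intro a (◂ᵖ fᵖ (pors-comp p (funᵖ m)))
      (Holds-map (λ v η (x , s) → sk _ η x s) (Holds-mono h m)))
    where
    f : Fn (dim w′)
    f v η = μ (ρ (fun m v η) η) η
    fᵖ : InPOR f
    fᵖ = por-comp μᵖ (pors-comp p (funᵖ m))
  el : ∀ {w ρ} → InPORs ρ → Forces (∃ᶠ A) w ρ → Holds w (λ v η → Σ Str λ x → Sat η (x ∷ ρ v η) A)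
  el {w} {ρ} p h = Holds-map (λ { v η (inj₁ e) → proj₁ (✓ (ρ v η) η) e ; v η (inj₂ ()) })
      (refute-elim d dᵖ (h _ (refute≼ d dᵖ)
      (λ w″ m f fᵖ x → refute-viol {w} d dᵖ m
         (Holds-map (λ v η s → proj₂ (✓ _ η) (f v η , s)) (elim a (◂ᵖ fᵖ (pors-comp p (funᵖ m))) x)))))
    where
    d : Dc (dim w)
    d v η = dd (ρ v η) η
    dᵖ : InPORᵈ d
    dᵖ = por-compᵈ ddᵖ p

-- Here `μ` chooses a counterexample whenever there is one; the instance at `μ` is therefore as
-- strong as the universal formula.
abs-∀ : ∀ {k} {A : Fm (suc k)} → Absolute A → (μ : Fn k) → InPOR μ →
        (∀ v η → Sat η (μ v η ∷ v) A → ∀ x → Sat η (x ∷ v) A) → Absolute (∀ᶠ A)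
abs-∀ {k} {A} a μ μᵖ sk = record
  { dec = dd ; decᵖ = por-compᵈ (decᵖ a) (◂ᵖ μᵖ pors-id)
  ; dec✓ = λ v η → (λ e → sk v η (proj₁ (dec✓ a _ η) e)) , (λ s → proj₂ (dec✓ a _ η) (s _))
  ; intro = λ p h w′ m f fᵖ → intro a (◂ᵖ fᵖ (pors-comp p (funᵖ m)))
      (Holds-map (λ v η s → s (f v η)) (Holds-mono h m))
  ; elim = λ {w} {ρ} p h → Holds-map (λ v η s → sk (ρ v η) η s)
      (elim a (◂ᵖ (por-comp μᵖ p) p) (h w id≼ (λ v η → μ (ρ v η) η) (por-comp μᵖ p))) }
  where
  dd : Dc k
  dd v η = dec a (μ v η ∷ v) η

abs-subwordOf : ∀ {k} (t : Tm k) → Absolute (subwordOf t)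
abs-subwordOf {k} t = abs-∃ (abs-∧ (abs-⊑ _ _) (abs-⊑ _ _)) μ
  (por-preSearch
    (por-pre (por-⌢ (por-var zero) (por-var 1F))
             (por-comp (por-term (wkT t)) (pors-tail pors-id)))
    (por-term (wkT t)) pors-id) sk
  where
  μ : Fn (suc k)
  μ v η = preSearch (λ w → pre (w ⌢ lookup v zero) (evalT v (wkT t))) (evalT v (wkT t))
  sk : ∀ v η w → _ → _
  sk v η w (p , q) rewrite evalT-wkT w v (wkT t) | evalT-wkT (μ v η) v (wkT t) =
    preSearch-Prefix _ _ ,
    proj₁ (pre-spec _ _) (preSearch-spec (λ w → pre (w ⌢ lookup v zero) (evalT v (wkT t))) w _ p
        (proj₂ (pre-spec _ _) q))

subwordOf-Sub : ∀ {k} η x (v : Vec Str k) t → Sat η (x ∷ v) (subwordOf t) ⟺ Sub x (evalT v t)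
subwordOf-Sub η x v t =
  (λ (w , p , q) → w , subst (Prefix w) (e w) p , subst (Prefix (w ⌢ x)) (e w) q) ,
  (λ (w , p , q) → w , subst (Prefix w) (sym (e w)) p , subst (Prefix (w ⌢ x)) (sym (e w)) q)
  where
  e : ∀ w → evalT (w ∷ x ∷ v) (wkT (wkT t)) ≡ evalT v t
  e w = trans (evalT-wkT w (x ∷ v) (wkT t)) (evalT-wkT x v t)

-- Bounded quantifiers range over the subwords of a term, where `subSearch` is a choice function in
-- POR; for `allSub` it looks for a counterexample.
abs₀ : ∀ {k} (G : Σb0 k) → Absolute ⌜ G ⌝₀
abs₀ (eqᵇ s t)   = abs-≐ s t
abs₀ (preᵇ s t)  = abs-⊑ s t
abs₀ (flipᵇ t)   = abs-flip t
abs₀ (notᵇ A)    = abs-⇒ (abs₀ A) abs-⊥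
abs₀ (andᵇ A B)  = abs-∧ (abs₀ A) (abs₀ B)
abs₀ (orᵇ A B)   = abs-∨ (abs₀ A) (abs₀ B)
abs₀ (impᵇ A B)  = abs-⇒ (abs₀ A) (abs₀ B)
abs₀ (allSub t A) = abs-∀ (abs-⇒ (abs-subwordOf t) a)
  (λ v η → subSearch (λ x → not (dec a (x ∷ v) η)) (evalT v t))
  (por-subSearch (por-not (decᵖ a)) (por-term t) pors-id)
  λ v η h x s → cex v η h x (proj₁ (subwordOf-Sub η x v t) s) (true⊎ (dec a (x ∷ v) η))
  where
  a : Absolute ⌜ A ⌝₀
  a = abs₀ A
  cex : ∀ v η → _ → ∀ x → Sub x (evalT v t) → dec a (x ∷ v) η ≡ true ⊎ dec a (x ∷ v) η ≡ false →
      Sat η (x ∷ v) ⌜ A ⌝₀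
  cex v η h x s (inj₁ e) = proj₁ (dec✓ a _ η) e
  cex v η h x s (inj₂ e) = ⊥-elim (dec-false a _ η
    (flip-not (subSearch-spec (λ x → not (dec a (x ∷ v) η)) x (evalT v t) s (cong not e)))
    (h (proj₂ (subwordOf-Sub η _ v t) (subSearch-Sub (λ x → not (dec a (x ∷ v) η)) (evalT v t)))))
    where
    flip-not : ∀ {b} → not b ≡ true → b ≡ false
    flip-not {false} e = refl
abs₀ (exSub t A) = abs-∃ (abs-∧ (abs-subwordOf t) a)
  (λ v η → subSearch (λ x → dec a (x ∷ v) η) (evalT v t))
  (por-subSearch (decᵖ a) (por-term t) pors-id)
  λ v η x (s , h) → proj₂ (subwordOf-Sub η _ v t) (subSearch-Sub (λ x → dec a (x ∷ v) η) (evalT v t)) ,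
    proj₁ (dec✓ a _ η) (subSearch-spec (λ x → dec a (x ∷ v) η) x _ (proj₁ (subwordOf-Sub η x v t) s)
        (proj₂ (dec✓ a _ η) h))
  where
  a : Absolute ⌜ A ⌝₀
  a = abs₀ A

-- Stability, substitution and Leibniz' law

abs-stable : ∀ {k} {A : Fm k} → Absolute A → ∀ {w ρ} → InPORs ρ → Forces (¬ᶠ (¬ᶠ A)) w ρ → Forces A w ρ
abs-stable {A = A} a {w} {ρ} p h =
  intro a p (Holds-map (λ v η → dne v η (dec⊎ a (ρ v η) η)) (elim (abs-⇒ (abs-⇒ a abs-⊥) abs-⊥) p h))
  where
  dne : ∀ v η → Sat η (ρ v η) A ⊎ ¬ Sat η (ρ v η) A → ¬ ¬ Sat η (ρ v η) A → Sat η (ρ v η) A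
  dne v η (inj₁ s) f = s
  dne v η (inj₂ n) f = ⊥-elim (f n)

opaque
  -- Atoms are stable because they are decided, `∨ᶠ` and `∃ᶠ` because their clauses are negations,
  -- and the other connectives inherit stability. This validates `raa` and lets the negative `∨ᶠ`
  -- and `∃ᶠ` be eliminated into arbitrary formulas.
  Forces-stable : ∀ {k} (A : Fm k) {w ρ} → InPORs ρ → Forces (¬ᶠ (¬ᶠ A)) w ρ → Forces A w ρ
  Forces-stable (s ≐ t)  p h = abs-stable (abs-≐ s t) p h
  Forces-stable (s ⊑ t)  p h = abs-stable (abs-⊑ s t) p h
  Forces-stable (flip t) p h = abs-stable (abs-flip t) p h
  Forces-stable ⊥ᶠ       p h = abs-stable abs-⊥ p h
  Forces-stable (A ∧ᶠ B) p h =
    Forces-stable A p (λ w′ m n → h w′ m (λ w″ m′ (a , b) → n w″ m′ a)) ,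
    Forces-stable B p (λ w′ m n → h w′ m (λ w″ m′ (a , b) → n w″ m′ b))
  Forces-stable (A ∨ᶠ B) p h = λ w₁ m₁ na nb → h w₁ m₁ (λ w₂ m₂ ab →
    ab w₂ id≼ (λ w₃ m₃ → na w₃ (m₂ ∘≼ m₃)) (λ w₃ m₃ → nb w₃ (m₂ ∘≼ m₃)))
  Forces-stable (A ⇒ B) {w} {ρ} p h = λ w₁ m₁ a → Forces-stable B (pors-comp p (funᵖ m₁)) (λ w₂ m₂ nb →
    h w₂ (m₁ ∘≼ m₂) (λ w₃ m₃ f → nb w₃ m₃ (f w₃ id≼ (Forces-mono A a (m₂ ∘≼ m₃)))))
  Forces-stable (∀ᶠ A) p h = λ w₁ m₁ f fᵖ → Forces-stable A (◂ᵖ fᵖ (pors-comp p (funᵖ m₁))) (λ w₂ m₂ n →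
    h w₂ (m₁ ∘≼ m₂) (λ w₃ m₃ g → n w₃ m₃ (g w₃ id≼ _ (por-comp fᵖ (funᵖ (m₂ ∘≼ m₃))))))
  Forces-stable (∃ᶠ A) p h = λ w₁ m₁ n → h w₁ m₁ (λ w₂ m₂ e →
    e w₂ id≼ (λ w₃ m₃ → n w₃ (m₂ ∘≼ m₃)))

Forces-subF : ∀ {k l} (A : Fm k) {w} {ρ : Map (dim w) l} {ρ′ : Map (dim w) k} {σ : Fin k → Tm l} →
  (∀ v η i → lookup (ρ′ v η) i ≡ evalT (ρ v η) (σ i)) → Forces (subF σ A) w ρ ⟺ Forces A w ρ′
Forces-subF (s ≐ t)  {σ = σ} e = Holds-map (λ v η → proj₁ (Sat-subF {η} σ (e v η) (s ≐ t))) ,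
    Holds-map (λ v η → proj₂ (Sat-subF {η} σ (e v η) (s ≐ t)))
Forces-subF (s ⊑ t)  {σ = σ} e = Holds-map (λ v η → proj₁ (Sat-subF {η} σ (e v η) (s ⊑ t))) ,
    Holds-map (λ v η → proj₂ (Sat-subF {η} σ (e v η) (s ⊑ t)))
Forces-subF (flip t) {σ = σ} e = Holds-map (λ v η → proj₁ (Sat-subF {η} σ (e v η) (flip t))) ,
    Holds-map (λ v η → proj₂ (Sat-subF {η} σ (e v η) (flip t)))
Forces-subF ⊥ᶠ       e = (λ h → h) , (λ h → h)
Forces-subF (A ∧ᶠ B) e =
  (λ (a , b) → proj₁ (Forces-subF A e) a , proj₁ (Forces-subF B e) b) ,
  (λ (a , b) → proj₂ (Forces-subF A e) a , proj₂ (Forces-subF B e) b)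
Forces-subF (A ∨ᶠ B) e =
  (λ h w′ m na nb → h w′ m (λ w″ m′ a → na w″ m′
      (proj₁ (Forces-subF A (λ v η → e (fun m (fun m′ v η) η) η)) a))
                           (λ w″ m′ b → nb w″ m′ (proj₁
                               (Forces-subF B (λ v η → e (fun m (fun m′ v η) η) η)) b))) ,
  (λ h w′ m na nb → h w′ m (λ w″ m′ a → na w″ m′
      (proj₂ (Forces-subF A (λ v η → e (fun m (fun m′ v η) η) η)) a))
                           (λ w″ m′ b → nb w″ m′ (proj₂
                               (Forces-subF B (λ v η → e (fun m (fun m′ v η) η) η)) b)))
Forces-subF (A ⇒ B) e =
  (λ h w′ m a → proj₁ (Forces-subF B (λ v η → e (fun m v η) η))
      (h w′ m (proj₂ (Forces-subF A (λ v η → e (fun m v η) η)) a))) ,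
  (λ h w′ m a → proj₂ (Forces-subF B (λ v η → e (fun m v η) η))
      (h w′ m (proj₁ (Forces-subF A (λ v η → e (fun m v η) η)) a)))
Forces-subF (∀ᶠ A) {σ = σ} e =
  (λ h w′ m f fᵖ → proj₁ (Forces-subF A (λ v η → evalT-liftS σ (e (fun m v η) η) (f v η))) (h w′ m f fᵖ)) ,
  (λ h w′ m f fᵖ → proj₂ (Forces-subF A (λ v η → evalT-liftS σ (e (fun m v η) η) (f v η))) (h w′ m f fᵖ))
Forces-subF (∃ᶠ A) {σ = σ} e =
  (λ h w′ m n → h w′ m (λ w″ m′ f fᵖ a → n w″ m′ f fᵖ
     (proj₁ (Forces-subF A (λ v η → evalT-liftS σ (e (fun m (fun m′ v η) η) η) (f v η))) a))) ,
  (λ h w′ m n → h w′ m (λ w″ m′ f fᵖ a → n w″ m′ f fᵖ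
     (proj₂ (Forces-subF A (λ v η → evalT-liftS σ (e (fun m (fun m′ v η) η) η) (f v η))) a)))

Forces-wkF : ∀ {k} (A : Fm k) {w ρ f} → Forces (wkF A) w (f ◂ ρ) ⟺ Forces A w ρ
Forces-wkF A rewrite renF-subF suc A = Forces-subF A (λ v η i → refl)

opaque
  -- A forced equation holds only up to a violation, so nothing stronger may be assumed; the
  -- violation is absorbed at the atoms. This gives the soundness of `≐subst`.
  Forces-≡ : ∀ {k} (A : Fm k) {w ρ ρ′} → Holds w (λ v η → ρ v η ≡ ρ′ v η) → Forces A w ρ → Forces A w ρ′
  Forces-≡ (s ≐ t)  e h = Holds-map₂ (λ v η → subst (λ z → evalT z s ≡ evalT z t)) e h
  Forces-≡ (s ⊑ t)  e h = Holds-map₂ (λ v η → subst (λ z → Prefix (evalT z s) (evalT z t))) e h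
  Forces-≡ (flip t) e h = Holds-map₂ (λ v η → subst (λ z → η (evalT z t) ≡ true)) e h
  Forces-≡ ⊥ᶠ       e h = h
  Forces-≡ (A ∧ᶠ B) e (a , b) = Forces-≡ A e a , Forces-≡ B e b
  Forces-≡ (A ∨ᶠ B) e h w′ m na nb = h w′ m
    (λ w″ m′ a → na w″ m′ (Forces-≡ A (Holds-mono e (m ∘≼ m′)) a))
    (λ w″ m′ b → nb w″ m′ (Forces-≡ B (Holds-mono e (m ∘≼ m′)) b))
  Forces-≡ (A ⇒ B)  e h w′ m a = Forces-≡ B (Holds-mono e m)
      (h w′ m (Forces-≡ A (Holds-map (λ v η → sym) (Holds-mono e m)) a))
  Forces-≡ (∀ᶠ A)   e h w′ m f fᵖ = Forces-≡ A (Holds-map (λ v η → cong (f v η ∷_))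
      (Holds-mono e m)) (h w′ m f fᵖ)
  Forces-≡ (∃ᶠ A)   e h w′ m n = h w′ m
    (λ w″ m′ f fᵖ a → n w″ m′ f fᵖ
        (Forces-≡ A (Holds-map (λ v η → cong (f v η ∷_)) (Holds-mono e (m ∘≼ m′))) a))

-- Witnesses of Σb1 formulas

-- One string codes the witnesses of the whole quantifier block. All of them obey their bounds and
-- the code ends in `ε`, so the length of a code is bounded by a term.
Wit : ∀ {k} → Σb1 k → Oracle → Str → Vec Str k → Set
Wit (base G)   η s v = Sat η v ⌜ G ⌝₀ × s ≡ ε
Wit (exLe t B) η s v = Σ Str λ y → Σ Str λ s′ →
  s ≡ pair y s′ × Sat η (y ∷ v) (leq v0 (wkT t)) × Wit B η s′ (y ∷ v)

Wit-Sat : ∀ {k} (B : Σb1 k) {η s v} → Wit B η s v → Sat η v ⌜ B ⌝₁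
Wit-Sat (base G)   (a , _) = a
Wit-Sat (exLe t B) (y , s′ , _ , l , h) = y , l , Wit-Sat B h

wit? : ∀ {k} → Σb1 k → Dc (suc k)
wit? (base G)   v η = dec (abs₀ G) (tail v) η ∧ eqˢ (head v) ε
wit? (exLe t B) v η = eqˢ (head v) (pair (fst (head v)) (snd (head v))) ∧
  (dec (abs-⊑ (oneᵗ ×ᵗ v0) (oneᵗ ×ᵗ wkT t)) (fst (head v) ∷ tail v) η ∧ wit? B
      (snd (head v) ∷ fst (head v) ∷ tail v) η)

wit?ᵖ : ∀ {k} (B : Σb1 k) → InPORᵈ (wit? B)
wit?ᵖ (base G) = por-∧ (por-compᵈ (decᵖ (abs₀ G)) (pors-tail pors-id))
                       (por-eqˢ por-head por-ε)
wit?ᵖ {k} (exLe t B) = por-∧ (por-eqˢ por-head (por-pair (por-fst por-head) (por-snd por-head)))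
  (por-∧ (por-compᵈ
            (decᵖ (abs-⊑ (oneᵗ ×ᵗ v0) (oneᵗ ×ᵗ wkT t))) p)
         (por-compᵈ
            (wit?ᵖ B) (◂ᵖ (por-snd por-head) p)))
  where
  fh : Fn (suc k)
  fh v η = fst (head v)
  p : InPORs (fh ◂ λ v η → tail v)
  p = ◂ᵖ (por-fst por-head) (pors-tail pors-id)

wit?✓ : ∀ {k} (B : Σb1 k) η s v → wit? B (s ∷ v) η ≡ true ⟺ Wit B η s v
wit?✓ (base G) η s v =
  (λ e → let (a , b) = ∧-true e in proj₁ (dec✓ (abs₀ G) v η) a , proj₁ (eqˢ-spec s ε) b) ,
  (λ (a , b) → ∧-intro (proj₂ (dec✓ (abs₀ G) v η) a) (proj₂ (eqˢ-spec s ε) b))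
wit?✓ (exLe t B) η s v =
  (λ e → let (a , e′) = ∧-true e ; (b , c) = ∧-true e′ in
     fst s , snd s , proj₁ (eqˢ-spec _ _) a , proj₁ (dec✓ (abs-⊑ (oneᵗ ×ᵗ v0) (oneᵗ ×ᵗ wkT t)) _ η)
         b , proj₁ (wit?✓ B η _ _) c) ,
  λ { (y , s′ , refl , l , h) → fr y s′ l h }
  where
  fr : ∀ y s′ → Sat η (y ∷ v) (leq v0 (wkT t)) → Wit B η s′ (y ∷ v) → wit? (exLe t B) (pair y s′ ∷ v) η ≡ true
  fr y s′ l h rewrite fst-pair y s′ | snd-pair y s′ =
    ∧-intro (proj₂ (eqˢ-spec (pair y s′) (pair y s′)) refl)
      (∧-intro (proj₂ (dec✓ (abs-⊑ (oneᵗ ×ᵗ v0) (oneᵗ ×ᵗ wkT t)) (y ∷ v) η) l)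
          (proj₂ (wit?✓ B η s′ (y ∷ v)) h))

Wit-bound : ∀ {k} (B : Σb1 k) → Σ (Tm k) λ T → ∀ η s v → Wit B η s v → len s ≤ len (evalT v T)
Wit-bound (base G) = eps , λ { η .ε v (_ , refl) → z≤n }
Wit-bound {k} (exLe t B) = T , λ { η _ v (y , s′ , refl , l , h) → bd η v y s′ l h }
  where
  T′ = proj₁ (Wit-bound B)
  σ : Fin (suc k) → Tm k
  σ zero    = t
  σ (suc i) = var i
  -- `pair y s′` spends two bits on each bit of `y` and one on the separator; in the bound for `s′`
  -- the variable `y` is replaced by its own bound `t`.
  T = (t ⌢ᵗ t ⌢ᵗ oneᵗ) ⌢ᵗ subT σ T′
  bd : ∀ η v y s′ → Sat η (y ∷ v) (leq v0 (wkT t)) → Wit B η s′ (y ∷ v) → len (pair y s′) ≤ len (evalT v T)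
  bd η v y s′ l h rewrite len-⌢ (evalT v t ⌢ evalT v t · true) (evalT v (subT σ T′)) | len-⌢
      (evalT v t) (evalT v t)
    | len-pair y s′ | evalT-subT {v = v} {v′ = evalT v t ∷ v} σ (λ { zero → refl ; (suc i) → refl }) T′ =
    s≤s (+-mono-≤ (+-mono-≤ y≤t y≤t)
      (≤-trans (proj₂ (Wit-bound B) η s′ (y ∷ v) h)
               (evalT-mono (y ∷ v) (evalT v t ∷ v) (λ { zero → y≤t ; (suc i) → ≤-refl }) T′)))
    where
    y≤t : len y ≤ len (evalT v t)
    y≤t = ≤-trans (leq⇒≤ y _ l) (≤-reflexive (cong len (evalT-wkT y v t)))

-- A single function serves as witness and as violation. Since witnesses are decidable, a test of
-- its value tells which of the two has been obtained.
WitHolds : ∀ {k} (B : Σb1 k) (w : World) → Map (dim w) k → Set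
WitHolds B w ρ = Σ (Fn (dim w)) λ f → InPOR f × (∀ v η → Wit B η (f v η) (ρ v η) ⊎ χ w (f v η ∷ v) η ≡ true)

opaque
  WitHolds⇒Forces : ∀ {k} (B : Σb1 k) {w ρ} → InPORs ρ → (f : Fn (dim w)) → InPOR f →
    Holds w (λ v η → Wit B η (f v η) (ρ v η)) → Forces ⌜ B ⌝₁ w ρ
  WitHolds⇒Forces (base G) p f fᵖ h = intro (abs₀ G) p (Holds-map (λ v η → proj₁) h)
  WitHolds⇒Forces (exLe t B) {w} {ρ} p f fᵖ h w′ m n = n w′ id≼ g (por-fst f′ᵖ)
    (intro (abs-⊑ (oneᵗ ×ᵗ v0) (oneᵗ ×ᵗ wkT t)) (◂ᵖ (por-fst f′ᵖ) (pors-comp p (funᵖ m)))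
       (Holds-map (λ v η → leq-of v η) (Holds-mono h m)) ,
     WitHolds⇒Forces B (◂ᵖ (por-fst f′ᵖ) (pors-comp p (funᵖ m))) (λ v η → snd (f′ v η)) (por-snd f′ᵖ)
       (Holds-map (λ v η → wit-of v η) (Holds-mono h m)))
    where
    f′ : Fn (dim w′)
    f′ v η = f (fun m v η) η
    f′ᵖ : InPOR f′
    f′ᵖ = por-comp fᵖ (funᵖ m)
    g : Fn (dim w′)
    g v η = fst (f′ v η)
    leq-of : ∀ v η → Wit (exLe t B) η (f′ v η) (ρ (fun m v η) η) → Sat η (g v η ∷ ρ (fun m v η) η)
        (leq v0 (wkT t))
    leq-of v η (y , s′ , e , l , h) rewrite e | fst-pair y s′ = l
    wit-of : ∀ v η → Wit (exLe t B) η (f′ v η) (ρ (fun m v η) η) → Wit B η (snd (f′ v η))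
        (g v η ∷ ρ (fun m v η) η)
    wit-of v η (y , s′ , e , l , h) rewrite e | fst-pair y s′ | snd-pair y s′ = h

module _ {k} (B : Σb1 k) {w : World} {ρ : Map (dim w) k} (p : InPORs ρ) where
  isWit : Dc (suc (dim w))
  isWit v η = wit? B (head v ∷ ρ (tail v) η) η

  opaque
    isWitᵖ : InPORᵈ isWit
    isWitᵖ = por-compᵈ (wit?ᵖ B)
               (◂ᵖ por-head (pors-comp p (pors-tail pors-id)))

  witless : World
  witless = extend w isWit isWitᵖ

  witless≼ : witless ≼ w
  witless≼ = extend≼ isWit isWitᵖ

  witless-elim : Bot witless → WitHolds B w ρ
  witless-elim (holds f fᵖ q) = f , fᵖ , λ v η → lem v η (q v η)
    where
    lem : ∀ v η → ⊥ ⊎ χ witless (f v η ∷ v) η ≡ true → Wit B η (f v η) (ρ v η) ⊎ χ w (f v η ∷ v) η ≡ true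
    lem v η (inj₂ c) with ∨-true {χ w (f v η ∷ v) η} c
    ... | inj₁ a = inj₂ a
    ... | inj₂ a = inj₁ (proj₁ (wit?✓ B η (f v η) (ρ v η)) a)

  witless-viol : ∀ {w′} (m : w′ ≼ witless) s v η → Wit B η s (ρ (fun m v η) η) → χ w′ (s ∷ v) η ≡ true
  witless-viol m s v η h = pres m s v η (∨-introʳ (proj₂ (wit?✓ B η s (ρ (fun m v η) η)) h))

-- In the world where no string is a witness, every forced instance of the
-- existential formula yields a violation, namely a witness.
opaque
  Forces⇒WitHolds : ∀ {k} (B : Σb1 k) {w ρ} → InPORs ρ → Forces ⌜ B ⌝₁ w ρ → WitHolds B w ρ
  Forces⇒WitHolds (base G) {w} {ρ} p h with elim (abs₀ G) p h
  ... | holds f fᵖ q = g , por-if (dec-atᵖ (abs₀ G) {w = w} p) por-ε fᵖ , spec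
    where
    g : Fn (dim w)
    g v η = if dec (abs₀ G) (ρ v η) η then ε else f v η
    spec : ∀ v η → Wit (base G) η (g v η) (ρ v η) ⊎ χ w (g v η ∷ v) η ≡ true
    spec v η with true⊎ (dec (abs₀ G) (ρ v η) η)
    ... | inj₁ e rewrite e = inj₁ (proj₁ (dec✓ (abs₀ G) _ η) e , refl)
    ... | inj₂ e rewrite e with q v η
    ... | inj₁ s = ⊥-elim (dec-false (abs₀ G) _ η e s)
    ... | inj₂ c = inj₂ c
  Forces⇒WitHolds {k} (exLe t B) {w} {ρ} p h = witless-elim (exLe t B) p
      (h (witless (exLe t B) {w} p) (witless≼ (exLe t B) {w} p) neg)
    where
    neg : ∀ w₂ (m : w₂ ≼ witless (exLe t B) {w} p) (f : Fn (dim w₂)) → InPOR f →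
          Forces (leq v0 (wkT t) ∧ᶠ ⌜ B ⌝₁) w₂ (f ◂ ρ ⟨ m ⟩) → Bot w₂
    neg w₂ m f fᵖ (holds l lᵖ l✓ , b) with Forces⇒WitHolds B (◂ᵖ fᵖ (pors-comp p (funᵖ m))) b
    ... | g , gᵖ , q = holds k′ kᵖ spec
      where
      k′ : Fn (dim w₂)
      -- If neither `g` nor `l` gives a violation, then both conjuncts are true and the pair is a
      -- witness, which is a violation of the witless assumption.
      k′ v η = if χ w₂ (g v η ∷ v) η then g v η else (if χ w₂ (l v η ∷ v) η then l v η else pair
          (f v η) (g v η))
      kᵖ : InPOR k′
      kᵖ = por-if (por-compᵈ (χᵖ w₂) (◂ᵖ gᵖ pors-id)) gᵖ
             (por-if (por-compᵈ (χᵖ w₂) (◂ᵖ lᵖ pors-id))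
                lᵖ (por-pair fᵖ gᵖ))
      spec : ∀ v η → ⊥ ⊎ χ w₂ (k′ v η ∷ v) η ≡ true
      spec v η with true⊎ (χ w₂ (g v η ∷ v) η)
      ... | inj₁ e₁ rewrite e₁ = inj₂ e₁
      ... | inj₂ e₁ rewrite e₁ with true⊎ (χ w₂ (l v η ∷ v) η)
      ... | inj₁ e₂ rewrite e₂ = inj₂ e₂
      ... | inj₂ e₂ rewrite e₂ with q v η | l✓ v η
      ... | inj₂ a | _      = true≢false a e₁
      ... | _      | inj₂ a = true≢false a e₂
      ... | inj₁ a | inj₁ c = inj₂ (witless-viol (exLe t B) {w} p m (pair (f v η) (g v η)) v η
          (f v η , g v η , refl , c , a))

-- Soundness of RS for forcing

evalT-bit : ∀ {n} (v : Vec Str n) b → evalT v (bitᵗ b) ≡ ε · b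
evalT-bit v false = refl
evalT-bit v true  = refl

forces-true : ∀ {k} (G : Σb0 k) → (∀ η v → Sat₀ η v G) → ∀ {w ρ} → InPORs ρ → Forces ⌜ G ⌝₀ w ρ
forces-true G h p = intro (abs₀ G) p (Holds-pure (λ v η → h η _))

forces-atSucc : ∀ {k} b (A : Fm (suc k)) {w f ρ} →
                Forces (atSucc b A) w (f ◂ ρ) → Forces A w ((λ v η → f v η · b) ◂ ρ)
forces-atSucc false A = proj₁ (Forces-subF A (λ { v η zero → refl ; v η (suc i) → refl }))
forces-atSucc true  A = proj₁ (Forces-subF A (λ { v η zero → refl ; v η (suc i) → refl }))

-- The realizer of an instance of induction keeps a witness as long as it has
-- one; once it holds a violation it never changes it.
module _ {n} (B : Σb1 (suc n)) {w : World} {ρ : Map (dim w) n} (p : InPORs ρ) where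
  private
    d = dim w

    witAt : Dc (2 + d)
    witAt v η = wit? B (head v ∷ head (tail v) ∷ ρ (tail (tail v)) η) η

    witAtᵖ : InPORᵈ witAt
    witAtᵖ = por-compᵈ (wit?ᵖ B)
      (◂ᵖ por-head (◂ᵖ (por-comp por-head (pors-tail pors-id))
         (pors-comp p (pors-tail (pors-tail pors-id)))))

    χ₂ : Dc (3 + d)
    χ₂ v η = χ w (head v ∷ tail (tail (tail v))) η ∨ not (witAt (tail v) η)

    χ₂ᵖ : InPORᵈ χ₂
    χ₂ᵖ = por-∨ (por-compᵈ (χᵖ w)
                    (◂ᵖ por-head (pors-tail (pors-tail (pors-tail pors-id)))))
                (por-not (por-compᵈ witAtᵖ (pors-tail pors-id)))

    -- Two more generic strings s and x, where s is assumed to be a witness of B at x.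
    w₂ : World
    w₂ = world (2 + d) χ₂ χ₂ᵖ

    m₂ : w₂ ≼ w
    m₂ = mor (λ v η → tail (tail v)) (pors-tail (pors-tail pors-id)) (λ s v η → ∨-introˡ)

    x₂ : Fn (2 + d)
    x₂ v η = head (tail v)

    x₂ᵖ : InPOR x₂
    x₂ᵖ = por-comp por-head (pors-tail pors-id)

    forced-at-x : Forces ⌜ B ⌝₁ w₂ (x₂ ◂ ρ ⟨ m₂ ⟩)
    forced-at-x = WitHolds⇒Forces B (◂ᵖ x₂ᵖ (pors-comp p (funᵖ m₂))) (λ v η → head v) por-head
      (holds (λ v η → ε) por-ε λ v η → Data.Sum.map (proj₁ (wit?✓ B η _ _))
        (λ e → ∨-introʳ {χ w (ε ∷ tail (tail v)) η} (cong not e)) (true⊎ (witAt v η)))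

  forces-ind : Forces (⌜ B ⌝₁ [ eps ]) w ρ →
               Forces (∀ᶠ (⌜ B ⌝₁ ⇒ (atSucc false ⌜ B ⌝₁ ∧ᶠ atSucc true ⌜ B ⌝₁))) w ρ →
               ∀ (f : Fn d) → InPOR f → Forces ⌜ B ⌝₁ w (f ◂ ρ)
  forces-ind h₀ hs f fᵖ = WitHolds⇒Forces B (◂ᵖ fᵖ p) (λ v η → r (f v η) v η) rfᵖ
                            (holds (λ v η → r (f v η) v η) rfᵖ λ v η → inv (f v η) v η)
    where
    base-wit : WitHolds B w ((λ v η → ε) ◂ ρ)
    base-wit = Forces⇒WitHolds B (◂ᵖ por-ε p)
      (proj₁ (Forces-subF ⌜ B ⌝₁ (λ { v η zero → refl ; v η (suc i) → refl })) h₀)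
    -- The step hypothesis is used at the generic string `x` with its generic witness `s`. The
    -- function obtained depends on `s`, `x` and the old generic strings, which is the type of a
    -- recursion step.
    step-wit : ∀ b → WitHolds B w₂ ((λ v η → x₂ v η · b) ◂ ρ ⟨ m₂ ⟩)
    step-wit b = Forces⇒WitHolds B (◂ᵖ (por-snoc b x₂ᵖ) (pors-comp p (funᵖ m₂)))
                   (forces-atSucc b ⌜ B ⌝₁ (pick b))
      where
      both = hs w₂ m₂ x₂ x₂ᵖ w₂ id≼ forced-at-x
      pick : ∀ b → Forces (atSucc b ⌜ B ⌝₁) w₂ (x₂ ◂ ρ ⟨ m₂ ⟩)
      pick false = proj₁ both
      pick true  = proj₂ both
    a₀ = proj₁ base-wit
    a : Bool → Fn (2 + d)
    a b = proj₁ (step-wit b)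
    r : Str → Fn d
    r ε       v η = a₀ v η
    r (x · b) v η = if witAt (r x v η ∷ x ∷ v) η then a b (r x v η ∷ x ∷ v) η else r x v η
    inv : ∀ x v η → Wit B η (r x v η) (x ∷ ρ v η) ⊎ χ w (r x v η ∷ v) η ≡ true
    inv ε v η = proj₂ (proj₂ base-wit) v η
    inv (x · b) v η with true⊎ (witAt (r x v η ∷ x ∷ v) η)
    ... | inj₁ e rewrite e = Data.Sum.map₂ (λ c → Data.Sum.[ (λ z → z) ,
        (λ z → true≢false e (not-true z)) ] (∨-true {χ w (a b (r x v η ∷ x ∷ v) η ∷ v) η} c))
                               (proj₂ (proj₂ (step-wit b)) (r x v η ∷ x ∷ v) η)
      where
      not-true : ∀ {b} → not b ≡ true → b ≡ false
      not-true {false} e = refl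
    ... | inj₂ e rewrite e with inv x v η
    ... | inj₁ h = true≢false (proj₂ (wit?✓ B η _ _) h) e
    ... | inj₂ c = inj₂ c
    -- A step is only taken from a witness, and by `Wit-bound` the length of a witness does not
    -- depend on how many steps led to it. So the bound of one step, with `s` replaced by the bound
    -- `TW` on witnesses and the parameters by their bounds `U`, serves for all steps; `T` adds the
    -- bounds of the base value and of the two steps.
    U : Fin n → Tm d
    U i = proj₁ (InPOR-bound (component p i))
    TW : Tm (suc n)
    TW = proj₁ (Wit-bound B)
    σW : Fin (suc n) → Tm (suc d)
    σW zero    = v0
    σW (suc i) = wkT (U i)
    Ta : Bool → Tm (2 + d)
    Ta b = proj₁ (InPOR-bound (proj₁ (proj₂ (step-wit b))))
    σa : Fin (2 + d) → Tm (suc d)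
    σa zero    = subT σW TW
    σa (suc i) = var i
    U₀ : Tm d
    U₀ = proj₁ (InPOR-bound (proj₁ (proj₂ base-wit)))
    T₀ : Tm (suc d)
    T₀ = wkT U₀
    T : Tm (suc d)
    T = (T₀ ⌢ᵗ subT σa (Ta false)) ⌢ᵗ subT σa (Ta true)
    ⊔ˡ : ∀ x y z → len x ≤ len ((x ⌢ y) ⌢ z)
    ⊔ˡ x y z rewrite len-⌢ (x ⌢ y) z | len-⌢ x y = ≤-trans (m≤m+n (len x) (len y)) (m≤m+n _ (len z))
    ⊔ᵐ : ∀ x y z → len y ≤ len ((x ⌢ y) ⌢ z)
    ⊔ᵐ x y z rewrite len-⌢ (x ⌢ y) z | len-⌢ x y = ≤-trans (m≤n+m (len y) (len x)) (m≤m+n _ (len z))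
    ⊔ʳ : ∀ x y z → len z ≤ len ((x ⌢ y) ⌢ z)
    ⊔ʳ x y z rewrite len-⌢ (x ⌢ y) z = m≤n+m (len z) _
    Ta≤T : ∀ b v → len (evalT v (subT σa (Ta b))) ≤ len (evalT v T)
    Ta≤T false v = ⊔ᵐ (evalT v T₀) (evalT v (subT σa (Ta false))) (evalT v (subT σa (Ta true)))
    Ta≤T true  v = ⊔ʳ (evalT v T₀) (evalT v (subT σa (Ta false))) (evalT v (subT σa (Ta true)))
    wit≤ : ∀ x v η s → Wit B η s (x ∷ ρ v η) → len s ≤ len (evalT (x ∷ v) (subT σW TW))
    wit≤ x v η s h = ≤-trans (proj₂ (Wit-bound B) η s (x ∷ ρ v η) h)
      (≤-trans (evalT-mono (x ∷ ρ v η) (x ∷ tabulate (λ i → evalT v (U i))) le TW)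
               (≤-reflexive (cong len (sym (evalT-subT σW le≡ TW)))))
      where
      le : ∀ i → len (lookup (x ∷ ρ v η) i) ≤ len (lookup (x ∷ tabulate (λ i → evalT v (U i))) i)
      le zero    = ≤-refl
      le (suc i) rewrite lookup∘tabulate (λ i → evalT v (U i)) i = proj₂ (InPOR-bound (component p i)) v η
      le≡ : ∀ i → lookup (x ∷ tabulate (λ i → evalT v (U i))) i ≡ evalT (x ∷ v) (σW i)
      le≡ zero    = refl
      le≡ (suc i) = trans (lookup∘tabulate (λ i → evalT v (U i)) i) (sym (evalT-wkT x v (U i)))
    bd : ∀ x v η → len (r x v η) ≤ len (evalT (x ∷ v) T)
    bd′ : ∀ x b v η → len (r (x · b) v η) ≤ len (evalT (x ∷ v) T)
    bd ε v η = ≤-trans (≤-trans (proj₂ (InPOR-bound (proj₁ (proj₂ base-wit))) v η)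
                        (≤-reflexive (cong len (sym (evalT-wkT ε v U₀)))))
                            (⊔ˡ (evalT (ε ∷ v) T₀) (evalT (ε ∷ v) (subT σa (Ta false)))
                                (evalT (ε ∷ v) (subT σa (Ta true))))
    bd (x · b) v η = ≤-trans (bd′ x b v η)
      (evalT-mono (x ∷ v) (x · b ∷ v) (λ { zero → n≤1+n _ ; (suc i) → ≤-refl }) T)
    bd′ x b v η with true⊎ (witAt (r x v η ∷ x ∷ v) η)
    ... | inj₂ e rewrite e = bd x v η
    ... | inj₁ e rewrite e = ≤-trans (proj₂ (InPOR-bound (proj₁ (proj₂ (step-wit b)))) (r x v η ∷ x ∷ v) η)
      (≤-trans (evalT-mono (r x v η ∷ x ∷ v) (evalT (x ∷ v) (subT σW TW) ∷ x ∷ v)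
                  (λ { zero → wit≤ x v η _ (proj₁ (wit?✓ B η _ _) e) ; (suc i) → ≤-refl }) (Ta b))
        (≤-trans (≤-reflexive (cong len (sym (evalT-subT {v′ = evalT (x ∷ v) (subT σW TW) ∷ x ∷ v} σa
                    (λ { zero → refl ; (suc i) → refl }) (Ta b)))))
                 (Ta≤T b (x ∷ v))))
    rᵖ : InPOR (λ v η → r (head v) (tail v) η)
    rᵖ = por-rec r (λ b v η → if witAt v η then a b v η else head v) T
           (proj₁ (proj₂ base-wit))
           (λ b → por-if witAtᵖ (proj₁ (proj₂ (step-wit b))) por-head)
           (λ y b v η → refl) bd′
    rfᵖ : InPOR (λ v η → r (f v η) v η)
    rfᵖ = por-rec-at r rᵖ fᵖ pors-id

forces-axiom : ∀ {k} {A : Fm k} → Axiom A → ∀ {w ρ} → InPORs ρ → Forces A w ρ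
forces-axiom (B1 x) = forces-true (eqᵇ (x ⌢ᵗ eps) x) λ η v → refl
forces-axiom (B2 x y b) = forces-true G h
  where
  G = eqᵇ (x ⌢ᵗ (y ⌢ᵗ bitᵗ b)) ((x ⌢ᵗ y) ⌢ᵗ bitᵗ b)
  h : ∀ η v → Sat₀ η v G
  h η v rewrite evalT-bit v b = refl
forces-axiom (B3 x) = forces-true (eqᵇ (x ×ᵗ eps) eps) λ η v → refl
forces-axiom (B4 x y b) = forces-true G h
  where
  G = eqᵇ (x ×ᵗ (y ⌢ᵗ bitᵗ b)) ((x ×ᵗ y) ⌢ᵗ x)
  h : ∀ η v → Sat₀ η v G
  h η v rewrite evalT-bit v b = refl
forces-axiom (B5 x) = forces-true (andᵇ (impᵇ (preᵇ x eps) (eqᵇ x eps)) (impᵇ (eqᵇ x eps) (preᵇ x eps)))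
  λ η v → (λ { (ε , e) → e }) , (λ e → ε , e)
forces-axiom (B6 x y b) = forces-true G h
  where
  G = andᵇ (impᵇ (preᵇ x (y ⌢ᵗ bitᵗ b)) (orᵇ (preᵇ x y) (eqᵇ x (y ⌢ᵗ bitᵗ b))))
           (impᵇ (orᵇ (preᵇ x y) (eqᵇ x (y ⌢ᵗ bitᵗ b))) (preᵇ x (y ⌢ᵗ bitᵗ b)))
  h : ∀ η v → Sat₀ η v G
  h η v rewrite evalT-bit v b = Prefix-snoc , λ { (inj₁ q) → Prefix-·ʳ b q ; (inj₂ q) → ε , q }
forces-axiom (B7 x y b) = forces-true G h
  where
  G = impᵇ (eqᵇ (x ⌢ᵗ bitᵗ b) (y ⌢ᵗ bitᵗ b)) (eqᵇ x y)
  h : ∀ η v → Sat₀ η v G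
  h η v rewrite evalT-bit v b = ·-injectiveˡ
forces-axiom (B8 x y) = forces-true (notᵇ (eqᵇ (x ⌢ᵗ zeroᵗ) (y ⌢ᵗ oneᵗ))) λ η v ()
forces-axiom (B9 x b) = forces-true G h
  where
  G = notᵇ (eqᵇ (x ⌢ᵗ bitᵗ b) eps)
  h : ∀ η v → Sat₀ η v G
  h η v rewrite evalT-bit v b = λ ()
forces-axiom (IND B) {w} {ρ} p = λ w₀ m₀ (h₀ , hs) w₁ m₁ f fᵖ →
  forces-ind B (pors-comp (pors-comp p (funᵖ m₀)) (funᵖ m₁)) (Forces-mono (⌜ B ⌝₁ [ eps ]) h₀ m₁)
    (λ w₂ m₂ → hs w₂ (m₁ ∘≼ m₂)) f fᵖ

soundness : ∀ {k} {Γ : List (Fm k)} {A} → Γ ⊢ A → ∀ {w ρ} → InPORs ρ →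
            (∀ {B} → B ∈ Γ → Forces B w ρ) → Forces A w ρ

push : ∀ {k} {Γ : List (Fm k)} {A} {w ρ} → Forces A w ρ → (∀ {B} → B ∈ Γ → Forces B w ρ) →
       ∀ {B} → B ∈ A ∷ Γ → Forces B w ρ
push a γ (here refl) = a
push a γ (there i)   = γ i

shift : ∀ {k} {Γ : List (Fm k)} {w ρ f} → (∀ {B} → B ∈ Γ → Forces B w ρ) →
        ∀ {B} → B ∈ map wkF Γ → Forces B w (f ◂ ρ)
shift {Γ = Γ} γ i with ∈-map⁻ wkF i
... | B , j , refl = proj₂ (Forces-wkF B) (γ j)

restrict : ∀ {k} {Γ : List (Fm k)} {w w′ ρ} (m : w′ ≼ w) → (∀ {B} → B ∈ Γ → Forces B w ρ) →
           ∀ {B} → B ∈ Γ → Forces B w′ (ρ ⟨ m ⟩)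
restrict m γ {B} i = Forces-mono B (γ i) m

at-term : ∀ {k} (A : Fm (suc k)) t {w ρ} →
          Forces (A [ t ]) w ρ ⟺ Forces A w ((λ v η → evalT (ρ v η) t) ◂ ρ)
at-term A t = Forces-subF A (λ { v η zero → refl ; v η (suc i) → refl })

soundness (ax a) p γ = forces-axiom a p
soundness (hyp i) p γ = γ i
soundness (⇒I d) p γ w m a = soundness d (pors-comp p (funᵖ m)) (push a (restrict m γ))
soundness (⇒E d e) {w} p γ = soundness d p γ w id≼ (soundness e p γ)
soundness (∧I d e) p γ = soundness d p γ , soundness e p γ
soundness (∧E₁ d) p γ = proj₁ (soundness d p γ)
soundness (∧E₂ d) p γ = proj₂ (soundness d p γ)
soundness (∨I₁ {A = A} d) {ρ = ρ} p γ w m na nb = na w id≼ (Forces-mono A (soundness d p γ) m)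
soundness (∨I₂ {B = B} d) {ρ = ρ} p γ w m na nb = nb w id≼ (Forces-mono B (soundness d p γ) m)
soundness (∨E {C = D} d e₁ e₂) p γ = Forces-stable D p λ w m n →
  soundness d p γ w m
    (λ w′ m′ a → n w′ m′ (soundness e₁ (pors-comp p (funᵖ (m ∘≼ m′))) (push a (restrict (m ∘≼ m′) γ))))
    (λ w′ m′ b → n w′ m′ (soundness e₂ (pors-comp p (funᵖ (m ∘≼ m′))) (push b (restrict (m ∘≼ m′) γ))))
soundness (⊥E {A = A} d) p γ = Forces-stable A p λ w m n → Holds-mono (soundness d p γ) m
soundness (raa {A = A} d) p γ = Forces-stable A p λ w m n →
  soundness d (pors-comp p (funᵖ m)) (push n (restrict m γ))
soundness (∀I d) p γ w m f fᵖ = soundness d (◂ᵖ fᵖ (pors-comp p (funᵖ m))) (shift (restrict m γ))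
soundness (∀E {A = A} d t) {w} {ρ} p γ = proj₂ (at-term A t)
  (soundness d p γ w id≼ (λ v η → evalT (ρ v η) t) (por-comp (por-term t) p))
soundness (∃I {A = A} t d) {w} {ρ} p γ w′ m n = n w′ id≼ (λ v η → evalT (ρ (fun m v η) η) t)
  (por-comp (por-term t) (pors-comp p (funᵖ m)))
  (Forces-mono A (proj₁ (at-term A t) (soundness d p γ)) m)
soundness (∃E {C = D} d e) p γ = Forces-stable D p λ w m n →
  soundness d p γ w m (λ w′ m′ f fᵖ a → n w′ m′ (proj₁ (Forces-wkF D)
    (soundness e (◂ᵖ fᵖ (pors-comp p (funᵖ (m ∘≼ m′)))) (push a (shift (restrict (m ∘≼ m′) γ))))))
soundness (≐refl t) p γ = Holds-pure (λ v η → refl)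
soundness (≐subst A {s} {t} d e) {w} {ρ} p γ = proj₂ (at-term A t)
  (Forces-≡ A (Holds-map (λ v η → cong (_∷ ρ v η)) (soundness d p γ)) (proj₁ (at-term A s) (soundness e p γ)))

Forces-allN : ∀ k (A : Fm k) {w} {ρ : Map (dim w) k} → InPORs ρ →
              Forces (allN k A) w (λ v η → []) → Forces A w ρ
Forces-allN zero A {ρ = ρ} p h = Forces-≡ A (Holds-pure (λ v η → lem (ρ v η))) h
  where
  lem : ∀ v → [] ≡ v
  lem [] = refl
Forces-allN (suc k) A {w} {ρ} p h = Forces-≡ A (Holds-pure (λ v η → lem (ρ v η)))
  (Forces-allN k (∀ᶠ A) (pors-tail p) h w id≼ (λ v η → head (ρ v η))
     (por-comp por-head p))
  where
  lem : ∀ v → head v ∷ tail v ≡ v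
  lem (x ∷ v) = refl

-- From provable totality to a POR function

evalT-num : ∀ {n} (v : Vec Str n) x → evalT v (num x) ≡ x
evalT-num v ε       = refl
evalT-num v (x · b) rewrite evalT-num v x | evalT-bit v b = refl

Sat-instF : ∀ {k} (F : Σb1 (suc k)) v y η → InInterp η (instF F v y) ⟺ Sat η (y ∷ v) ⌜ F ⌝₁
Sat-instF F v y η = Sat-subF _
    (λ { zero → sym (evalT-num [] y) ; (suc i) → sym (evalT-num [] (lookup v i)) }) ⌜ F ⌝₁

-- Extraction: in the world that assumes that no string codes a value of F
-- together with a witness, totality yields such a code.
extract : ∀ {k} (F : Σb1 (suc k)) → RS (Totality F) →
          Σ (Fn k) λ f → InPOR f × (∀ v η → Sat η (f v η ∷ v) ⌜ F ⌝₁)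
extract {k} F total = (λ v η → fst (viol bot v η)) , por-fst (violᵖ bot) ,
  λ v η → Wit-Sat F (proj₁ (wit?✓ F η _ _) (value (true⊎viol bot v η)))
  where
  -- Nothing violates the assumption of `none`; hence every violation at `w` satisfies `e`, that is,
  -- it codes a value and a witness.
  none : World
  none = world k (λ v η → false) (por-const false)
  e : Dc (suc k)
  e v η = wit? F (snd (head v) ∷ fst (head v) ∷ tail v) η
  eᵖ : InPORᵈ e
  eᵖ = por-compᵈ (wit?ᵖ F)
         (◂ᵖ (por-snd por-head) (◂ᵖ (por-fst por-head) (pors-tail pors-id)))
  value : ∀ {b : Bool} → ⊥ ⊎ b ≡ true → b ≡ true
  value (inj₂ h) = h
  w : World
  w = extend none e eᵖ
  neg : ∀ w′ (m : w′ ≼ w) (f : Fn (dim w′)) → InPOR f → Forces ⌜ F ⌝₁ w′ (f ◂ fun m) → Bot w′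
  neg w′ m f fᵖ h with Forces⇒WitHolds F (◂ᵖ fᵖ (funᵖ m)) h
  ... | g , gᵖ , q = holds k′ (por-if (por-compᵈ (χᵖ w′) (◂ᵖ gᵖ pors-id)) gᵖ (por-pair fᵖ gᵖ)) spec
    where
    k′ : Fn (dim w′)
    k′ v η = if χ w′ (g v η ∷ v) η then g v η else pair (f v η) (g v η)
    isCode : ∀ v η → Wit F η (g v η) (f v η ∷ fun m v η) → e (pair (f v η) (g v η) ∷ fun m v η) η ≡ true
    isCode v η h rewrite fst-pair (f v η) (g v η) | snd-pair (f v η) (g v η) = proj₂ (wit?✓ F η _ _) h
    spec : ∀ v η → ⊥ ⊎ χ w′ (k′ v η ∷ v) η ≡ true
    spec v η with true⊎ (χ w′ (g v η ∷ v) η)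
    ... | inj₁ e₁ rewrite e₁ = inj₂ e₁
    ... | inj₂ e₁ rewrite e₁ with q v η
    ... | inj₂ a = true≢false a e₁
    ... | inj₁ a = inj₂ (pres m (pair (f v η) (g v η)) v η (isCode v η a))
  bot : Bot w
  bot = Forces-allN k (∃ᶠ ⌜ F ⌝₁) {w = none} pors-id (soundness total {w = none} []ᵖ (λ ()))
          w (extend≼ e eᵖ) neg

representable⇒POR : ∀ {k} (f : Vec Str k → Oracle → Str) → Representable f → InPOR f
representable⇒POR f (F , total , _ , rep) with extract F total
... | g , gᵖ , h = InPOR-ext
    (λ v η → sym (proj₂ (rep v (g v η) η) (proj₂ (Sat-instF F v (g v η) η) (h v η)))) gᵖ

-- Derived rules of RS

conv : ∀ {n} {Γ : List (Fm n)} {A B} → A ≡ B → Γ ⊢ A → Γ ⊢ B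
conv refl d = d

weaken : ∀ {n} {Γ Δ : List (Fm n)} {A} → (∀ {B} → B ∈ Γ → B ∈ Δ) → Γ ⊢ A → Δ ⊢ A

weaken-∷ : ∀ {n} {Γ Δ : List (Fm n)} {A} → (∀ {B} → B ∈ Γ → B ∈ Δ) → ∀ {B} → B ∈ A ∷ Γ → B ∈ A ∷ Δ
weaken-∷ s (here e)  = here e
weaken-∷ s (there i) = there (s i)

weaken-map : ∀ {n} {Γ Δ : List (Fm n)} → (∀ {B} → B ∈ Γ → B ∈ Δ) → ∀ {B} → B ∈ map wkF Γ → B ∈ map wkF Δ
weaken-map s i with ∈-map⁻ wkF i
... | B , j , refl = ∈-map⁺ wkF (s j)

weaken s (ax a)       = ax a
weaken s (hyp i)      = hyp (s i)
weaken s (⇒I d)       = ⇒I (weaken (weaken-∷ s) d)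
weaken s (⇒E d e)     = ⇒E (weaken s d) (weaken s e)
weaken s (∧I d e)     = ∧I (weaken s d) (weaken s e)
weaken s (∧E₁ d)      = ∧E₁ (weaken s d)
weaken s (∧E₂ d)      = ∧E₂ (weaken s d)
weaken s (∨I₁ d)      = ∨I₁ (weaken s d)
weaken s (∨I₂ d)      = ∨I₂ (weaken s d)
weaken s (∨E d e f)   = ∨E (weaken s d) (weaken (weaken-∷ s) e) (weaken (weaken-∷ s) f)
weaken s (⊥E d)       = ⊥E (weaken s d)
weaken s (raa d)      = raa (weaken (weaken-∷ s) d)
weaken s (∀I d)       = ∀I (weaken (weaken-map s) d)
weaken s (∀E d t)     = ∀E (weaken s d) t
weaken s (∃I t d)     = ∃I t (weaken s d)
weaken s (∃E d e)     = ∃E (weaken s d) (weaken (weaken-∷ (weaken-map s)) e)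
weaken s (≐refl t)    = ≐refl t
weaken s (≐subst A d e) = ≐subst A (weaken s d) (weaken s e)

wk : ∀ {n} {Γ : List (Fm n)} {A B} → Γ ⊢ A → B ∷ Γ ⊢ A
wk = weaken there

hyp0 : ∀ {n} {Γ : List (Fm n)} {A} → A ∷ Γ ⊢ A
hyp0 = hyp (here refl)
hyp1 : ∀ {n} {Γ : List (Fm n)} {A B} → B ∷ A ∷ Γ ⊢ A
hyp1 = hyp (there (here refl))
hyp2 : ∀ {n} {Γ : List (Fm n)} {A B D} → D ∷ B ∷ A ∷ Γ ⊢ A
hyp2 = hyp (there (there (here refl)))
hyp3 : ∀ {n} {Γ : List (Fm n)} {A B D G} → G ∷ D ∷ B ∷ A ∷ Γ ⊢ A
hyp3 = hyp (there (there (there (here refl))))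

em : ∀ {n} {Γ : List (Fm n)} (A : Fm n) → Γ ⊢ A ∨ᶠ ¬ᶠ A
em A = raa (⇒E hyp0 (∨I₂ (⇒I (⇒E hyp1 (∨I₁ hyp0)))))

infixr 6 _⊳_
_⊳_ : ∀ {m n} → Tm n → (Fin m → Tm n) → Fin (suc m) → Tm n
(t ⊳ σ) zero    = t
(t ⊳ σ) (suc i) = σ i

wkT-inst : ∀ {n} {τ : Fin (suc n) → Tm n} → (∀ i → τ (suc i) ≡ var i) → ∀ t → subT τ (wkT t) ≡ t
wkT-inst {τ = τ} e t = trans (subT-wkT τ t) (trans (subT-cong e t) (subT-var t))

wkT-keep : ∀ {n} {τ : Fin (suc n) → Tm (suc n)} → (∀ i → τ (suc i) ≡ var (suc i)) → ∀ t → subT τ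
    (wkT t) ≡ wkT t
wkT-keep {τ = τ} e t = trans (subT-wkT τ t) (trans (subT-cong e t) (sym (renT-subT suc t)))

-- Instantiation under a substitution is one parallel substitution. With it the quantifier rules and
-- Leibniz' law keep all formulas in the form `subF τ A`, where `τ` lists what the variables of `A`
-- stand for.
inst-≡ : ∀ {m n} (σ : Fin m → Tm n) (t : Tm n) A → (subF (liftS σ) A) [ t ] ≡ subF (t ⊳ σ) A
inst-≡ σ t A = trans (subF-subF (liftS σ) _ A)
  (subF-cong (λ { zero → refl ; (suc i) → wkT-inst (λ _ → refl) (σ i) }) A)

∀inst : ∀ {m n} {Γ : List (Fm n)} {σ : Fin m → Tm n} (A : Fm (suc m)) →
        Γ ⊢ subF σ (∀ᶠ A) → ∀ t → Γ ⊢ subF (t ⊳ σ) A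
∀inst {σ = σ} A d t = conv (inst-≡ σ t A) (∀E d t)

∃intro : ∀ {m n} {Γ : List (Fm n)} {σ : Fin m → Tm n} (A : Fm (suc m)) →
         ∀ t → Γ ⊢ subF (t ⊳ σ) A → Γ ⊢ subF σ (∃ᶠ A)
∃intro {σ = σ} A t d = ∃I t (conv (sym (inst-≡ σ t A)) d)

∀inst₀ : ∀ {n} {Γ : List (Fm n)} (A : Fm (suc n)) → Γ ⊢ ∀ᶠ A → ∀ t → Γ ⊢ subF (t ⊳ var) A
∀inst₀ A d = ∀inst A (conv (sym (subF-var (∀ᶠ A))) d)

leibniz : ∀ {m n} {Γ : List (Fm n)} (A : Fm (suc m)) {σ : Fin m → Tm n} {s t} →
          Γ ⊢ s ≐ t → Γ ⊢ subF (s ⊳ σ) A → Γ ⊢ subF (t ⊳ σ) A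
leibniz A {σ} {s} {t} e d = conv (inst-≡ σ t A) (≐subst (subF (liftS σ) A) e (conv (sym (inst-≡ σ s A)) d))

wkF-subF : ∀ {m n} (σ : Fin m → Tm n) A → wkF (subF σ A) ≡ subF (wkT ∘ σ) A
wkF-subF σ A = trans (renF-subF suc (subF σ A))
  (trans (subF-subF σ (var ∘ suc) A) (subF-cong (λ i → sym (renT-subT suc (σ i))) A))

module _ {n} {Γ : List (Fm n)} where

  ≐sym : ∀ {s t : Tm n} → Γ ⊢ s ≐ t → Γ ⊢ t ≐ s
  ≐sym {s} e = leibniz (v0 ≐ v1) {σ = s ⊳ var} e (≐refl s)

  ≐trans : ∀ {r s t : Tm n} → Γ ⊢ r ≐ s → Γ ⊢ s ≐ t → Γ ⊢ r ≐ t
  ≐trans {r} d e = leibniz (v1 ≐ v0) {σ = r ⊳ var} e d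

  ≐⌢ : ∀ {s t : Tm n} r → Γ ⊢ s ≐ t → Γ ⊢ (s ⌢ᵗ r) ≐ (t ⌢ᵗ r)
  ≐⌢ {s} r e = leibniz ((v1 ⌢ᵗ v2) ≐ (v0 ⌢ᵗ v2)) {σ = s ⊳ r ⊳ var} e (≐refl (s ⌢ᵗ r))

  ≐ones : ∀ {s t : Tm n} → Γ ⊢ s ≐ t → Γ ⊢ (oneᵗ ×ᵗ s) ≐ (oneᵗ ×ᵗ t)
  ≐ones {s} e = leibniz ((oneᵗ ×ᵗ v1) ≐ (oneᵗ ×ᵗ v0)) {σ = s ⊳ var} e (≐refl (oneᵗ ×ᵗ s))

  ⊑ˡ : ∀ {r s t : Tm n} → Γ ⊢ s ≐ t → Γ ⊢ s ⊑ r → Γ ⊢ t ⊑ r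
  ⊑ˡ {r} = leibniz (v0 ⊑ v1) {σ = r ⊳ var}

  ⊑ʳ : ∀ {r s t : Tm n} → Γ ⊢ s ≐ t → Γ ⊢ r ⊑ s → Γ ⊢ r ⊑ t
  ⊑ʳ {r} = leibniz (v1 ⊑ v0) {σ = r ⊳ var}

  ones-snoc : ∀ (s : Tm n) b → Γ ⊢ (oneᵗ ×ᵗ (s ⌢ᵗ bitᵗ b)) ≐ ((oneᵗ ×ᵗ s) ⌢ᵗ oneᵗ)
  ones-snoc s b = ax (B4 oneᵗ s b)

  ⊑snoc-elim : ∀ {s t : Tm n} {b D} → Γ ⊢ s ⊑ (t ⌢ᵗ bitᵗ b) → s ⊑ t ∷ Γ ⊢ D → s ≐
      (t ⌢ᵗ bitᵗ b) ∷ Γ ⊢ D → Γ ⊢ D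
  ⊑snoc-elim {s} {t} {b} d = ∨E (⇒E (∧E₁ (ax (B6 s t b))) d)

  ⊑snoc : ∀ {s t : Tm n} b → Γ ⊢ s ⊑ t → Γ ⊢ s ⊑ (t ⌢ᵗ bitᵗ b)
  ⊑snoc {s} {t} b d = ⇒E (∧E₂ (ax (B6 s t b))) (∨I₁ d)

  ≐⇒⊑snoc : ∀ {s t : Tm n} b → Γ ⊢ s ≐ (t ⌢ᵗ bitᵗ b) → Γ ⊢ s ⊑ (t ⌢ᵗ bitᵗ b)
  ≐⇒⊑snoc {s} {t} b d = ⇒E (∧E₂ (ax (B6 s t b))) (∨I₂ d)

  snoc-⊑-eps : ∀ {s : Tm n} {b D} → Γ ⊢ (s ⌢ᵗ bitᵗ b) ⊑ eps → Γ ⊢ D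
  snoc-⊑-eps {s} {b} d = ⊥E (⇒E (ax (B9 s b)) (⇒E (∧E₁ (ax (B5 _))) d))

  snoc-inj : ∀ {s t : Tm n} b c → Γ ⊢ (s ⌢ᵗ bitᵗ b) ≐ (t ⌢ᵗ bitᵗ c) → Γ ⊢ s ≐ t
  snoc-inj false false d = ⇒E (ax (B7 _ _ false)) d
  snoc-inj true  true  d = ⇒E (ax (B7 _ _ true)) d
  snoc-inj false true  d = ⊥E (⇒E (ax (B8 _ _)) d)
  snoc-inj true  false d = ⊥E (⇒E (ax (B8 _ _)) (≐sym d))

induction∀ : ∀ {n} {Γ : List (Fm n)} (B : Σb1 (suc n)) → Γ ⊢ ⌜ B ⌝₁ [ eps ] →
             (∀ c → ⌜ B ⌝₁ ∷ map wkF Γ ⊢ atSucc c ⌜ B ⌝₁) → Γ ⊢ ∀ᶠ ⌜ B ⌝₁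
induction∀ B d e = ⇒E (ax (IND B)) (∧I d (∀I (⇒I (∧I (e false) (e true)))))

induction : ∀ {n} {Γ : List (Fm n)} (B : Σb1 (suc n)) → Γ ⊢ ⌜ B ⌝₁ [ eps ] →
            (∀ c → ⌜ B ⌝₁ ∷ map wkF Γ ⊢ atSucc c ⌜ B ⌝₁) → ∀ t → Γ ⊢ subF (t ⊳ var) ⌜ B ⌝₁
induction B d e = ∀inst₀ ⌜ B ⌝₁ (induction∀ B d e)

module _ {n} {Γ : List (Fm n)} where

  ⊑refl : ∀ (t : Tm n) → Γ ⊢ t ⊑ t
  ⊑refl = induction (base (preᵇ v0 v0)) (⇒E (∧E₂ (ax (B5 eps))) (≐refl eps)) (λ c → ≐⇒⊑snoc c (≐refl _))

  eps⊑ : ∀ (t : Tm n) → Γ ⊢ eps ⊑ t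
  eps⊑ = induction (base (preᵇ eps v0)) (⇒E (∧E₂ (ax (B5 eps))) (≐refl eps)) (λ c → ⊑snoc c hyp0)

  eps⌢ : ∀ (t : Tm n) → Γ ⊢ (eps ⌢ᵗ t) ≐ t
  eps⌢ = induction (base (eqᵇ (eps ⌢ᵗ v0) v0)) (ax (B1 eps))
           (λ c → ≐trans (ax (B2 eps v0 c)) (≐⌢ (bitᵗ c) hyp0))

  ≐⇒⊑ : ∀ {s t : Tm n} → Γ ⊢ s ≐ t → Γ ⊢ s ⊑ t
  ≐⇒⊑ {s} e = ⊑ʳ e (⊑refl s)

snoc⊑-step : ∀ {n} {Γ : List (Fm n)} {s t} b c → Γ ⊢ (s ⌢ᵗ bitᵗ b) ⊑ t ⇒ s ⊑ t →
             Γ ⊢ (s ⌢ᵗ bitᵗ b) ⊑ (t ⌢ᵗ bitᵗ c) ⇒ s ⊑ (t ⌢ᵗ bitᵗ c)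
snoc⊑-step {s = s} {t} b c ih = ⇒I (⊑snoc-elim hyp0
  (⊑snoc c (⇒E (wk (wk ih)) hyp0))
  (⊑snoc c (≐⇒⊑ (snoc-inj b c hyp0))))

-- The variables 0 and 1 of B are the string on which we induct and a parameter.
induction₂ : ∀ {n} {Γ : List (Fm n)} (B : Σb0 (2 + n)) →
             (∀ {Δ} → Δ ⊢ ⌜ B ⌝₀ [ eps ]) → (∀ {Δ} c → ⌜ B ⌝₀ ∷ Δ ⊢ atSucc c ⌜ B ⌝₀) →
             ∀ s t → Γ ⊢ subF (t ⊳ s ⊳ var) ⌜ B ⌝₀
induction₂ B d e s t =
  ∀inst {σ = s ⊳ var} ⌜ B ⌝₀ (∀inst₀ (∀ᶠ ⌜ B ⌝₀) (∀I (induction∀ (base B) d e)) s) t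

snoc⊑ : ∀ {n} {Γ : List (Fm n)} {s t} b → Γ ⊢ (s ⌢ᵗ bitᵗ b) ⊑ t → Γ ⊢ s ⊑ t
snoc⊑ {n} {Γ} {s} {t} b = go b
  where
  both : Γ ⊢ ((s ⌢ᵗ zeroᵗ) ⊑ t ⇒ s ⊑ t) ∧ᶠ ((s ⌢ᵗ oneᵗ) ⊑ t ⇒ s ⊑ t)
  both = induction₂ (andᵇ (impᵇ (preᵇ (v1 ⌢ᵗ zeroᵗ) v0) (preᵇ v1 v0)) (impᵇ (preᵇ (v1 ⌢ᵗ oneᵗ) v0)
      (preᵇ v1 v0)))
    (∧I (⇒I (snoc-⊑-eps {b = false} hyp0)) (⇒I (snoc-⊑-eps {b = true} hyp0)))
    (λ c → ∧I (snoc⊑-step false c (∧E₁ hyp0)) (snoc⊑-step true c (∧E₂ hyp0))) s t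
  go : ∀ b → Γ ⊢ (s ⌢ᵗ bitᵗ b) ⊑ t → Γ ⊢ s ⊑ t
  go false = ⇒E (∧E₁ both)
  go true  = ⇒E (∧E₂ both)

-- A comparison principle for `trace-unique`: a prefix that is not the whole string can be continued
-- by one more bit inside it.
⊑-next : ∀ {n} {Γ : List (Fm n)} {s t} → Γ ⊢ s ⊑ t → Γ ⊢ s ≐ t ∨ᶠ ((s ⌢ᵗ zeroᵗ) ⊑ t ∨ᶠ (s ⌢ᵗ oneᵗ) ⊑ t)
⊑-next {s = s} {t} = ⇒E (induction₂
  (impᵇ (preᵇ v1 v0) (orᵇ (eqᵇ v1 v0) (orᵇ (preᵇ (v1 ⌢ᵗ zeroᵗ) v0) (preᵇ (v1 ⌢ᵗ oneᵗ) v0))))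
  (⇒I (∨I₁ (⇒E (∧E₁ (ax (B5 _))) hyp0)))
  (λ c → ⇒I (⊑snoc-elim {b = c} hyp0
     (∨E (⇒E hyp2 hyp0)
        (∨I₂ (grow c (≐⇒⊑ (≐⌢ (bitᵗ c) hyp0))))
        (∨E hyp0 (∨I₂ (∨I₁ (⊑snoc c hyp0))) (∨I₂ (∨I₂ (⊑snoc c hyp0)))))
     (∨I₁ hyp0))) s t)
  where
  grow : ∀ {n} {Γ : List (Fm n)} {s t} c → Γ ⊢ (s ⌢ᵗ bitᵗ c) ⊑ t → Γ ⊢ (s ⌢ᵗ zeroᵗ) ⊑ t ∨ᶠ (s ⌢ᵗ oneᵗ) ⊑ t
  grow false d = ∨I₁ d
  grow true  d = ∨I₂ d

-- Both bits are treated in one induction because the step to `t · c` needs the hypothesis for `c`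
-- and not for the bit `b` that is appended.
snoc⋢ : ∀ {n} {Γ : List (Fm n)} {t D} b → Γ ⊢ (t ⌢ᵗ bitᵗ b) ⊑ t → Γ ⊢ D
snoc⋢ {n} {Γ} {t} b = go b
  where
  step : ∀ {Δ : List (Fm (suc n))} b c → ((v0 ⌢ᵗ zeroᵗ) ⊑ v0 ⇒ ⊥ᶠ) ∧ᶠ ((v0 ⌢ᵗ oneᵗ) ⊑ v0 ⇒ ⊥ᶠ) ∷ Δ ⊢
         ((v0 ⌢ᵗ bitᵗ c) ⌢ᵗ bitᵗ b) ⊑ (v0 ⌢ᵗ bitᵗ c) ⇒ ⊥ᶠ
  step {Δ} b c = ⇒I (⊑snoc-elim {b = c} hyp0
    (contra c hyp2 (snoc⊑ b hyp0))
    (contra c hyp2 (⊑ʳ (snoc-inj b c hyp0) (⊑refl _))))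
    where
    contra : ∀ {Δ : List (Fm (suc n))} c → Δ ⊢ ((v0 ⌢ᵗ zeroᵗ) ⊑ v0 ⇒ ⊥ᶠ) ∧ᶠ ((v0 ⌢ᵗ oneᵗ) ⊑ v0 ⇒ ⊥ᶠ) →
             Δ ⊢ (v0 ⌢ᵗ bitᵗ c) ⊑ v0 → Δ ⊢ ⊥ᶠ
    contra false ih = ⇒E (∧E₁ ih)
    contra true  ih = ⇒E (∧E₂ ih)
  both : Γ ⊢ ((t ⌢ᵗ zeroᵗ) ⊑ t ⇒ ⊥ᶠ) ∧ᶠ ((t ⌢ᵗ oneᵗ) ⊑ t ⇒ ⊥ᶠ)
  both = induction (base (andᵇ (notᵇ (preᵇ (v0 ⌢ᵗ zeroᵗ) v0)) (notᵇ (preᵇ (v0 ⌢ᵗ oneᵗ) v0))))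
    (∧I (⇒I (snoc-⊑-eps {b = false} hyp0)) (⇒I (snoc-⊑-eps {b = true} hyp0)))
    (λ c → ∧I (step false c) (step true c)) t
  go : ∀ {D} b → Γ ⊢ (t ⌢ᵗ bitᵗ b) ⊑ t → Γ ⊢ D
  go false d = ⊥E (⇒E (∧E₁ both) d)
  go true  d = ⊥E (⇒E (∧E₂ both) d)

ones-mono : ∀ {n} {Γ : List (Fm n)} {s t} → Γ ⊢ s ⊑ t → Γ ⊢ (oneᵗ ×ᵗ s) ⊑ (oneᵗ ×ᵗ t)
ones-mono {s = s} {t} = ⇒E (induction₂ (impᵇ (preᵇ v1 v0) (preᵇ (oneᵗ ×ᵗ v1) (oneᵗ ×ᵗ v0)))
  (⇒I (≐⇒⊑ (≐ones (⇒E (∧E₁ (ax (B5 _))) hyp0))))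
  (λ c → ⇒I (⊑snoc-elim {b = c} hyp0
     (⊑ʳ (≐sym (ones-snoc v0 c)) (⊑snoc true (⇒E hyp2 hyp0)))
     (≐⇒⊑ (≐ones hyp0)))) s t)

-- In unary the prefix relation becomes `ones s · 1 ⊑ ones t`, and with equal lengths this
-- contradicts `snoc⋢`.
longer-⊥ : ∀ {n} {Γ : List (Fm n)} {s t D} b → Γ ⊢ (s ⌢ᵗ bitᵗ b) ⊑ t →
           Γ ⊢ (oneᵗ ×ᵗ s) ≐ (oneᵗ ×ᵗ t) → Γ ⊢ D
longer-⊥ {s = s} b d e = snoc⋢ true (⊑ʳ (≐sym e) (⊑ˡ (ones-snoc s b) (ones-mono d)))

-- Strings defined bit by bit

sub₀-inst : ∀ {k m n} (τ : Fin m → Tm n) (σ : Fin k → Tm m) (A : Σb0 k) →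
            subF τ ⌜ sub₀ σ A ⌝₀ ≡ subF (subT τ ∘ σ) ⌜ A ⌝₀
sub₀-inst τ σ A = trans (cong (subF τ) (⌜sub₀⌝ σ A)) (subF-subF σ τ ⌜ A ⌝₀)

lit : ∀ {n} → Bool → Fm n → Fm n
lit true  A = A
lit false A = ¬ᶠ A

subF-lit : ∀ {m n} b (σ : Fin m → Tm n) A → subF σ (lit b A) ≡ lit b (subF σ A)
subF-lit false σ A = refl
subF-lit true  σ A = refl

wkT-bit : ∀ {n} b → wkT {n} (bitᵗ b) ≡ bitᵗ b
wkT-bit false = refl
wkT-bit true  = refl

lit-clash : ∀ {n} {Γ : List (Fm n)} {A D} b c → b ≢ c → Γ ⊢ lit b A → Γ ⊢ lit c A → Γ ⊢ D
lit-clash false false n d e = ⊥-elim (n refl)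
lit-clash false true  n d e = ⊥E (⇒E d e)
lit-clash true  false n d e = ⊥E (⇒E e d)
lit-clash true  true  n d e = ⊥-elim (n refl)

skip : ∀ {n} → Fin (suc n) → Tm (2 + n)
skip zero    = v0
skip (suc i) = var (suc (suc i))

subwordOf-intro : ∀ {m n} {Γ : List (Fm n)} {τ : Fin (2 + m) → Tm n} →
                  Γ ⊢ τ zero ⊑ τ 1F → Γ ⊢ subF τ (subwordOf v0)
subwordOf-intro {τ = τ} d = ∃intro {σ = τ} ((v0 ⊑ v2) ∧ᶠ ((v0 ⌢ᵗ v1) ⊑ v2)) eps
  (∧I (eps⊑ _) (⊑ˡ (≐sym (eps⌢ _)) d))

module Trace {n} (φ : Σb0 (suc n)) where

  -- The next bit of var 0 after each of its proper prefixes is given by φ.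
  bitsᵇ : Σb0 (2 + n)
  bitsᵇ = andᵇ (impᵇ (preᵇ (v0 ⌢ᵗ oneᵗ) v1) (sub₀ skip φ))
               (impᵇ (preᵇ (v0 ⌢ᵗ zeroᵗ) v1) (notᵇ (sub₀ skip φ)))

  traceᵇ : Σb0 (suc n)
  traceᵇ = allSub v0 bitsᵇ

  T : Fm (suc n)
  T = ⌜ traceᵇ ⌝₀

  trace-elim : ∀ {k} {Γ : List (Fm k)} {τ} b A → Γ ⊢ subF τ T → Γ ⊢ (A ⌢ᵗ bitᵗ b) ⊑ τ zero →
               Γ ⊢ lit b (subF (A ⊳ τ ∘ suc) ⌜ φ ⌝₀)
  trace-elim {Γ = Γ} {τ} b A d e = pick b e
    where
    both : Γ ⊢ subF (A ⊳ τ) ⌜ bitsᵇ ⌝₀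
    both = ⇒E (∀inst {σ = τ} (subwordOf v0 ⇒ ⌜ bitsᵇ ⌝₀) d A) (subwordOf-intro {τ = A ⊳ τ} (snoc⊑ b e))
    e≡ : subF (A ⊳ τ) ⌜ sub₀ skip φ ⌝₀ ≡ subF (A ⊳ τ ∘ suc) ⌜ φ ⌝₀
    e≡ = trans (sub₀-inst (A ⊳ τ) skip φ) (subF-cong (λ { zero → refl ; (suc i) → refl }) ⌜ φ ⌝₀)
    pick : ∀ b → Γ ⊢ (A ⌢ᵗ bitᵗ b) ⊑ τ zero → Γ ⊢ lit b (subF (A ⊳ τ ∘ suc) ⌜ φ ⌝₀)
    pick true  e = conv e≡ (⇒E (∧E₁ both) e)
    pick false e = conv (cong ¬ᶠ e≡) (⇒E (∧E₂ both) e)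

  trace-intro : ∀ {k} {Γ : List (Fm k)} {τ} →
    (∀ {X} b → (v0 ⌢ᵗ bitᵗ b) ⊑ wkT (τ zero) ∷ X ∷ map wkF Γ ⊢ lit b (subF (v0 ⊳ wkT ∘ τ ∘ suc) ⌜ φ ⌝₀)) →
    Γ ⊢ subF τ T
  trace-intro {τ = τ} d = ∀I (⇒I (∧I (⇒I (conv (sym e≡) (d true))) (⇒I (conv (cong ¬ᶠ (sym e≡)) (d false)))))
    where
    e≡ : subF (liftS τ) ⌜ sub₀ skip φ ⌝₀ ≡ subF (v0 ⊳ wkT ∘ τ ∘ suc) ⌜ φ ⌝₀
    e≡ = trans (sub₀-inst (liftS τ) skip φ) (subF-cong (λ { zero → refl ; (suc i) → refl }) ⌜ φ ⌝₀)

  trace-extend : ∀ {k} {Γ : List (Fm k)} {τ} b → Γ ⊢ subF τ T → Γ ⊢ lit b (subF τ ⌜ φ ⌝₀) →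
                 Γ ⊢ subF ((τ zero ⌢ᵗ bitᵗ b) ⊳ τ ∘ suc) T
  -- The quantifier rules carry hypotheses into an enlarged context, but not derivations; so `d` and
  -- `e` are made hypotheses and supplied afterwards. The same detour occurs in `trace-unique` and
  -- `totality`.
  trace-extend {k} {Γ} {τ} b d e = ⇒E (⇒E (⇒I (⇒I (trace-intro λ {X} c → step X c))) d) e
    where
    step : ∀ X c → (v0 ⌢ᵗ bitᵗ c) ⊑ (wkT (τ zero) ⌢ᵗ wkT (bitᵗ b)) ∷ X ∷ wkF (lit b (subF τ ⌜ φ ⌝₀))
        ∷ wkF (subF τ T) ∷ map wkF Γ
           ⊢ lit c (subF (v0 ⊳ wkT ∘ τ ∘ suc) ⌜ φ ⌝₀)
    step X c = ⊑snoc-elim {b = b} (conv (cong (λ z → (v0 ⌢ᵗ bitᵗ c) ⊑ (wkT (τ zero) ⌢ᵗ z)) (wkT-bit b)) hyp0)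
      (trace-elim {τ = wkT ∘ τ} c v0
          (conv (wkF-subF τ T) (hyp (there (there (there (there (here refl))))))) hyp0)
      (final c b hyp0 (conv (wkF-lit b)
                       (hyp (there (there (there (here refl)))))))
      where
      wkF-lit : ∀ b → wkF (lit b (subF τ ⌜ φ ⌝₀)) ≡ lit b (subF (wkT ∘ τ) ⌜ φ ⌝₀)
      wkF-lit false = cong ¬ᶠ (wkF-subF τ ⌜ φ ⌝₀)
      wkF-lit true  = wkF-subF τ ⌜ φ ⌝₀
      same : ∀ {Δ} b → Δ ⊢ v0 ≐ wkT (τ zero) → Δ ⊢ lit b (subF (wkT ∘ τ) ⌜ φ ⌝₀) → Δ ⊢ lit b
          (subF (v0 ⊳ wkT ∘ τ ∘ suc) ⌜ φ ⌝₀)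
      same b q h = conv (subF-lit b _ ⌜ φ ⌝₀) (leibniz (lit b ⌜ φ ⌝₀) {σ = wkT ∘ τ ∘ suc} (≐sym q)
        (conv (trans (cong (lit b) (subF-cong (λ { zero → refl ; (suc i) → refl }) ⌜ φ ⌝₀))
            (sym (subF-lit b _ ⌜ φ ⌝₀))) h))
      final : ∀ {Δ} c b → Δ ⊢ (v0 ⌢ᵗ bitᵗ c) ≐ (wkT (τ zero) ⌢ᵗ bitᵗ b) → Δ ⊢ lit b (subF (wkT ∘ τ) ⌜ φ ⌝₀) →
             Δ ⊢ lit c (subF (v0 ⊳ wkT ∘ τ ∘ suc) ⌜ φ ⌝₀)
      final false false q h = same false (snoc-inj false false q) h
      final true  true  q h = same true (snoc-inj true true q) h
      final false true  q h = ⊥E (⇒E (ax (B8 _ _)) q)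
      final true  false q h = ⊥E (⇒E (ax (B8 _ _)) (≐sym q))

  existsᵇ : Σb1 (suc n)
  existsᵇ = exLe v0 (base (andᵇ (eqᵇ (oneᵗ ×ᵗ v0) (oneᵗ ×ᵗ v1)) (sub₀ skip traceᵇ)))

  Ex : Fm (2 + n)
  Ex = leq v0 v1 ∧ᶠ (((oneᵗ ×ᵗ v0) ≐ (oneᵗ ×ᵗ v1)) ∧ᶠ ⌜ sub₀ skip traceᵇ ⌝₀)

  skip-trace : ∀ {k} (τ : Fin (2 + n) → Tm k) → subF τ ⌜ sub₀ skip traceᵇ ⌝₀ ≡ subF
      (τ zero ⊳ λ i → τ (suc (suc i))) T
  skip-trace τ = trans (sub₀-inst τ skip traceᵇ) (subF-cong (λ { zero → refl ; (suc i) → refl }) T)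

  exists-intro : ∀ {k} {Γ : List (Fm k)} {σ} W → Γ ⊢ (oneᵗ ×ᵗ W) ≐ (oneᵗ ×ᵗ σ zero) →
                 Γ ⊢ subF (W ⊳ σ ∘ suc) T → Γ ⊢ subF σ ⌜ existsᵇ ⌝₁
  exists-intro {σ = σ} W e d = ∃intro {σ = σ} Ex W (∧I (≐⇒⊑ e) (∧I e (conv (sym (skip-trace (W ⊳ σ))) d)))

  -- Excluded middle for `φ` at the string built so far decides the next bit. Among the inductions
  -- carried out in RS this is the one whose formula begins with an existential quantifier.
  trace-exists : ∀ {Γ : List (Fm n)} → Γ ⊢ ∀ᶠ ⌜ existsᵇ ⌝₁
  trace-exists = induction∀ existsᵇ
    (exists-intro eps (≐refl _) (trace-intro λ b → snoc-⊑-eps hyp0))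
    (λ c → ∃E hyp0 (conv (sym (shape c)) (∨E (em (subF skip ⌜ φ ⌝₀)) (grow c true hyp1 hyp0)
        (grow c false hyp1 hyp0))))
    where
    σ : Bool → Fin (suc n) → Tm (2 + n)
    σ c = (v1 ⌢ᵗ bitᵗ c) ⊳ λ i → var (suc (suc i))
    shape : ∀ c → wkF (atSucc c ⌜ existsᵇ ⌝₁) ≡ subF (σ c) ⌜ existsᵇ ⌝₁
    shape c = trans (wkF-subF _ ⌜ existsᵇ ⌝₁)
      (subF-cong (λ { zero → cong (v1 ⌢ᵗ_) (wkT-bit c) ; (suc i) → refl }) ⌜ existsᵇ ⌝₁)
    grow : ∀ {Γ} c b → Γ ⊢ Ex → Γ ⊢ lit b (subF skip ⌜ φ ⌝₀) → Γ ⊢ subF (σ c) ⌜ existsᵇ ⌝₁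
    grow c b d e = exists-intro (v0 ⌢ᵗ bitᵗ b)
      (≐trans (ones-snoc v0 b) (≐trans (≐⌢ oneᵗ (∧E₁ (∧E₂ d))) (≐sym (ones-snoc v1 c))))
      (trace-extend {τ = skip} b (conv (⌜sub₀⌝ skip traceᵇ) (∧E₂ (∧E₂ d))) e)

  -- Every prefix of `W` is a prefix of `W′`: at a common prefix `φ` dictates the next bit of both,
  -- and `W′` cannot end before `W` as their lengths agree. So `W ⊑ W′`, and the lengths exclude a
  -- proper prefix.
  trace-unique : ∀ {k} {Γ : List (Fm k)} {W W′ ι} → Γ ⊢ subF (W ⊳ ι) T → Γ ⊢ subF (W′ ⊳ ι) T →
                 Γ ⊢ (oneᵗ ×ᵗ W) ≐ (oneᵗ ×ᵗ W′) → Γ ⊢ W ≐ W′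
  trace-unique {k} {Γ} {W} {W′} {ι} d d′ e = ⇒E (⇒E (⇒E (⇒I (⇒I (⇒I main))) d) d′) e
    where
    Δ : List (Fm k)
    Δ = (oneᵗ ×ᵗ W) ≐ (oneᵗ ×ᵗ W′) ∷ subF (W′ ⊳ ι) T ∷ subF (W ⊳ ι) T ∷ Γ
    B : Σb1 (suc k)
    B = base (impᵇ (preᵇ v0 (wkT W)) (preᵇ v0 (wkT W′)))
    wk-trace : ∀ V → wkF (subF (V ⊳ ι) T) ≡ subF (wkT V ⊳ wkT ∘ ι) T
    wk-trace V = trans (wkF-subF (V ⊳ ι) T) (subF-cong (λ { zero → refl ; (suc i) → refl }) T)
    step : ∀ c → (v0 ⌢ᵗ bitᵗ c) ⊑ wkT W ∷ ⌜ B ⌝₁ ∷ map wkF Δ ⊢ (v0 ⌢ᵗ bitᵗ c) ⊑ wkT W′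
    step c = ∨E (⊑-next (⇒E hyp1 (snoc⊑ c hyp0)))
      (longer-⊥ c hyp1 (≐trans (≐ones hyp0) (≐sym hyp3)))
      (∨E hyp0 (agree c false hyp2 hyp0 (hyp (there (there (there (there (there (there (here refl))))))))
                                        (hyp (there (there (there (there (there (here refl))))))))
               (agree c true  hyp2 hyp0 (hyp (there (there (there (there (there (there (here refl))))))))
                                        (hyp (there (there (there (there (there (here refl)))))))))
      where
      agree : ∀ {Θ} c b → Θ ⊢ (v0 ⌢ᵗ bitᵗ c) ⊑ wkT W → Θ ⊢ (v0 ⌢ᵗ bitᵗ b) ⊑ wkT W′ →
              Θ ⊢ wkF (subF (W ⊳ ι) T) → Θ ⊢ wkF (subF (W′ ⊳ ι) T) → Θ ⊢ (v0 ⌢ᵗ bitᵗ c) ⊑ wkT W′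
      agree false false p q h h′ = q
      agree true  true  p q h h′ = q
      agree false true  p q h h′ = lit-clash false true (λ ())
          (trace-elim false v0 (conv (wk-trace W) h) p) (trace-elim true v0 (conv (wk-trace W′) h′) q)
      agree true  false p q h h′ = lit-clash true false (λ ())
          (trace-elim true v0 (conv (wk-trace W) h) p) (trace-elim false v0 (conv (wk-trace W′) h′) q)
    shape : ∀ c → (v0 ⌢ᵗ bitᵗ c) ⊑ wkT W ⇒ (v0 ⌢ᵗ bitᵗ c) ⊑ wkT W′ ≡ atSucc c ⌜ B ⌝₁
    shape c = sym (cong₂ (λ x y → (v0 ⌢ᵗ bitᵗ c) ⊑ x ⇒ (v0 ⌢ᵗ bitᵗ c) ⊑ y)
                     (wkT-keep (λ _ → refl) W) (wkT-keep (λ _ → refl) W′))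
    sub : Δ ⊢ W ⊑ W ⇒ W ⊑ W′
    sub = conv (cong₂ (λ x y → W ⊑ x ⇒ W ⊑ y) (wkT-inst (λ _ → refl) W) (wkT-inst (λ _ → refl) W′))
      (induction B (⇒I (eps⊑ _)) (λ c → conv (shape c) (⇒I (step c))) W)
    main : Δ ⊢ W ≐ W′
    main = ∨E (⊑-next (⇒E sub (⊑refl W))) hyp0
      (∨E hyp0 (longer-⊥ false hyp0 hyp2) (longer-⊥ true hyp0 hyp2))

-- W is the trace of φ of length N, and y is the unique subword z of W such
-- that D z W, or ε if there is no such z or more than one.
module Describe {n} (φ : Σb0 (suc n)) (N : Tm n) (D : Σb0 (2 + n)) where
  open Trace φ

  -- The contexts, before the arguments: `D` and `uniqueᵇ` speak about `z`, `W`; `onlyᵇ` about a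
  -- rival `z′`, then `z`, `W`; `isᵇ` about `z`, `W`, `y`; `valueᵇ` and `graphᵇ` about `W`, `y`.
  keep₁ : Fin (2 + n) → Tm (3 + n)
  keep₁ zero    = v0
  keep₁ (suc i) = var (suc (suc i))

  keep₂ : Fin (2 + n) → Tm (3 + n)
  keep₂ zero          = v0
  keep₂ 1F    = v1
  keep₂ (suc (suc i)) = var (suc (suc (suc i)))

  onlyᵇ : Σb0 (3 + n)
  onlyᵇ = impᵇ (sub₀ keep₁ D) (eqᵇ v0 v1)

  uniqueᵇ : Σb0 (2 + n)
  uniqueᵇ = andᵇ D (allSub v1 onlyᵇ)

  hasᵇ : Σb0 (suc n)
  hasᵇ = exSub v0 uniqueᵇ

  isᵇ : Σb0 (3 + n)
  isᵇ = andᵇ (sub₀ keep₂ uniqueᵇ) (eqᵇ v2 v0)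

  valueᵇ : Σb0 (2 + n)
  valueᵇ = orᵇ (exSub v0 isᵇ) (andᵇ (notᵇ (sub₀ skip hasᵇ)) (eqᵇ v1 eps))

  graphᵇ : Σb0 (2 + n)
  graphᵇ = andᵇ (andᵇ (eqᵇ (oneᵗ ×ᵗ v0) (oneᵗ ×ᵗ wkT (wkT N))) (sub₀ skip traceᵇ)) valueᵇ

  F : Σb1 (suc n)
  F = exLe (wkT N) (base graphᵇ)

  G : Fm (2 + n)
  G = leq v0 (wkT (wkT N)) ∧ᶠ ⌜ graphᵇ ⌝₀

  unique-inst : ∀ {k} (τ : Fin (3 + n) → Tm k) → subF τ ⌜ sub₀ keep₂ uniqueᵇ ⌝₀ ≡
                subF (τ zero ⊳ τ 1F ⊳ λ i → τ (suc (suc (suc i)))) ⌜ uniqueᵇ ⌝₀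
  unique-inst τ = trans (sub₀-inst τ keep₂ uniqueᵇ)
    (subF-cong (λ { zero → refl ; 1F → refl ; (suc (suc i)) → refl }) ⌜ uniqueᵇ ⌝₀)

  has-inst : ∀ {k} (τ : Fin (2 + n) → Tm k) → subF τ ⌜ sub₀ skip hasᵇ ⌝₀ ≡
             subF (τ zero ⊳ λ i → τ (suc (suc i))) ⌜ hasᵇ ⌝₀
  has-inst τ = trans (sub₀-inst τ skip hasᵇ) (subF-cong (λ { zero → refl ; (suc i) → refl }) ⌜ hasᵇ ⌝₀)

  unique-≐ : ∀ {k} {Γ : List (Fm k)} {x y W ι} → Γ ⊢ subF (x ⊳ W ⊳ ι) (subwordOf v0) →
             Γ ⊢ subF (x ⊳ W ⊳ ι) ⌜ uniqueᵇ ⌝₀ → Γ ⊢ subF (y ⊳ W ⊳ ι) ⌜ uniqueᵇ ⌝₀ → Γ ⊢ x ≐ y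
  unique-≐ {x = x} {y} {W} {ι} s d e = ⇒E
    (⇒E (∀inst {σ = y ⊳ W ⊳ ι} (subwordOf v1 ⇒ ⌜ onlyᵇ ⌝₀) (∧E₂ e) x) s)
    (conv (sym (trans (sub₀-inst _ keep₁ D)
        (subF-cong (λ { zero → refl ; 1F → refl ; (suc (suc i)) → refl }) ⌜ D ⌝₀))) (∧E₁ d))

  value-intro : ∀ {k} {Γ : List (Fm k)} {W ι} y → Γ ⊢ subF (y ⊳ W ⊳ ι) (subwordOf v0) →
                Γ ⊢ subF (y ⊳ W ⊳ ι) ⌜ uniqueᵇ ⌝₀ → Γ ⊢ subF (W ⊳ y ⊳ ι) ⌜ valueᵇ ⌝₀
  value-intro {W = W} {ι} y s d = ∨I₁ (∃intro {σ = W ⊳ y ⊳ ι} (subwordOf v0 ∧ᶠ ⌜ isᵇ ⌝₀) y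
    (∧I s (∧I (conv (sym (unique-inst (y ⊳ W ⊳ y ⊳ ι))) d) (≐refl y))))

  -- The hypotheses Ex are stated as one formula so that they can be weakened.
  total-from : ∀ {k} {Γ : List (Fm k)} {W ι} → subF (W ⊳ subT ι N ⊳ ι) Ex ∷ Γ ⊢ subF ι (∃ᶠ ⌜ F ⌝₁)
  total-from {k} {Γ} {W} {ι} = ∨E (em (subF (W ⊳ ι) ⌜ hasᵇ ⌝₀))
    (∃E hyp0 (conv (sym (wkF-subF ι (∃ᶠ ⌜ F ⌝₁)))
      (value v0 (conv ex≡ hyp2) (value-intro v0 (∧E₁ hyp0)
        (conv (subF-cong (λ { zero → refl ; 1F → refl ; (suc (suc i)) → refl }) ⌜ uniqueᵇ ⌝₀) (∧E₂ hyp0))))))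
    (value eps hyp1 (∨I₂ (∧I (conv (cong ¬ᶠ (sym (has-inst _))) hyp0) (≐refl eps))))
    where
    ex≡ : wkF (subF (W ⊳ subT ι N ⊳ ι) Ex) ≡ subF (wkT W ⊳ subT (wkT ∘ ι) N ⊳ wkT ∘ ι) Ex
    ex≡ = trans (wkF-subF _ Ex) (subF-cong (λ { zero → refl ; 1F → wkT-subT ι N ; (suc (suc i)) → refl }) Ex)
    value : ∀ {k} {Γ : List (Fm k)} {W ι} y → Γ ⊢ subF (W ⊳ subT ι N ⊳ ι) Ex → Γ ⊢ subF
        (W ⊳ y ⊳ ι) ⌜ valueᵇ ⌝₀ →
            Γ ⊢ subF ι (∃ᶠ ⌜ F ⌝₁)
    value {W = W} {ι} y d e = ∃intro {σ = ι} ⌜ F ⌝₁ y (∃intro {σ = y ⊳ ι} G W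
      (∧I (conv (cong (λ z → (oneᵗ ×ᵗ W) ⊑ (oneᵗ ×ᵗ z)) (sym N≡)) (∧E₁ d))
          (∧I (∧I (conv (cong (λ z → (oneᵗ ×ᵗ W) ≐ (oneᵗ ×ᵗ z)) (sym N≡)) (∧E₁ (∧E₂ d)))
                  (conv (trans (skip-trace _) (sym (skip-trace _))) (∧E₂ (∧E₂ d)))) e)))
      where
      N≡ : subT (W ⊳ y ⊳ ι) (wkT (wkT N)) ≡ subT ι N
      N≡ = trans (subT-wkT (W ⊳ y ⊳ ι) (wkT N)) (subT-wkT (y ⊳ ι) N)

  totality : [] ⊢ ∃ᶠ ⌜ F ⌝₁
  totality = ∃E (∀inst₀ ⌜ existsᵇ ⌝₁ trace-exists N) (conv (sym (renF-subF suc (∃ᶠ ⌜ F ⌝₁)))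
    (⇒E (⇒I (total-from {W = v0} {ι = var ∘ suc}))
        (conv (subF-cong (λ { zero → refl ; 1F → renT-subT suc N ; (suc (suc i)) → refl }) Ex) hyp0)))

  value-unique : ∀ {k} {Γ : List (Fm k)} {W y z ι} → Γ ⊢ subF (W ⊳ y ⊳ ι) ⌜ valueᵇ ⌝₀ → Γ ⊢ subF
      (W ⊳ z ⊳ ι) ⌜ valueᵇ ⌝₀ → Γ ⊢ y ≐ z
  value-unique {k} {Γ} {W} {y} {z} {ι} d e = ∨E d
    (∨E (wk e)
      (∃E hyp1 (∃E (conv (wk≡ z) hyp1) both))
      (⊥E (⇒E (conv (cong ¬ᶠ (has-inst (W ⊳ z ⊳ ι))) (∧E₁ hyp0)) (has y hyp1))))
    (∨E (wk e)
      (⊥E (⇒E (conv (cong ¬ᶠ (has-inst (W ⊳ y ⊳ ι))) (∧E₁ hyp1)) (has z hyp0)))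
      (≐trans (∧E₂ hyp1) (≐sym (∧E₂ hyp0))))
    where
    IsVal : Fm (3 + n)
    IsVal = subwordOf v0 ∧ᶠ ⌜ isᵇ ⌝₀
    wk≡ : ∀ z → wkF (subF (W ⊳ z ⊳ ι) (∃ᶠ IsVal)) ≡ subF (wkT W ⊳ wkT z ⊳ wkT ∘ ι) (∃ᶠ IsVal)
    wk≡ z = trans (wkF-subF _ (∃ᶠ IsVal))
        (subF-cong (λ { zero → refl ; 1F → refl ; (suc (suc i)) → refl }) (∃ᶠ IsVal))
    has : ∀ {Γ} y → Γ ⊢ subF (W ⊳ y ⊳ ι) (∃ᶠ IsVal) → Γ ⊢ subF (W ⊳ ι) ⌜ hasᵇ ⌝₀
    has y h = ∃E h (conv (sym (wkF-subF _ ⌜ hasᵇ ⌝₀))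
        (∃intro {σ = wkT ∘ (W ⊳ ι)} (subwordOf v0 ∧ᶠ ⌜ uniqueᵇ ⌝₀) v0
      (∧I (∧E₁ hyp0) (conv (trans (unique-inst _)
          (subF-cong (λ { zero → refl ; 1F → refl ; (suc (suc i)) → refl }) ⌜ uniqueᵇ ⌝₀))
                       (∧E₁ (∧E₂ hyp0))))))
    both : ∀ {Γ} → subF (liftS (wkT W ⊳ wkT z ⊳ wkT ∘ ι)) IsVal ∷ wkF
        (subF (liftS (W ⊳ y ⊳ ι)) IsVal) ∷ Γ ⊢ wkF (wkF (y ≐ z))
    both = ≐trans (∧E₂ (∧E₂ first)) (≐trans
        (unique-≐ {x = v1} {v0} {wkT (wkT W)} {wkT ∘ wkT ∘ ι}
          (∧E₁ first) (conv (unique-inst _) (∧E₁ (∧E₂ first)))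
          (conv (unique-inst _) (∧E₁ (∧E₂ hyp0))))
        (≐sym (∧E₂ (∧E₂ hyp0))))
      where
      first : ∀ {Γ A} → A ∷ wkF (subF (liftS (W ⊳ y ⊳ ι)) IsVal) ∷ Γ ⊢ subF
          (v1 ⊳ wkT (wkT W) ⊳ wkT (wkT y) ⊳ wkT ∘ wkT ∘ ι) IsVal
      first = conv (trans (wkF-subF _ IsVal)
          (subF-cong (λ { zero → refl ; 1F → refl ; 2F → refl ; (suc (suc (suc i))) → refl }) IsVal)) hyp1

  uniqueness : ∀ {k} {y z ι} → subF (z ⊳ ι) ⌜ F ⌝₁ ∷ subF (y ⊳ ι) ⌜ F ⌝₁ ∷ [] ⊢ (y ≐ z)
  uniqueness {k} {y} {z} {ι} = ∃E hyp1 (∃E (conv (wk≡ z) hyp1) both)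
    where
    wk≡ : ∀ z → wkF (subF (z ⊳ ι) ⌜ F ⌝₁) ≡ subF (wkT z ⊳ wkT ∘ ι) ⌜ F ⌝₁
    wk≡ z = trans (wkF-subF _ ⌜ F ⌝₁) (subF-cong (λ { zero → refl ; (suc i) → refl }) ⌜ F ⌝₁)
    both : ∀ {Γ} → subF (liftS (wkT z ⊳ wkT ∘ ι)) G ∷ wkF (subF (liftS (y ⊳ ι)) G) ∷ Γ ⊢ wkF (wkF (y ≐ z))
    both {Γ} = value-unique {W = v1} {ι = wkT ∘ wkT ∘ ι} (∧E₂ (∧E₂ first))
       (leibniz ⌜ valueᵇ ⌝₀ {σ = wkT (wkT z) ⊳ wkT ∘ wkT ∘ ι} (≐sym eq) (∧E₂ (∧E₂ second)))
      where
      Δ : List (Fm (2 + k))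
      Δ = subF (liftS (wkT z ⊳ wkT ∘ ι)) G ∷ wkF (subF (liftS (y ⊳ ι)) G) ∷ Γ
      first : Δ ⊢ subF (v1 ⊳ wkT (wkT y) ⊳ wkT ∘ wkT ∘ ι) G
      first = conv (trans (wkF-subF _ G)
          (subF-cong (λ { zero → refl ; 1F → refl ; (suc (suc i)) → refl }) G)) hyp1
      second : Δ ⊢ subF (v0 ⊳ wkT (wkT z) ⊳ wkT ∘ wkT ∘ ι) G
      second = conv (subF-cong (λ { zero → refl ; 1F → refl ; (suc (suc i)) → refl }) G) hyp0
      len≡ : ∀ {W x} → Δ ⊢ subF (W ⊳ x ⊳ wkT ∘ wkT ∘ ι) G → Δ ⊢ (oneᵗ ×ᵗ W) ≐ (oneᵗ ×ᵗ subT (wkT ∘ wkT ∘ ι) N)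
      len≡ {W} {x} d = conv (cong (λ z → (oneᵗ ×ᵗ W) ≐ (oneᵗ ×ᵗ z))
        (trans (subT-wkT (W ⊳ x ⊳ wkT ∘ wkT ∘ ι) (wkT N)) (subT-wkT (x ⊳ wkT ∘ wkT ∘ ι) N)))
            (∧E₁ (∧E₁ (∧E₂ d)))
      eq : Δ ⊢ v1 ≐ v0
      eq = trace-unique {ι = wkT ∘ wkT ∘ ι} (conv (skip-trace _) (∧E₂ (∧E₁ (∧E₂ first))))
          (conv (skip-trace _) (∧E₂ (∧E₁ (∧E₂ second))))
             (≐trans (len≡ first) (≐sym (len≡ second)))

allN-intro : ∀ k {A : Fm k} → [] ⊢ A → RS (allN k A)
allN-intro zero    d = d
allN-intro (suc k) d = allN-intro k (∀I d)

-- Bit sequences defined by a Σb0 formula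

opaque
  truth : ∀ {n} → Σb0 n → Dc n
  truth A = dec (abs₀ A)

  truth✓ : ∀ {n} (A : Σb0 n) v η → truth A v η ≡ true ⟺ Sat₀ η v A
  truth✓ A = dec✓ (abs₀ A)

truth-false : ∀ {n} (A : Σb0 n) v η → ¬ Sat₀ η v A → truth A v η ≡ false
truth-false A v η n with true⊎ (truth A v η)
... | inj₁ e = ⊥-elim (n (proj₁ (truth✓ A v η) e))
... | inj₂ e = e

truth-≡ : ∀ {m n} (A : Σb0 m) (B : Σb0 n) v w η → (Sat₀ η v A ⟺ Sat₀ η w B) → truth A v η ≡ truth B w η
truth-≡ A B v w η (f , g) with true⊎ (truth B w η)
... | inj₁ e = trans (proj₂ (truth✓ A v η) (g (proj₁ (truth✓ B w η) e))) (sym e)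
... | inj₂ e = trans (truth-false A v η (λ a → true≢false (proj₂ (truth✓ B w η) (f a)) e)) (sym e)

-- The traces of `φ` in the standard model, computed outright; `bits-trace` and `trace-bits` show
-- that `traceᵇ` has no other solutions.
bits : ∀ {n} → Σb0 (suc n) → Vec Str n → Oracle → ℕ → Str
bits φ v η zero    = ε
bits φ v η (suc k) = bits φ v η k · truth φ (bits φ v η k ∷ v) η

len-bits : ∀ {n} (φ : Σb0 (suc n)) v η k → len (bits φ v η k) ≡ k
len-bits φ v η zero    = refl
len-bits φ v η (suc k) = cong suc (len-bits φ v η k)

bits-+ : ∀ {n} (φ : Σb0 (suc n)) v η j k → Prefix (bits φ v η k) (bits φ v η (j + k))
bits-+ φ v η zero    k = Prefix-refl _
bits-+ φ v η (suc j) k = Prefix-·ʳ _ (bits-+ φ v η j k)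

bits-≤ : ∀ {n} (φ : Σb0 (suc n)) v η {j k} → j ≤ k → Prefix (bits φ v η j) (bits φ v η k)
bits-≤ φ v η {j} {k} p = subst (λ z → Prefix (bits φ v η j) (bits φ v η z)) (m∸n+n≡m p)
    (bits-+ φ v η (k ∸ j) j)

bits-Prefix : ∀ {n} (φ : Σb0 (suc n)) v η {A k} → Prefix A (bits φ v η k) → A ≡ bits φ v η (len A)
bits-Prefix φ v η {A} {k} p = Prefix-unique p
  (bits-≤ φ v η (≤-trans (Prefix-len p) (≤-reflexive (len-bits φ v η k)))) (sym (len-bits φ v η (len A)))

-- The principle by which sequences are put together: if `φ` behaves after `B` as `ψ` does from the
-- start, the bits of `φ` continue `B` with those of `ψ`.
bits-run : ∀ {m n} (φ : Σb0 (suc n)) (ψ : Σb0 (suc m)) v w η {B} p k → bits φ v η p ≡ B →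
  (∀ j → j < k → Sat₀ η (B ⌢ bits ψ w η j ∷ v) φ ⟺ Sat₀ η (bits ψ w η j ∷ w) ψ) →
  bits φ v η (k + p) ≡ B ⌢ bits ψ w η k
bits-run φ ψ v w η p zero    e h = e
bits-run φ ψ v w η {B} p (suc k) e h rewrite bits-run φ ψ v w η p k e (λ j q → h j (m≤n⇒m≤1+n q)) =
  cong ((B ⌢ bits ψ w η k) ·_) (truth-≡ φ ψ _ _ η (h k ≤-refl))

bits-run₀ : ∀ {m n} (φ : Σb0 (suc n)) (ψ : Σb0 (suc m)) v w η k →
  (∀ j → j < k → Sat₀ η (bits ψ w η j ∷ v) φ ⟺ Sat₀ η (bits ψ w η j ∷ w) ψ) →
  bits φ v η k ≡ bits ψ w η k
bits-run₀ φ ψ v w η k h = trans (cong (bits φ v η) (sym (+-identityʳ k)))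
  (trans (bits-run φ ψ v w η {ε} 0 k refl
      (λ j q → subst (λ z → Sat₀ η (z ∷ v) φ ⟺ Sat₀ η (bits ψ w η j ∷ w) ψ)
                                                        (sym (⌢-identityˡ _)) (h j q)))
         (⌢-identityˡ _))

skip-at : ∀ {n} (v : Vec Str n) x y i → lookup (x ∷ v) i ≡ evalT (x ∷ y ∷ v) (skip i)
skip-at v x y zero    = refl
skip-at v x y (suc i) = refl

module _ {n} (φ : Σb0 (suc n)) (v : Vec Str n) (η : Oracle) where
  open Trace φ

  bits-trace : ∀ k → Sat₀ η (bits φ v η k ∷ v) traceᵇ
  bits-trace k A _ = (λ p → proj₂ (Sat-sub₀ skip (skip-at v A _) φ)
      (proj₁ (truth✓ φ (A ∷ v) η) (sym (next p)))) ,
                     (λ p s → true≢false (proj₂ (truth✓ φ (A ∷ v) η)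
                         (proj₁ (Sat-sub₀ skip (skip-at v A _) φ) s)) (sym (next p)))
    where
    next : ∀ {b} → Prefix (A · b) (bits φ v η k) → b ≡ truth φ (A ∷ v) η
    next p = trans (·-injectiveʳ (bits-Prefix φ v η {k = k} p))
               (cong (λ z → truth φ (z ∷ v) η) (sym (bits-Prefix φ v η {k = k} (Prefix-·ˡ p))))

  trace-bits : ∀ W → Sat₀ η (W ∷ v) traceᵇ → W ≡ bits φ v η (len W)
  trace-bits W h = go W (Prefix-refl W)
    where
    go : ∀ A → Prefix A W → A ≡ bits φ v η (len A)
    go ε       p = refl
    go (A · b) p = cong₂ _·_ (go A (Prefix-·ˡ p))
                     (trans (bit b p) (cong (λ z → truth φ (z ∷ v) η) (go A (Prefix-·ˡ p))))
      where
      bit : ∀ b → Prefix (A · b) W → b ≡ truth φ (A ∷ v) η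
      bit true  p = sym (proj₂ (truth✓ φ (A ∷ v) η) (proj₁ (Sat-sub₀ skip (skip-at v A _) φ)
          (proj₁ (h A (Prefix⇒Sub (Prefix-·ˡ p))) p)))
      bit false p = sym (truth-false φ (A ∷ v) η (λ s → proj₂ (h A (Prefix⇒Sub (Prefix-·ˡ p))) p
          (proj₂ (Sat-sub₀ skip (skip-at v A _) φ) s)))

-- Functions read off a bit sequence

-- The value must be readable at every length from `N` on, not just at `N`: in a composite sequence
-- the length left for a part is only estimated from below by a term.
record Readable {n} (f : Fn n) : Set where
  field
    φ : Σb0 (suc n)
    N : Tm n
    D : Σb0 (2 + n)
    occurs : ∀ v η k → len (evalT v N) ≤ k → Sub (f v η) (bits φ v η k)
    sound  : ∀ v η k → len (evalT v N) ≤ k → Sat₀ η (f v η ∷ bits φ v η k ∷ v) D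
    unique : ∀ v η k → len (evalT v N) ≤ k → ∀ z → Sat₀ η (z ∷ bits φ v η k ∷ v) D → z ≡ f v η
open Readable

Readable-ext : ∀ {n} {f g : Fn n} → (∀ v η → f v η ≡ g v η) → Readable f → Readable g
Readable-ext e r = record
  { φ = φ r ; N = N r ; D = D r
  ; occurs = λ v η k p → subst (λ z → Sub z _) (e v η) (occurs r v η k p)
  ; sound  = λ v η k p → subst (λ z → Sat₀ η (z ∷ _) (D r)) (e v η) (sound r v η k p)
  ; unique = λ v η k p z s → trans (unique r v η k p z s) (e v η) }

graph-correct : ∀ {n} {f : Fn n} (r : Readable f) v y η →
                f v η ≡ y ⟺ Sat η (y ∷ v) ⌜ Describe.F (φ r) (N r) (D r) ⌝₁
graph-correct {n} {f} r v y η = to , from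
  where
  open Describe (φ r) (N r) (D r) hiding (F)
  open Trace (φ r)
  k = len (evalT v (N r))
  W₀ = bits (φ r) v η k
  N≡ : ∀ W y → evalT (W ∷ y ∷ v) (wkT (wkT (N r))) ≡ evalT v (N r)
  N≡ W y = trans (evalT-wkT W (y ∷ v) (wkT (N r))) (evalT-wkT y v (N r))
  keep₁-at : ∀ z′ z W i → lookup (z′ ∷ W ∷ v) i ≡ evalT (z′ ∷ z ∷ W ∷ v) (keep₁ i)
  keep₁-at z′ z W zero    = refl
  keep₁-at z′ z W (suc i) = refl
  keep₂-at : ∀ z W y i → lookup (z ∷ W ∷ v) i ≡ evalT (z ∷ W ∷ y ∷ v) (keep₂ i)
  keep₂-at z W y zero          = refl
  keep₂-at z W y 1F    = refl
  keep₂-at z W y (suc (suc i)) = refl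
  unique₀ : Sat₀ η (f v η ∷ W₀ ∷ v) uniqueᵇ
  unique₀ = sound r v η k ≤-refl , λ z _ s → unique r v η k ≤-refl z
      (proj₁ (Sat-sub₀ keep₁ (keep₁-at z _ W₀) (D r)) s)
  to : f v η ≡ y → _
  to refl = W₀ , ≤⇒leq W₀ _ (≤-reflexive len≡) ,
      (ones-cong W₀ _ len≡ , proj₂ (Sat-sub₀ skip (skip-at v W₀ y) traceᵇ) (bits-trace (φ r) v η k)) ,
      inj₁ (y , occurs r v η k ≤-refl , proj₂ (Sat-sub₀ keep₂ (keep₂-at y W₀ y) uniqueᵇ) unique₀ , refl)
    where
    len≡ : len W₀ ≡ len (evalT (W₀ ∷ y ∷ v) (wkT (wkT (N r))))
    len≡ = trans (len-bits (φ r) v η k) (cong len (sym (N≡ W₀ y)))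
  from : _ → f v η ≡ y
  from (W , _ , (l , tr) , val) = value W≡ val
    where
    W≡ : W ≡ W₀
    W≡ = trans (trace-bits (φ r) v η W (proj₁ (Sat-sub₀ skip (skip-at v W y) traceᵇ) tr))
           (cong (bits (φ r) v η) (trans (ones-inj W _ l) (cong len (N≡ W y))))
    value : W ≡ W₀ → Sat₀ η (W ∷ y ∷ v) valueᵇ → f v η ≡ y
    value refl (inj₁ (z , _ , u , e)) =
      trans (sym (unique r v η k ≤-refl z
          (proj₁ (proj₁ (Sat-sub₀ keep₂ (keep₂-at z W y) uniqueᵇ) u)))) (sym e)
    value refl (inj₂ (n , _)) = ⊥-elim (n (proj₂ (Sat-sub₀ skip (skip-at v W y) hasᵇ)
      (f v η , occurs r v η k ≤-refl , unique₀)))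

Readable⇒Representable : ∀ {n} {f : Fn n} → Readable f → Representable f
Readable⇒Representable {n} {f} r = F , allN-intro n totality , allN-intro n (∀I (∀I (⇒I unique′))) , λ v y η →
    (λ e → proj₂ (Sat-instF F v y η) (proj₁ (graph-correct r v y η) e)) ,
    (λ s → proj₂ (graph-correct r v y η) (proj₁ (Sat-instF F v y η) s))
  where
  open Describe (φ r) (N r) (D r)
  unique′ : _ ⊢ (v1 ≐ v0)
  unique′ = ⇒E (⇒E (⇒I (⇒I (weaken (weaken-∷ (weaken-∷ λ ()))
      (uniqueness {y = v1} {z = v0} {ι = λ i → var (suc (suc i))}))))
       (conv (trans (renF-subF _ ⌜ F ⌝₁) (subF-cong (λ { zero → refl ; (suc i) → refl }) ⌜ F ⌝₁)) (∧E₁ hyp0)))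
     (conv (trans (renF-subF _ ⌜ F ⌝₁) (subF-cong (λ { zero → refl ; (suc i) → refl }) ⌜ F ⌝₁)) (∧E₂ hyp0))

lenᵇ leqᵇ : ∀ {n} → Tm n → Tm n → Σb0 n
lenᵇ s t = eqᵇ (oneᵗ ×ᵗ s) (oneᵗ ×ᵗ t)
leqᵇ s t = preᵇ (oneᵗ ×ᵗ s) (oneᵗ ×ᵗ t)

uncons-Prefix : ∀ {A s} → Prefix A s → len A < len s → Σ Bool λ d → Prefix (A · d) s
uncons-Prefix {A} (ε , refl) l = ⊥-elim (<-irrefl refl l)
uncons-Prefix {A} (c · b , refl) l with uncons c b
... | d , c′ , e , _ = d , c′ , trans (⌢-assoc A (ε · d) c′) (cong (A ⌢_) (sym e))

module _ {n} (φ : Σb0 (suc n)) (v : Vec Str n) (η : Oracle) (s : Str)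
         (copies : ∀ A → Sat₀ η (A ∷ v) φ ⟺ Prefix (A · true) s) where

  bits-copy : ∀ k → k ≤ len s → Prefix (bits φ v η k) s
  bits-copy zero    p = Prefix-ε s
  bits-copy (suc k) p with uncons-Prefix (bits-copy k (≤-trans (n≤1+n k) p))
      (≤-trans (s≤s (≤-reflexive (len-bits φ v η k))) p)
  ... | d , q = subst (λ z → Prefix (bits φ v η k · z) s) (sym (bit d q)) q
    where
    bit : ∀ d → Prefix (bits φ v η k · d) s → truth φ (bits φ v η k ∷ v) η ≡ d
    bit true  q = proj₂ (truth✓ φ _ η) (proj₂ (copies _) q)
    bit false q = truth-false φ _ η (λ t → case-⊥ (Prefix-unique (proj₁ (copies _) t) q refl))
      where
      case-⊥ : ∀ {A} → A · true ≡ A · false → ⊥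
      case-⊥ ()

zeros : ℕ → Str
zeros zero    = ε
zeros (suc k) = zeros k · false

len-zeros : ∀ k → len (zeros k) ≡ k
len-zeros zero    = refl
len-zeros (suc k) = cong suc (len-zeros k)

-- This is how the language expresses that a string consists of zeros: it is a prefix of some
-- `zeroᵗ ×ᵗ t`.
zero⊗ : ∀ x → (ε · false) ⊗ x ≡ zeros (len x)
zero⊗ ε       = refl
zero⊗ (x · b) = cong (_· false) (zero⊗ x)

Prefix-zeros : ∀ {a} k → Prefix a (zeros k) → a ≡ zeros (len a)
Prefix-zeros {ε}     k p = refl
Prefix-zeros {a · b} zero p = ⊥-elim (n≮0 (Prefix-len p))
Prefix-zeros {a · b} (suc k) p with Prefix-snoc p
... | inj₁ q    = Prefix-zeros k q
... | inj₂ refl = cong (λ i → zeros i · false) (sym (len-zeros k))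

zeros-Prefix : ∀ {j k} → j ≤ k → Prefix (zeros j) (zeros k)
zeros-Prefix {k = zero}  z≤n = Prefix-refl ε
zeros-Prefix {j} {suc k} p with m≤n⇒m<n∨m≡n p
... | inj₁ (s≤s q) = Prefix-·ʳ false (zeros-Prefix q)
... | inj₂ refl    = Prefix-refl _

-- The marker is the last `true`, so the padding can be removed in only one way.
padded-inj : ∀ s t i j → (s · true) ⌢ zeros i ≡ (t · true) ⌢ zeros j → s ≡ t
padded-inj s t zero    zero    e = ·-injectiveˡ e
padded-inj s t (suc i) (suc j) e = padded-inj s t i j (·-injectiveˡ e)
padded-inj s t zero    (suc j) ()
padded-inj s t (suc i) zero    ()

-- Once `s · true` has been copied, no longer string is a prefix of it, so the copying formula
-- itself goes on with zeros.
bits-padded : ∀ {n} (φ : Σb0 (suc n)) v η s → (∀ A → Sat₀ η (A ∷ v) φ ⟺ Prefix (A · true) (s · true)) →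
              ∀ j → bits φ v η (j + suc (len s)) ≡ (s · true) ⌢ zeros j
bits-padded φ v η s h zero = Prefix-unique (bits-copy φ v η (s · true) h (suc (len s)) ≤-refl) (Prefix-refl _)
                               (len-bits φ v η (suc (len s)))
bits-padded φ v η s h (suc j) rewrite bits-padded φ v η s h j =
  cong (((s · true) ⌢ zeros j) ·_) (truth-false φ _ η (λ t → 1+n≰n
    (≤-trans (s≤s (≤-trans (m≤m+n (suc (len s)) (len (zeros j)))
        (≤-reflexive (sym (len-⌢ (s · true) (zeros j))))))
             (Prefix-len (proj₁ (h _) t)))))

v3 : ∀ {n} → Tm (4 + n)
v3 = var 3F
v4 : ∀ {n} → Tm (5 + n)
v4 = var (4 ↑ʳ zero)
v5 : ∀ {n} → Tm (6 + n)
v5 = var (5 ↑ʳ zero)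
-- The last len m bits of q (m = var 2, q = var 1) are var 0 followed by a marker and zeros.
lastᵇ : Σb0 3
lastᵇ = exSub v1 (exSub v2 (exSub v1 (andᵇ (eqᵇ (v1 ⌢ᵗ v2) v4)
  (andᵇ (lenᵇ v2 v5) (andᵇ (eqᵇ v2 ((v3 ⌢ᵗ oneᵗ) ⌢ᵗ v0)) (preᵇ v0 (zeroᵗ ×ᵗ v2)))))))

last-intro : ∀ {η s q m} q′ j → q ≡ q′ ⌢ ((s · true) ⌢ zeros j) → len ((s · true) ⌢ zeros j) ≡ len m →
             Sat₀ η (s ∷ q ∷ m ∷ []) lastᵇ
last-intro {s = s} {m = m} q′ j refl e = O , Suffix⇒Sub q′ O , q′ , Prefix⇒Sub (O , refl) ,
    zeros j , Suffix⇒Sub (s · true) (zeros j) ,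
  refl , ones-cong O m e , refl ,
  subst (Prefix (zeros j)) (sym (zero⊗ O))
      (zeros-Prefix (subst (_≤ len O) (len-zeros j) (Sub-len (Suffix⇒Sub (s · true) (zeros j)))))
  where
  O = (s · true) ⌢ zeros j

last-unique : ∀ {η s z q m} q′ j → q ≡ q′ ⌢ ((s · true) ⌢ zeros j) → len ((s · true) ⌢ zeros j) ≡ len m →
              Sat₀ η (z ∷ q ∷ m ∷ []) lastᵇ → z ≡ s
last-unique {s = s} {z} {m = m} q′ j refl e (O , _ , q″ , _ , a , _ , e₁ , e₂ , refl , p)
  rewrite zero⊗ ((z · true) ⌢ a) | Prefix-zeros _ p =
  padded-inj z s (len a) j (proj₂ (⌢-injective q″ q′ _ _ e₁ lq))
  where
  O′ = (s · true) ⌢ zeros j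
  lO : len ((z · true) ⌢ zeros (len a)) ≡ len O′
  lO = trans (ones-inj ((z · true) ⌢ zeros (len a)) m e₂) (sym e)
  lq : len q″ ≡ len q′
  lq = +-cancelʳ-≡ (len O′) (len q″) (len q′) (trans (cong (len q″ +_) (sym lO))
         (trans (sym (len-⌢ q″ _)) (trans (cong len e₁) (len-⌢ q′ O′))))

-- Closure properties of readable functions

Readable-graph : ∀ {n} {f : Fn n} (R : Σb0 (suc n)) (t : Tm n) → (∀ v η → Sub (f v η) (evalT v t)) →
  (∀ v η → Sat₀ η (f v η ∷ v) R) → (∀ v η z → Sat₀ η (z ∷ v) R → z ≡ f v η) → Readable f
Readable-graph {n} {f} R t s h u = record
  { φ = ψ ; N = t ; D = sub₀ skip R
  ; occurs = λ v η k p → Sub-Prefix (s v η) (Prefix-trans (t-bits v η) (bits-≤ ψ v η p))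
  ; sound  = λ v η k p → proj₂ (Sat-sub₀ skip (skip-at v _ _) R) (h v η)
  ; unique = λ v η k p z q → u v η z (proj₁ (Sat-sub₀ skip (skip-at v _ _) R) q) }
  where
  ψ : Σb0 (suc n)
  ψ = preᵇ (v0 ⌢ᵗ oneᵗ) (wkT t)
  copies : ∀ v η A → Sat₀ η (A ∷ v) ψ ⟺ Prefix (A · true) (evalT v t)
  copies v η A rewrite evalT-wkT A v t = (λ z → z) , (λ z → z)
  t-bits : ∀ v η → Prefix (evalT v t) (bits ψ v η (len (evalT v t)))
  t-bits v η = subst (λ z → Prefix z (bits ψ v η (len (evalT v t))))
    (Prefix-unique (bits-copy ψ v η (evalT v t) (copies v η) _ ≤-refl) (Prefix-refl _)
        (len-bits ψ v η _)) (Prefix-refl _)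

Readable-term : ∀ {n} (t : Tm n) → Readable (λ v η → evalT v t)
Readable-term t = Readable-graph (eqᵇ v0 (wkT t)) t (λ v η → Prefix⇒Sub (Prefix-refl _))
  (λ v η → sym (evalT-wkT _ v t)) (λ v η z e → trans e (evalT-wkT z v t))

Readable-query : Readable {1} (λ v η → ε · η (lookup v zero))
-- Both possible answers occur as subwords of the string 01.
Readable-query = Readable-graph R (zeroᵗ ⌢ᵗ oneᵗ) sub (λ v η → s v η _ refl) u
  where
  R : Σb0 2
  R = orᵇ (andᵇ (flipᵇ v1) (eqᵇ v0 oneᵗ)) (andᵇ (notᵇ (flipᵇ v1)) (eqᵇ v0 zeroᵗ))
  sub : ∀ (v : Vec Str 1) (η : Oracle) → Sub (ε · η (lookup v zero)) (ε · false · true)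
  sub v η with η (lookup v zero)
  ... | false = Prefix⇒Sub (ε · true , refl)
  ... | true  = Suffix⇒Sub (ε · false) (ε · true)
  s : ∀ (v : Vec Str 1) (η : Oracle) b → η (lookup v zero) ≡ b → Sat₀ η (ε · b ∷ v) R
  s v η true  e = inj₁ (e , refl)
  s v η false e = inj₂ ((λ e′ → true≢false e′ e) , refl)
  u : ∀ (v : Vec Str 1) (η : Oracle) z → Sat₀ η (z ∷ v) R → z ≡ ε · η (lookup v zero)
  u v η z (inj₁ (e , refl)) = cong (ε ·_) (sym e)
  u v η z (inj₂ (n , refl)) with η (lookup v zero)
  ... | false = refl
  ... | true  = ⊥-elim (n refl)

condFn : Fn 4
condFn v η = cond (lookup v zero) (lookup v 1F) (lookup v 2F) (lookup v 3F)

Readable-cond : Readable condFn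
Readable-cond = Readable-graph R ((v1 ⌢ᵗ v2) ⌢ᵗ v3) sub s u
  where
  R : Σb0 5
  R = orᵇ (andᵇ (eqᵇ v1 eps) (eqᵇ v0 v2))
     (orᵇ (exSub v1 (andᵇ (eqᵇ v2 (v0 ⌢ᵗ zeroᵗ)) (eqᵇ v1 v4)))
          (exSub v1 (andᵇ (eqᵇ v2 (v0 ⌢ᵗ oneᵗ)) (eqᵇ v1 v5))))
  sub : ∀ v η → Sub (condFn v η) (evalT v ((v1 ⌢ᵗ v2) ⌢ᵗ v3))
  sub (ε ∷ y ∷ z ∷ w ∷ []) η         = Sub-Prefix (Prefix⇒Sub (z , refl)) (w , refl)
  sub (x · false ∷ y ∷ z ∷ w ∷ []) η = Sub-Prefix (Suffix⇒Sub y z) (w , refl)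
  sub (x · true ∷ y ∷ z ∷ w ∷ []) η  = Suffix⇒Sub (y ⌢ z) w
  s : ∀ v η → Sat₀ η (condFn v η ∷ v) R
  s (ε ∷ y ∷ z ∷ w ∷ []) η         = inj₁ (refl , refl)
  s (x · false ∷ y ∷ z ∷ w ∷ []) η = inj₂ (inj₁ (x , Prefix⇒Sub (ε · false , refl) , refl , refl))
  s (x · true ∷ y ∷ z ∷ w ∷ []) η  = inj₂ (inj₂ (x , Prefix⇒Sub (ε · true , refl) , refl , refl))
  u : ∀ v η r → Sat₀ η (r ∷ v) R → r ≡ condFn v η
  u (.ε ∷ y ∷ z ∷ w ∷ []) η r (inj₁ (refl , e)) = e
  u (._ ∷ y ∷ z ∷ w ∷ []) η r (inj₂ (inj₁ (x , _ , refl , e))) = e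
  u (._ ∷ y ∷ z ∷ w ∷ []) η r (inj₂ (inj₂ (x , _ , refl , e))) = e

Readable-trunc : Readable {2} (λ v η → trunc (lookup v zero) (lookup v 1F))
Readable-trunc = Readable-graph R v0
    (λ v η → Prefix⇒Sub (dropLast-Prefix (len (lookup v zero) ∸ len (lookup v 1F)) _)) s u
  where
  R : Σb0 3
  R = andᵇ (preᵇ v0 v1) (orᵇ (lenᵇ v0 v2) (andᵇ (leqᵇ v1 v2) (eqᵇ v0 v1)))
  s : ∀ v η → Sat₀ η (trunc (lookup v zero) (lookup v 1F) ∷ v) R
  s (x ∷ y ∷ []) η with ≤-total (len x) (len y)
  ... | inj₁ p rewrite trunc-id x y p = Prefix-refl x , inj₂ (≤⇒leq x y p , refl)
  ... | inj₂ p = dropLast-Prefix (len x ∸ len y) x , inj₁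
      (ones-cong (trunc x y) y (trans (len-dropLast (len x ∸ len y) x) (m∸[m∸n]≡n p)))
  u : ∀ v η z → Sat₀ η (z ∷ v) R → z ≡ trunc (lookup v zero) (lookup v 1F)
  u (x ∷ y ∷ []) η z (p , inj₁ e) = Prefix-unique p (dropLast-Prefix (len x ∸ len y) x)
    (trans lz (trans (sym (m∸[m∸n]≡n (subst (_≤ len x) lz (Prefix-len p))))
        (sym (len-dropLast (len x ∸ len y) x))))
    where
    lz : len z ≡ len y
    lz = ones-inj z y e
  u (x ∷ y ∷ []) η .x (p , inj₂ (l , refl)) = sym (trunc-id x y (leq⇒≤ x y l))

evalTs : ∀ {m n} → (Fin m → Tm n) → Vec Str n → Vec Str m
evalTs σ v = tabulate (λ i → evalT v (σ i))

Readable-sub : ∀ {m n} {f : Fn m} → Readable f → (σ : Fin m → Tm n) → Readable (λ v η → f (evalTs σ v) η)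
Readable-sub {m} {n} {f} r σ = record
  { φ = ψ ; N = subT σ (N r) ; D = sub₀ σ₂ (D r)
  ; occurs = λ v η k p → subst (Sub _) (sym (bits≡ v η k)) (occurs r (evalTs σ v) η k (N≤ v k p))
  ; sound  = λ v η k p → proj₂ (Sat-sub₀ σ₂ (at₂ v _ _) (D r))
      (subst (λ z → Sat₀ η (_ ∷ z ∷ _) (D r)) (sym (bits≡ v η k)) (sound r (evalTs σ v) η k (N≤ v k p)))
  ; unique = λ v η k p z s → unique r (evalTs σ v) η k (N≤ v k p) z
      (subst (λ W → Sat₀ η (z ∷ W ∷ _) (D r)) (bits≡ v η k) (proj₁ (Sat-sub₀ σ₂ (at₂ v _ _) (D r)) s)) }
  where
  σ₁ : Fin (suc m) → Tm (suc n)
  σ₁ zero    = v0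
  σ₁ (suc i) = wkT (σ i)
  σ₂ : Fin (2 + m) → Tm (2 + n)
  σ₂ zero          = v0
  σ₂ 1F    = v1
  σ₂ (suc (suc i)) = wkT (wkT (σ i))
  at₁ : ∀ v A i → lookup (A ∷ evalTs σ v) i ≡ evalT (A ∷ v) (σ₁ i)
  at₁ v A zero    = refl
  at₁ v A (suc i) = trans (lookup∘tabulate _ i) (sym (evalT-wkT A v (σ i)))
  at₂ : ∀ v z W i → lookup (z ∷ W ∷ evalTs σ v) i ≡ evalT (z ∷ W ∷ v) (σ₂ i)
  at₂ v z W zero          = refl
  at₂ v z W 1F    = refl
  at₂ v z W (suc (suc i)) = trans (lookup∘tabulate _ i)
      (sym (trans (evalT-wkT z (W ∷ v) (wkT (σ i))) (evalT-wkT W v (σ i))))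
  ψ : Σb0 (suc n)
  ψ = sub₀ σ₁ (φ r)
  bits≡ : ∀ v η k → bits ψ v η k ≡ bits (φ r) (evalTs σ v) η k
  bits≡ v η k = bits-run₀ ψ (φ r) v (evalTs σ v) η k (λ j _ → Sat-sub₀ σ₁ (at₁ v _) (φ r))
  N≤ : ∀ v k → len (evalT v (subT σ (N r))) ≤ k → len (evalT (evalTs σ v) (N r)) ≤ k
  N≤ v k p = subst (λ z → len z ≤ k) (evalT-subT σ (lookup∘tabulate _) (N r)) p

-- After len M bits computing g v, the bits are those of K with g v as additional parameter.
module Phase {n} {g : Fn n} (r : Readable g) (M : Tm n) where

  -- The current string is split as `B ⌢ r` with `B` of the length of `M`; the value of `g` is read
  -- off `B` by its `D`, and `K` is asked about `r`. The map `ι` allows `K` parameters that `g` does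
  -- not have.
  after : ∀ {m} → (Fin n → Fin m) → Σb0 (2 + m) → Σb0 (suc m)
  after {m} ι K = exSub v0 (andᵇ (lenᵇ v0 (subT (λ i → var (2 ↑ʳ ι i)) M))
    (exSub v0 (andᵇ (sub₀ (v0 ⊳ v1 ⊳ λ i → var (3 ↑ʳ ι i)) (D r))
      (exSub v2 (andᵇ (eqᵇ (v2 ⌢ᵗ v0) v3) (sub₀ (v0 ⊳ v1 ⊳ λ i → var (4 ↑ʳ i)) K))))))

  module _ {m} (ι : Fin n → Fin m) (K : Σb0 (2 + m)) {u : Vec Str m} {v : Vec Str n}
           (u≡ : ∀ i → lookup v i ≡ lookup u (ι i)) where

    private
      M≡ : ∀ B A → evalT (B ∷ A ∷ u) (subT (λ i → var (2 ↑ʳ ι i)) M) ≡ evalT v M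
      M≡ B A = evalT-subT (λ i → var (2 ↑ʳ ι i)) u≡ M
      D-at : ∀ y B A i → lookup (y ∷ B ∷ v) i ≡ evalT (y ∷ B ∷ A ∷ u) ((v0 ⊳ v1 ⊳ λ i → var (3 ↑ʳ ι i)) i)
      D-at y B A zero          = refl
      D-at y B A 1F    = refl
      D-at y B A (suc (suc i)) = u≡ i
      K-at : ∀ r y B A i → lookup (r ∷ y ∷ u) i ≡ evalT (r ∷ y ∷ B ∷ A ∷ u) ((v0 ⊳ v1 ⊳ λ i → var (4 ↑ʳ i)) i)
      K-at r y B A zero          = refl
      K-at r y B A 1F    = refl
      K-at r y B A (suc (suc i)) = refl

    after-elim : ∀ {η A} → Sat₀ η (A ∷ u) (after ι K) → Σ Str λ B → Σ Str λ y → Σ Str λ r′ →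
                 len B ≡ len (evalT v M) × Sat₀ η (y ∷ B ∷ v) (D r) × B ⌢ r′ ≡ A × Sat₀ η (r′ ∷ y ∷ u) K
    after-elim {η} {A} (B , _ , l , y , _ , d , r′ , _ , e , k) = B , y , r′ ,
      trans (ones-inj B _ l) (cong len (M≡ B A)) , proj₁ (Sat-sub₀ _ (D-at y B A) (D r)) d , e ,
      proj₁ (Sat-sub₀ _ (K-at r′ y B A) K) k

    after-bits : ∀ {η} → len (evalT v (N r)) ≤ len (evalT v M) → ∀ r′ →
                 Sat₀ η (bits (φ r) v η (len (evalT v M)) ⌢ r′ ∷ u) (after ι K) ⟺ Sat₀ η (r′ ∷ g v η ∷ u) K
    after-bits {η} N≤M r′ = to , from
      where
      k = len (evalT v M)
      B₀ = bits (φ r) v η k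
      to : Sat₀ η (B₀ ⌢ r′ ∷ u) (after ι K) → Sat₀ η (r′ ∷ g v η ∷ u) K
      to s with after-elim s
      ... | B , y , r″ , l , d , e , h with ⌢-injective B B₀ r″ r′ e (trans l (sym (len-bits (φ r) v η k)))
      ... | refl , refl with unique r v η k N≤M y d
      ... | refl = h
      from : Sat₀ η (r′ ∷ g v η ∷ u) K → Sat₀ η (B₀ ⌢ r′ ∷ u) (after ι K)
      from h = B₀ , Prefix⇒Sub (r′ , refl) , ones-cong B₀ _ (trans (len-bits (φ r) v η k)
          (cong len (sym (M≡ B₀ (B₀ ⌢ r′))))) ,
        g v η , occurs r v η k N≤M , proj₂ (Sat-sub₀ _ (D-at _ B₀ _) (D r)) (sound r v η k N≤M) ,
        r′ , Suffix⇒Sub B₀ r′ , refl , proj₂ (Sat-sub₀ _ (K-at r′ _ B₀ _) K) h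

  -- The two disjuncts never compete: the first requires strictly fewer than `len M` bits, as `oneᵗ`
  -- is appended before comparing, while `after` requires a prefix of that length.
  phaseᵇ : Σb0 (2 + n) → Σb0 (suc n)
  phaseᵇ K = orᵇ (andᵇ (leqᵇ (v0 ⌢ᵗ oneᵗ) (wkT M)) (φ r)) (after (λ i → i) K)

  module _ (K : Σb0 (2 + n)) (v : Vec Str n) (η : Oracle) where
    private
      k = len (evalT v M)

    phase-first : ∀ j → j ≤ k → bits (phaseᵇ K) v η j ≡ bits (φ r) v η j
    phase-first j p = bits-run₀ (phaseᵇ K) (φ r) v v η j λ i q → to i (≤-trans q p) , from i (≤-trans q p)
      where
      to : ∀ i → i < k → Sat₀ η (bits (φ r) v η i ∷ v) (phaseᵇ K) → Sat₀ η (bits (φ r) v η i ∷ v) (φ r)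
      to i q (inj₁ (_ , s)) = s
      to i q (inj₂ s) with after-elim (λ i → i) K (λ _ → refl) s
      ... | B , y , r′ , l , _ , e , _ = ⊥-elim (<⇒≱ q (≤-trans (≤-reflexive (sym l))
              (≤-trans (Prefix-len (r′ , e)) (≤-reflexive (len-bits (φ r) v η i)))))
      from : ∀ i → i < k → Sat₀ η (bits (φ r) v η i ∷ v) (φ r) → Sat₀ η (bits (φ r) v η i ∷ v) (phaseᵇ K)
      from i q s = inj₁ (≤⇒leq (bits (φ r) v η i · true) (evalT (bits (φ r) v η i ∷ v) (wkT M))
        (subst₂ _≤_ (cong suc (sym (len-bits (φ r) v η i)))
            (cong len (sym (evalT-wkT (bits (φ r) v η i) v M))) q) , s)

    phase-second : len (evalT v (N r)) ≤ k → ∀ j → bits (phaseᵇ K) v η (j + k) ≡ bits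
        (φ r) v η k ⌢ bits K (g v η ∷ v) η j
    phase-second N≤M j = bits-run (phaseᵇ K) K v (g v η ∷ v) η k j (phase-first k ≤-refl)
      λ i _ → to _ , λ s → inj₂ (proj₂ (after-bits (λ i → i) K (λ _ → refl) N≤M _) s)
      where
      to : ∀ r′ → Sat₀ η (bits (φ r) v η k ⌢ r′ ∷ v) (phaseᵇ K) → Sat₀ η (r′ ∷ g v η ∷ v) K
      to r′ (inj₂ s) = proj₁ (after-bits (λ i → i) K (λ _ → refl) N≤M r′) s
      to r′ (inj₁ (l , _)) = ⊥-elim
          (<⇒≱ (≤-trans (leq⇒≤ (A · true) _ l) (≤-reflexive (cong len (evalT-wkT A v M))))
        (≤-trans (≤-reflexive (sym (len-bits (φ r) v η k))) (Prefix-len (r′ , refl))))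
        where
        A = bits (φ r) v η k ⌢ r′

-- The description of `h` refers to the value of `g`, so the new `D′` reads that value again from
-- the first phase, by `after` with `z` as an extra parameter. A term cannot mention `g v η` either;
-- in the bound of `h` it is replaced by `N rg`, which is at least as long because the value occurs
-- in that many bits.
Readable-let : ∀ {n} {g : Fn n} {h : Fn (suc n)} → Readable g → Readable h → Readable
    (λ v η → h (g v η ∷ v) η)
Readable-let {n} {g} {h} rg rh = record
  { φ = phaseᵇ (φ rh) ; N = N rg ⌢ᵗ subT σ (N rh) ; D = D′
  ; occurs = λ v η k p → subst (Sub _) (sym (split v η k p))
      (Sub-⌢ (B₀ v η) (occurs rh (g v η ∷ v) η (k ∸ k₀ v) (N≤ v η k p)))
  ; sound  = λ v η k p → proj₂ (Sat-sub₀ swap (swap-at v _ _) (after suc K))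
      (subst (λ W → Sat₀ η (W ∷ _ ∷ v) (after suc K)) (sym (split v η k p))
        (proj₂ (after-bits suc K (λ _ → refl) ≤-refl _) (proj₂ (Sat-sub₀ swap′ (swap′-at v _ _ _) (D rh))
          (sound rh (g v η ∷ v) η (k ∸ k₀ v) (N≤ v η k p)))))
  ; unique = λ v η k p z s → unique rh (g v η ∷ v) η (k ∸ k₀ v) (N≤ v η k p) z
      (proj₁ (Sat-sub₀ swap′ (swap′-at v _ _ _) (D rh)) (proj₁ (after-bits suc K (λ _ → refl) ≤-refl _)
        (subst (λ W → Sat₀ η (W ∷ z ∷ v) (after suc K)) (split v η k p)
          (proj₁ (Sat-sub₀ swap (swap-at v _ _) (after suc K)) s)))) }
  where
  open Phase rg (N rg)
  σ : Fin (suc n) → Tm n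
  σ = N rg ⊳ var
  swap : Fin (2 + n) → Tm (2 + n)
  swap = v1 ⊳ v0 ⊳ λ i → var (suc (suc i))
  swap-at : ∀ v z W i → lookup (W ∷ z ∷ v) i ≡ evalT (z ∷ W ∷ v) (swap i)
  swap-at v z W zero          = refl
  swap-at v z W 1F    = refl
  swap-at v z W (suc (suc i)) = refl
  swap′ : Fin (3 + n) → Tm (3 + n)
  swap′ = v2 ⊳ v0 ⊳ v1 ⊳ λ i → var (suc (suc (suc i)))
  swap′-at : ∀ v z W y i → lookup (z ∷ W ∷ y ∷ v) i ≡ evalT (W ∷ y ∷ z ∷ v) (swap′ i)
  swap′-at v z W y zero                = refl
  swap′-at v z W y 1F          = refl
  swap′-at v z W y 2F    = refl
  swap′-at v z W y (suc (suc (suc i))) = refl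
  K : Σb0 (3 + n)
  K = sub₀ swap′ (D rh)
  D′ : Σb0 (2 + n)
  D′ = sub₀ swap (after suc K)
  k₀ : Vec Str n → ℕ
  k₀ v = len (evalT v (N rg))
  B₀ : Fn n
  B₀ v η = bits (φ rg) v η (k₀ v)
  N-len : ∀ v k → len (evalT v (N rg ⌢ᵗ subT σ (N rh))) ≤ k → k₀ v + len
      (evalT (evalT v (N rg) ∷ v) (N rh)) ≤ k
  N-len v k p = subst (_≤ k) (trans (len-⌢ (evalT v (N rg)) _)
    (cong (λ z → k₀ v + len z) (evalT-subT {v′ = evalT v (N rg) ∷ v} σ
        (λ { zero → refl ; (suc i) → refl }) (N rh)))) p
  k₀≤ : ∀ v k → len (evalT v (N rg ⌢ᵗ subT σ (N rh))) ≤ k → k₀ v ≤ k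
  k₀≤ v k p = ≤-trans (m≤m+n _ _) (N-len v k p)
  split : ∀ v η k p → bits (phaseᵇ (φ rh)) v η k ≡ B₀ v η ⌢ bits (φ rh) (g v η ∷ v) η (k ∸ k₀ v)
  split v η k p = trans (cong (bits (phaseᵇ (φ rh)) v η) (sym (m∸n+n≡m (k₀≤ v k p))))
                        (phase-second (φ rh) v η ≤-refl (k ∸ k₀ v))
  N≤ : ∀ v η k → len (evalT v (N rg ⌢ᵗ subT σ (N rh))) ≤ k → len (evalT (g v η ∷ v) (N rh)) ≤ k ∸ k₀ v
  N≤ v η k p = ≤-trans (evalT-mono (g v η ∷ v) (evalT v (N rg) ∷ v)
      (λ { zero → ≤-trans (Sub-len (occurs rg v η (k₀ v) ≤-refl))
          (≤-reflexive (len-bits (φ rg) v η (k₀ v))) ; (suc i) → ≤-refl }) (N rh))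
    (subst (_≤ k ∸ k₀ v) (m+n∸m≡n (k₀ v) _) (∸-monoˡ-≤ (k₀ v) (N-len v k p)))

-- With m an additional parameter at least as long as N, the value is written,
-- padded, exactly after len m bits.
module Align {n} {g : Fn n} (r : Readable g) where

  shifted : Readable {suc n} (λ w η → g (tail w) η)
  shifted = Readable-ext (λ { (m ∷ v) η → cong (λ z → g z η) (tabulate∘lookup v) })
      (Readable-sub r (λ i → var (suc i)))

  open Phase shifted v0

  padᵇ : Σb0 (3 + n)
  -- Variable 1 is the value of `g`; the formula copies it with a marker, and `bits-padded` supplies
  -- the zeros.
  padᵇ = preᵇ (v0 ⌢ᵗ oneᵗ) (v1 ⌢ᵗ oneᵗ)

  alignedᵇ : Σb0 (2 + n)
  alignedᵇ = phaseᵇ padᵇ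

  aligned-bits : ∀ m v η j → len (evalT v (N r)) ≤ len m → Σ Str λ B →
    bits alignedᵇ (m ∷ v) η ((j + suc (len (g v η))) + len m) ≡ B ⌢ ((g v η · true) ⌢ zeros j)
  aligned-bits m v η j p = bits (φ shifted) (m ∷ v) η (len m) , trans
    (phase-second padᵇ (m ∷ v) η (subst (λ z → len z ≤ len m)
        (sym (evalT-subT (λ i → var (suc i)) (λ i → refl) (N r))) p) (j + suc (len (g v η))))
    (cong (bits (φ shifted) (m ∷ v) η (len m) ⌢_) (bits-padded padᵇ (g v η ∷ m ∷ v) η (g v η)
        (λ A → (λ z → z) , (λ z → z)) j))

-- Uniqueness of the quotient in a division by `K`: the length of a partial sequence determines how
-- many blocks are complete.
blocks-unique : ∀ a c {i j K} → i < K → j < K → a * K + i ≡ c * K + j → a ≡ c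
blocks-unique zero    zero    p q e = refl
blocks-unique zero    (suc c) {i} {j} {K} p q e =
  ⊥-elim (<⇒≱ p (≤-trans (≤-trans (m≤m+n K (c * K)) (m≤m+n _ j)) (≤-reflexive (sym e))))
blocks-unique (suc a) zero    {i} {j} {K} p q e =
  ⊥-elim (<⇒≱ q (≤-trans (≤-trans (m≤m+n K (a * K)) (m≤m+n _ i)) (≤-reflexive e)))
blocks-unique (suc a) (suc c) {i} {j} {K} p q e = cong suc (blocks-unique a c p q
  (+-cancelˡ-≡ K _ _ (trans (sym (+-assoc K (a * K) i)) (trans e (+-assoc K (c * K) j)))))

one-bit : ∀ c → len c ≡ 1 → Σ Bool λ b → c ≡ ε · b
one-bit (ε · b) e = b , refl

-- Bounded recursion: the value at ε is written in a first block of L bits;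
-- then each step uses L bits to compute the next value and L bits to write it.
module Recursion {n} {H : Fn (3 + n)} (rH : Readable H) (t : Tm (suc n))
                 (bound : ∀ s u c v η → len (H (s ∷ u ∷ c ∷ v) η) ≤ len (evalT (u ∷ v) t)) where

  open Align rH

  val : Str → Vec Str n → Oracle → Str → Str
  val s₀ v η ε       = s₀
  val s₀ v η (x · b) = H (val s₀ v η x ∷ x ∷ ε · b ∷ v) η

  tail² : Fin n → Tm (2 + n)
  tail² i = var (suc (suc i))

  -- With `x` and `s₀` as variables 0 and 1, this bounds the values at all prefixes of `x`.
  Sz : Tm (2 + n)
  Sz = v1 ⌢ᵗ subT (v0 ⊳ tail²) t

  -- The block length has to leave room for a value and its marker, hence `oneᵗ`, and for the bits
  -- that one evaluation of `H` needs. The latter are bounded at the largest arguments: `Sz` for the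
  -- value, `x` for the prefix, and a one-bit string for the bit.
  M : Tm (2 + n)
  M = (Sz ⌢ᵗ oneᵗ) ⌢ᵗ subT (Sz ⊳ v0 ⊳ oneᵗ ⊳ tail²) (N rH)

  -- With `m` of the block length, this has the length of the sequence at the moment when the value
  -- at `u` has just been written.
  offset : ∀ {k} → Tm k → Tm k → Tm k
  offset m u = m ⌢ᵗ ((m ⌢ᵗ m) ×ᵗ u)

  len-offset : ∀ m u → len (m ⌢ ((m ⌢ m) ⊗ u)) ≡ len m + len u * (len m + len m)
  len-offset m u = trans (len-⌢ m _) (cong (len m +_) (trans (len-⊗ (m ⌢ m) u) (cong (len u *_) (len-⌢ m m))))

  M↑ : ∀ k → Tm (k + suc (suc n))
  M↑ k = subT (λ i → var (k ↑ʳ i)) M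

  lastσ : ∀ {k} → Tm k → Tm k → Tm k → Fin 3 → Tm k
  lastσ s q m = s ⊳ q ⊳ m ⊳ λ ()

  -- The step in progress is recovered from the current string alone: `u` is the part of `x` already
  -- processed and `c` its next bit, `q` the sequence up to the value at `u`, `r` the unfinished
  -- rest, and `s` the value read off the end of `q`. `Block` names these components.
  blockᵇ : Σb0 (3 + n)
  blockᵇ =
    exSub v1 (exSub v2 (andᵇ (preᵇ (v1 ⌢ᵗ v0) v3) (andᵇ (lenᵇ v0 oneᵗ)
      (exSub v2 (exSub v3 (andᵇ (eqᵇ (v1 ⌢ᵗ v0) v4) (andᵇ (lenᵇ v1 (offset (M↑ 5) v3))
          (andᵇ (leqᵇ (v0 ⌢ᵗ oneᵗ) (M↑ 5 ⌢ᵗ M↑ 5))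
        (exSub v1 (andᵇ (sub₀ (lastσ v0 v2 (M↑ 6)) lastᵇ)
                        (sub₀ (v1 ⊳ M↑ 6 ⊳ v0 ⊳ v4 ⊳ v3 ⊳ λ i → var (8 ↑ʳ i)) alignedᵇ)))))))))))

  recᵇ : Σb0 (3 + n)
  recᵇ = orᵇ (andᵇ (leqᵇ (v0 ⌢ᵗ oneᵗ) (M↑ 1)) (preᵇ (v0 ⌢ᵗ oneᵗ) (v2 ⌢ᵗ oneᵗ))) blockᵇ

  -- The sequence may run on beyond the result, so the result is looked up at the end of the prefix
  -- of the exact length, not at the end of the whole sequence.
  decodeᵇ : Σb0 (4 + n)
  decodeᵇ = exSub v1 (andᵇ (preᵇ v0 v2) (andᵇ (lenᵇ v0 (offset (M↑ 3) v3)) (sub₀ (lastσ v1 v0 (M↑ 3)) lastᵇ)))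

  module _ (x s₀ : Str) (v : Vec Str n) (η : Oracle) where

    w : Vec Str (2 + n)
    w = x ∷ s₀ ∷ v

    m : Str
    m = evalT w M

    L : ℕ
    L = len m

    at : Str → Str
    at u = val s₀ v η u

    len-M : L ≡ suc (len s₀ + len (evalT (x ∷ v) t)) + len (evalT (evalT w Sz ∷ x ∷ ε · true ∷ v) (N rH))
    len-M = trans (len-⌢ (evalT w Sz · true) _) (cong₂ (λ a b → suc a + len b)
      (trans (len-⌢ s₀ _) (cong (λ z → len s₀ + len z) (evalT-subT {v′ = x ∷ v} (v0 ⊳ tail²)
          (λ { zero → refl ; (suc i) → refl }) t)))
      (evalT-subT {v′ = evalT w Sz ∷ x ∷ ε · true ∷ v} (Sz ⊳ v0 ⊳ oneᵗ ⊳ tail²)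
        (λ { zero → refl ; 1F → refl ; 2F → refl ; (suc (suc (suc i))) → refl }) (N rH)))

    at-len : ∀ u → Prefix u x → len (at u) ≤ len s₀ + len (evalT (x ∷ v) t)
    at-len ε       p = m≤m+n _ _
    at-len (u · b) p = ≤-trans (≤-trans (bound (at u) u (ε · b) v η)
      (evalT-mono (u ∷ v) (x ∷ v) (λ { zero → Prefix-len (Prefix-·ˡ p) ; (suc i) → ≤-refl }) t)) (m≤n+m _ _)

    at<L : ∀ u → Prefix u x → suc (len (at u)) ≤ L
    at<L u p = ≤-trans (s≤s (at-len u p)) (≤-trans (m≤m+n _ _) (≤-reflexive (sym len-M)))

    N≤L : ∀ u b → Prefix u x → len (evalT (at u ∷ u ∷ ε · b ∷ v) (N rH)) ≤ L
    N≤L u b p = ≤-trans (evalT-mono (at u ∷ u ∷ ε · b ∷ v) (evalT w Sz ∷ x ∷ ε · true ∷ v)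
      (λ { zero → ≤-trans (at-len u p) (≤-reflexive (sym (trans (len-⌢ s₀ _)
                    (cong (λ z → len s₀ + len z) (evalT-subT {v′ = x ∷ v} (v0 ⊳ tail²)
                        (λ { zero → refl ; (suc i) → refl }) t)))))
         ; 1F → Prefix-len p ; 2F → ≤-refl ; (suc (suc (suc i))) → ≤-refl }) (N rH))
      (≤-trans (m≤n+m _ _) (≤-reflexive (sym len-M)))

    record Block (A : Str) : Set where
      constructor block
      field
        u c q r s : Str
        uc⊑x  : Prefix (u ⌢ c) x
        len-c : len c ≡ 1
        q⌢r   : q ⌢ r ≡ A
        len-q : len q ≡ L + len u * (L + L)
        len-r : len r < L + L
        last-s : Sat₀ η (s ∷ q ∷ m ∷ []) lastᵇ
        next-r : Sat₀ η (r ∷ m ∷ s ∷ u ∷ c ∷ v) alignedᵇ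

    M≡ : ∀ {k} (a : Vec Str k) → evalT (a ++ w) (M↑ k) ≡ m
    M≡ {k} a = evalT-subT (λ i → var (k ↑ʳ i)) (λ i → sym (lookup-++ʳ a w i)) M

    offset≡ : ∀ {k} (a : Vec Str k) u → len
        (evalT (a ++ w) (M↑ k) ⌢ ((evalT (a ++ w) (M↑ k) ⌢ evalT (a ++ w) (M↑ k)) ⊗ u)) ≡ L + len u * (L + L)
    offset≡ a u rewrite M≡ a = len-offset m u

    last-inst : ∀ {k} (a : Vec Str k) s q → Sat₀ η (a ++ w) (sub₀ (lastσ s q (M↑ k)) lastᵇ) ⟺
                Sat₀ η (evalT (a ++ w) s ∷ evalT (a ++ w) q ∷ m ∷ []) lastᵇ
    last-inst {k} a s q = Sat-sub₀ {η = η} {v′ = evalT (a ++ w) s ∷ evalT (a ++ w) q ∷ m ∷ []}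
        (lastσ s q (M↑ k))
      (λ { zero → refl ; 1F → refl ; 2F → sym (M≡ a) }) lastᵇ

    next-at : ∀ s r q c u A i → lookup (r ∷ m ∷ s ∷ u ∷ c ∷ v) i ≡
              evalT (s ∷ r ∷ q ∷ c ∷ u ∷ A ∷ w) ((v1 ⊳ M↑ 6 ⊳ v0 ⊳ v4 ⊳ v3 ⊳ λ i → var (8 ↑ʳ i)) i)
    next-at s r q c u A zero                         = refl
    next-at s r q c u A 1F                   = sym (M≡ (s ∷ r ∷ q ∷ c ∷ u ∷ A ∷ []))
    next-at s r q c u A 2F             = refl
    next-at s r q c u A 3F       = refl
    next-at s r q c u A 4F = refl
    next-at s r q c u A (suc (suc (suc (suc (suc i))))) = refl

    block-elim : ∀ {A} → Sat₀ η (A ∷ w) blockᵇ → Block A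
    block-elim {A} (u , _ , c , _ , p , lc , q , _ , r , _ , e , lq , lr , s , _ , h , k) =
      block u c q r s p (ones-inj c (ε · true) lc) e
        (trans (ones-inj q _ lq) (offset≡ (r ∷ q ∷ c ∷ u ∷ A ∷ []) u))
        (≤-trans (leq⇒≤ (r · true) _ lr)
            (≤-reflexive (trans (cong₂ (λ a b → len (a ⌢ b)) (M≡ (r ∷ q ∷ c ∷ u ∷ A ∷ []))
                (M≡ (r ∷ q ∷ c ∷ u ∷ A ∷ []))) (len-⌢ m m))))
        (proj₁ (last-inst (s ∷ r ∷ q ∷ c ∷ u ∷ A ∷ []) v0 v2) h)
        (proj₁ (Sat-sub₀ _ (next-at s r q c u A) alignedᵇ) k)

    block-intro : ∀ {A} → (B : Block A) → Sub (Block.s B) (Block.q B) → Sat₀ η (A ∷ w) blockᵇ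
    block-intro {A} (block u c q r s p lc e lq lr h k) s⊑q =
      u , Prefix⇒Sub (Prefix-trans (c , refl) p) , c , Sub-Prefix (Suffix⇒Sub u c) p , p ,
          ones-cong c (ε · true) lc ,
      q , Prefix⇒Sub (r , e) , r , subst (Sub r) e (Suffix⇒Sub q r) , e ,
      ones-cong q _ (trans lq (sym (offset≡ (r ∷ q ∷ c ∷ u ∷ A ∷ []) u))) ,
      ≤⇒leq (r · true) _ (≤-trans lr
          (≤-reflexive (sym (trans (cong₂ (λ a b → len (a ⌢ b)) (M≡ (r ∷ q ∷ c ∷ u ∷ A ∷ []))
              (M≡ (r ∷ q ∷ c ∷ u ∷ A ∷ []))) (len-⌢ m m))))) ,
      s , s⊑q , proj₂ (last-inst (s ∷ r ∷ q ∷ c ∷ u ∷ A ∷ []) v0 v2) h ,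
      proj₂ (Sat-sub₀ _ (next-at s r q c u A) alignedᵇ) k

    padded : Str → Str
    padded s = (s · true) ⌢ zeros (L ∸ suc (len s))

    len-padded : ∀ u → Prefix u x → len (padded (at u)) ≡ L
    len-padded u p = trans (len-⌢ (at u · true) _) (trans (cong (suc (len (at u)) +_) (len-zeros _))
        (m+[n∸m]≡n (at<L u p)))

    stepW : Str → Bool → Vec Str (4 + n)
    stepW u b = m ∷ at u ∷ u ∷ ε · b ∷ v

    -- The intended sequence up to the value at `u`; `bits-rec` shows that `recᵇ` produces it.
    run : Str → Str
    run ε       = padded s₀
    run (u · b) = run u ⌢ bits alignedᵇ (stepW u b) η (L + L)

    len-run : ∀ u → Prefix u x → len (run u) ≡ L + len u * (L + L)
    len-run ε       p = trans (len-padded ε p) (sym (+-identityʳ L))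
    len-run (u · b) p = trans (len-⌢ (run u) _)
        (trans (cong₂ _+_ (len-run u (Prefix-·ˡ p)) (len-bits alignedᵇ (stepW u b) η (L + L)))
      (trans (+-assoc L (len u * (L + L)) (L + L)) (cong (L +_) (+-comm (len u * (L + L)) (L + L)))))

    run-last : ∀ u → Prefix u x → Σ Str λ q → run u ≡ q ⌢ padded (at u)
    run-last ε       p = ε , sym (⌢-identityˡ _)
    run-last (u · b) p with aligned-bits m (at u ∷ u ∷ ε · b ∷ v) η (L ∸ suc (len (at (u · b))))
        (N≤L u b (Prefix-·ˡ p))
    ... | B , e = (run u ⌢ B) , trans
        (cong (run u ⌢_) (trans (cong (bits alignedᵇ (stepW u b) η)
            (cong (_+ L) (sym (m∸n+n≡m (at<L (u · b) p))))) e))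
                                      (sym (⌢-assoc (run u) B _))

    last-run : ∀ u → Prefix u x → ∀ s → Sat₀ η (s ∷ run u ∷ m ∷ []) lastᵇ ⟺ s ≡ at u
    last-run u p s with run-last u p
    ... | q , e = last-unique {η} {at u} {s} {run u} {m} q (L ∸ suc (len (at u))) e
        (len-padded u p) , λ { refl → last-intro {η} {at u} {run u} {m} q (L ∸ suc (len (at u))) e
            (len-padded u p) }

    sub-run : ∀ u → Prefix u x → Sub (at u) (run u)
    sub-run u p with run-last u p
    ... | q , e = subst (Sub (at u)) (sym e)
        (Sub-⌢ q (Prefix⇒Sub (Prefix-trans {y = at u · true} (ε · true , refl) (_ , refl))))

    bits-rec : ∀ u → Prefix u x → bits recᵇ w η (len (run u)) ≡ run u
    bits-rec ε p = trans (cong (bits recᵇ w η) (len-padded ε p)) (Prefix-unique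
      (subst (λ z → Prefix (bits recᵇ w η L) z) refl pre-L) (Prefix-refl _)
          (trans (len-bits recᵇ w η L) (sym (len-padded ε p))))
      where
      φ₀ : Σb0 (3 + n)
      φ₀ = preᵇ (v0 ⌢ᵗ oneᵗ) (v2 ⌢ᵗ oneᵗ)
      same : ∀ j → j < L → Sat₀ η (bits φ₀ w η j ∷ w) recᵇ ⟺ Sat₀ η (bits φ₀ w η j ∷ w) φ₀
      same j q = to , λ s → inj₁
          (≤⇒leq (A · true) _ (subst₂ _≤_ (cong suc (sym (len-bits φ₀ w η j)))
              (cong len (sym (M≡ (A ∷ [])))) q) , s)
        where
        A = bits φ₀ w η j
        to : Sat₀ η (A ∷ w) recᵇ → Sat₀ η (A ∷ w) φ₀
        to (inj₁ (_ , s)) = s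
        to (inj₂ s) with block-elim s
        ... | block u c q′ r s′ _ _ e lq _ _ _ = ⊥-elim
            (<⇒≱ q (≤-trans (≤-trans (m≤m+n L _) (≤-reflexive (sym lq)))
                (≤-trans (Prefix-len (r , e)) (≤-reflexive (len-bits φ₀ w η j)))))
      pre-L : Prefix (bits recᵇ w η L) (padded s₀)
      pre-L = subst (λ z → Prefix z (padded s₀)) (sym (trans (bits-run₀ recᵇ φ₀ w w η L same)
        (trans (cong (bits φ₀ w η) (sym (m∸n+n≡m (at<L ε p))))
            (bits-padded φ₀ w η s₀ (λ A → (λ z → z) , (λ z → z)) (L ∸ suc (len s₀))))))
        (Prefix-refl _)
    bits-rec (u · b) p = trans (cong (bits recᵇ w η) (trans (len-⌢ (run u) _)
        (trans (cong (len (run u) +_) (len-bits alignedᵇ (stepW u b) η (L + L)))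
            (+-comm (len (run u)) (L + L)))))
      (bits-run recᵇ alignedᵇ w (stepW u b) η (len (run u)) (L + L) (bits-rec u (Prefix-·ˡ p)) same)
      where
      same : ∀ j → j < L + L → Sat₀ η (run u ⌢ bits alignedᵇ (stepW u b) η j ∷ w) recᵇ ⟺
                               Sat₀ η (bits alignedᵇ (stepW u b) η j ∷ stepW u b) alignedᵇ
      same j j< = to , λ s → inj₂ (block-intro (block u (ε · b) (run u) r (at u) p refl refl
          (len-run u (Prefix-·ˡ p)) r<
            (proj₂ (last-run u (Prefix-·ˡ p) (at u)) refl) s) (sub-run u (Prefix-·ˡ p)))
        where
        r = bits alignedᵇ (stepW u b) η j
        r< : len r < L + L
        r< = subst (_< L + L) (sym (len-bits alignedᵇ (stepW u b) η j)) j<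
        long : L ≤ len (run u ⌢ r)
        long = ≤-trans (≤-trans (m≤m+n L _) (≤-reflexive (sym (len-run u (Prefix-·ˡ p)))))
            (Prefix-len (r , refl))
        to : Sat₀ η (run u ⌢ r ∷ w) recᵇ → Sat₀ η (r ∷ stepW u b) alignedᵇ
        to (inj₁ (l , _)) = ⊥-elim
            (<⇒≱ (≤-trans (leq⇒≤ ((run u ⌢ r) · true) _ l)
                (≤-reflexive (cong len (M≡ (run u ⌢ r ∷ []))))) long)
        -- As `r` and `r′` are both shorter than two blocks, the total length determines the length
        -- of `u′`. Hence `q` is `run u`, the prefixes of `x` agree together with the next bit, and
        -- `s′` must be the value at `u`.
        to (inj₂ s) with block-elim s
        ... | block u′ c q r′ s′ p′ lc e lq lr h k with ⌢-injective q (run u) r′ r e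
              (trans lq (trans (cong (λ z → L + z * (L + L)) len-u′) (sym (len-run u (Prefix-·ˡ p)))))
          where
          len-u′ : len u′ ≡ len u
          len-u′ = blocks-unique (len u′) (len u) lr r< (+-cancelˡ-≡ L _ _ (trans (sym (+-assoc L _ (len r′)))
            (trans (trans (cong (_+ len r′) (sym lq))
                (trans (sym (len-⌢ q r′)) (trans (cong len e)
                    (trans (len-⌢ (run u) r) (cong (_+ len r) (len-run u (Prefix-·ˡ p)))))))
                   (+-assoc L _ (len r)))))
        ... | refl , refl with one-bit c lc
        ... | b′ , refl with Prefix-unique p′ p
            (cong suc (*-cancelʳ-≡-len u′ u (trans (sym lq) (len-run u (Prefix-·ˡ p)))))
          where
          *-cancelʳ-≡-len : ∀ a c → L + len a * (L + L) ≡ L + len c * (L + L) → len a ≡ len c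
          *-cancelʳ-≡-len a c e = blocks-unique (len a) (len c) r< r< (cong (_+ len r) (+-cancelˡ-≡ L _ _ e))
        ... | refl with proj₁ (last-run u (Prefix-·ˡ p) s′) h
        ... | refl = k

    decode : ∀ {k} → L + len x * (L + L) ≤ k → ∀ z → Sat₀ η (z ∷ bits recᵇ w η k ∷ w) decodeᵇ ⟺ z ≡ at x
    decode {k} l z = to , from
      where
      W = bits recᵇ w η k
      run-W : Prefix (run x) W
      run-W = subst (λ y → Prefix y W) (bits-rec x (Prefix-refl x))
                (bits-≤ recᵇ w η (≤-trans (≤-reflexive (len-run x (Prefix-refl x))) l))
      to : Sat₀ η (z ∷ W ∷ w) decodeᵇ → z ≡ at x
      to (q , _ , p , lq , h) with Prefix-unique p run-W
          (trans (trans (ones-inj q _ lq) (offset≡ (q ∷ z ∷ W ∷ []) x)) (sym (len-run x (Prefix-refl x))))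
      ... | refl = proj₁ (last-run x (Prefix-refl x) z) (proj₁ (last-inst (q ∷ z ∷ W ∷ []) v1 v0) h)
      from : z ≡ at x → Sat₀ η (z ∷ W ∷ w) decodeᵇ
      from e = run x , Prefix⇒Sub run-W , run-W ,
        ones-cong (run x) _ (trans (len-run x (Prefix-refl x)) (sym (offset≡ (run x ∷ z ∷ W ∷ []) x))) ,
        proj₂ (last-inst (run x ∷ z ∷ W ∷ []) v1 v0) (proj₂ (last-run x (Prefix-refl x) z) e)

    rec-occurs : ∀ {k} → L + len x * (L + L) ≤ k → Sub (at x) (bits recᵇ w η k)
    rec-occurs l = Sub-Prefix (subst (Sub (at x)) (sym (bits-rec x (Prefix-refl x)))
        (sub-run x (Prefix-refl x)))
      (bits-≤ recᵇ w η (≤-trans (≤-reflexive (len-run x (Prefix-refl x))) l))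

  Readable-rec : Readable {suc (suc n)} (λ w η → val (head (tail w)) (tail (tail w)) η (head w))
  Readable-rec = record
    { φ = recᵇ ; N = offset M v0 ; D = decodeᵇ
    ; occurs = λ { (x ∷ s₀ ∷ v) η k p → rec-occurs x s₀ v η (N≤ x s₀ v η p) }
    ; sound  = λ { (x ∷ s₀ ∷ v) η k p → proj₂ (decode x s₀ v η (N≤ x s₀ v η p) _) refl }
    ; unique = λ { (x ∷ s₀ ∷ v) η k p z → proj₁ (decode x s₀ v η (N≤ x s₀ v η p) z) } }
    where
    N≤ : ∀ x s₀ v η {k} → len (evalT (x ∷ s₀ ∷ v) (offset M v0)) ≤ k → L x s₀ v η + len x *
        (L x s₀ v η + L x s₀ v η) ≤ k
    N≤ x s₀ v η {k} = subst (_≤ k) (len-offset (m x s₀ v η) x)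

-- All POR functions are readable

Readable-lets : ∀ m {n} {h : Fn (m + n)} (g : Fin m → Fn n) → Readable h → (∀ i → Readable (g i)) →
                Readable {n} (λ v η → h (tabulate (λ i → g i v η) ++ v) η)
Readable-lets zero    g rh rg = rh
Readable-lets (suc m) {n} {h} g rh rg = Readable-ext
  (λ v η → cong (λ z → h (g zero z η ∷ tabulate (λ i → g (suc i) v η) ++ v) η)
      (drop-params (tabulate (λ i → g (suc i) v η)) v))
  (Readable-lets m (λ i → g (suc i)) (Readable-let (Readable-sub (rg zero) (λ i → var (m ↑ʳ i))) rh)
      (λ i → rg (suc i)))
  where
  drop-params : ∀ (ys : Vec Str m) v → evalTs (λ i → var (m ↑ʳ i)) (ys ++ v) ≡ v
  drop-params ys v = trans (tabulate-cong (lookup-++ʳ ys v)) (tabulate∘lookup v)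

-- The values are bound one by one in front of the arguments, so that every `g i` can still read the
-- original ones; `h` looks only at the new entries.
Readable-comp : ∀ {m n} {h : Fn m} {g : Fin m → Fn n} → Readable h → (∀ i → Readable (g i)) →
                Readable {n} (λ v η → h (tabulate (λ i → g i v η)) η)
Readable-comp {m} {n} {h} {g} rh rg = Readable-ext
  (λ v η → cong (λ z → h z η) (trans (tabulate-cong (lookup-++ˡ (tabulate (λ i → g i v η)) v))
      (tabulate∘lookup _)))
  (Readable-lets m g (Readable-sub rh (λ i → var (i ↑ˡ n))) rg)

-- Positions in s ∷ u ∷ c ∷ v of the entries of v ∷ʳ u and of (v ∷ʳ u) ∷ʳ s.
arg-u : ∀ {n} → Fin (suc n) → Fin (3 + n)
arg-u i with rotate i
... | zero  = suc zero
... | suc j = suc (suc (suc j))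

lookup-arg-u : ∀ {n} s u c (v : Vec Str n) i → lookup (s ∷ u ∷ c ∷ v) (arg-u i) ≡ lookup (v ∷ʳ u) i
lookup-arg-u s u c v i with rotate i | lookup-rotate v u i
... | zero  | e = e
... | suc j | e = e

arg-s : ∀ {n} → Fin (2 + n) → Fin (3 + n)
arg-s i with rotate i
... | zero  = zero
... | suc j = arg-u j

lookup-arg-s : ∀ {n} s u c (v : Vec Str n) i → lookup (s ∷ u ∷ c ∷ v) (arg-s i) ≡ lookup ((v ∷ʳ u) ∷ʳ s) i
lookup-arg-s s u c v i with rotate i | lookup-rotate (v ∷ʳ u) s i
... | zero  | e = e
... | suc j | e = trans (lookup-arg-u s u c v j) e

POR-readable : ∀ {n} (p : POR n) → Readable ⟦ p ⟧
POR-readable E          = Readable-term eps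
POR-readable (P i)      = Readable-term (var i)
POR-readable (S b)      = Readable-ext (λ { (x ∷ []) η → cong (x ⌢_) (evalT-bit (x ∷ []) b) })
    (Readable-term (v0 ⌢ᵗ bitᵗ b))
POR-readable C          = Readable-ext (λ { (x ∷ y ∷ z ∷ w ∷ []) η → refl }) Readable-cond
POR-readable Q          = Readable-ext (λ { (x ∷ []) η → refl }) Readable-query
POR-readable (comp p q) = Readable-comp (POR-readable p) (λ i → POR-readable (q i))
POR-readable {suc n} (rec g h t) = Readable-ext result (Readable-comp Readable-rec args)
  where
  step : Bool → Fn (3 + n)
  step b w η = ⟦ h b ⟧ (evalTs (λ i → var (arg-s i)) w) η
  bnd : Tm (3 + n)
  bnd = subT (λ i → var (arg-u i)) t
  branches : Fin 4 → Fn (3 + n)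
  branches zero                   w η = evalT w v2
  branches 1F             w η = evalT w eps
  branches 2F       w η = step false w η
  branches 3F w η = step true w η
  branches-readable : ∀ i → Readable (branches i)
  branches-readable zero                   = Readable-term v2
  branches-readable 1F             = Readable-term eps
  branches-readable 2F       = Readable-sub (POR-readable (h false)) (λ i → var (arg-s i))
  branches-readable 3F = Readable-sub (POR-readable (h true)) (λ i → var (arg-s i))
  -- The appended bit arrives as the one-bit string `c`, and `cond` on it chooses between the two
  -- step functions.
  parts : Fin 2 → Fn (3 + n)
  parts zero       w η = cond (evalT w v2) ε (step false w η) (step true w η)
  parts 1F w η = evalT w bnd
  parts-readable : ∀ i → Readable (parts i)
  parts-readable zero       = Readable-comp Readable-cond branches-readable
  parts-readable 1F = Readable-term bnd
  -- The truncation is made part of the step function; it supplies the length bound that `Recursion`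
  -- demands.
  H : Fn (3 + n)
  H w η = trunc (parts zero w η) (parts 1F w η)
  bnd≡ : ∀ s u c v → evalT (s ∷ u ∷ c ∷ v) bnd ≡ evalT (v ∷ʳ u) t
  bnd≡ s u c v = evalT-subT (λ i → var (arg-u i)) (λ i → sym (lookup-arg-u s u c v i)) t
  t′ : Tm (suc n)
  t′ = subT (λ i → var (rotate i)) t
  open Recursion {H = H} (Readable-comp Readable-trunc parts-readable) t′
    (λ s u c v η → ≤-trans (trunc-len (parts zero (s ∷ u ∷ c ∷ v) η) _)
      (≤-reflexive (cong len (trans (bnd≡ s u c v)
          (sym (evalT-subT (λ i → var (rotate i)) (λ i → sym (lookup-rotate v u i)) t))))))
  step≡ : ∀ b s u c v η → step b (s ∷ u ∷ c ∷ v) η ≡ ⟦ h b ⟧ ((v ∷ʳ u) ∷ʳ s) η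
  step≡ b s u c v η = cong (λ z → ⟦ h b ⟧ z η) (trans (tabulate-cong (lookup-arg-s s u c v))
      (tabulate∘lookup _))
  H≡ : ∀ b s u v η → H (s ∷ u ∷ ε · b ∷ v) η ≡ trunc (⟦ h b ⟧ ((v ∷ʳ u) ∷ʳ s) η) (evalT (v ∷ʳ u) t)
  H≡ false s u v η = cong₂ trunc (step≡ false s u (ε · false) v η) (bnd≡ s u (ε · false) v)
  H≡ true  s u v η = cong₂ trunc (step≡ true s u (ε · true) v η) (bnd≡ s u (ε · true) v)
  val≡ : ∀ v η y → val (⟦ g ⟧ v η) v η y ≡ recSem g h t v y η
  val≡ v η ε       = refl
  val≡ v η (y · b) = trans (cong (λ s → H (s ∷ y ∷ ε · b ∷ v) η) (val≡ v η y)) (H≡ b _ y v η)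
  inits : Fin n → Tm (suc n)
  inits i = var (inject₁ i)
  argFn : Fin (2 + n) → Fn (suc n)
  argFn zero          w η = evalT w (var (fromℕ n))
  argFn 1F    w η = ⟦ g ⟧ (evalTs inits w) η
  argFn (suc (suc i)) w η = evalT w (inits i)
  args : ∀ i → Readable (argFn i)
  args zero          = Readable-term (var (fromℕ n))
  args 1F    = Readable-sub (POR-readable g) inits
  args (suc (suc i)) = Readable-term (inits i)
  unsnoc : ∀ w → w ≡ init w ∷ʳ last w
  unsnoc w = proj₂ (proj₂ (initLast w))
  inits≡ : ∀ w → evalTs inits w ≡ init w
  inits≡ w = trans (tabulate-cong (λ i → trans (cong (λ z → lookup z (inject₁ i)) (unsnoc w))
      (lookup-inject₁ (init w) (last w) i)))
                   (tabulate∘lookup (init w))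
  result : ∀ w η → val (⟦ g ⟧ (evalTs inits w) η) (evalTs inits w) η (lookup w (fromℕ n)) ≡ ⟦ rec g h t ⟧ w η
  result w η = trans (cong₂ (λ v y → val (⟦ g ⟧ v η) v η y) (inits≡ w)
                        (trans (cong (λ z → lookup z (fromℕ n)) (unsnoc w)) (lookup-fromℕ (init w) (last w))))
                     (val≡ (init w) η (last w))

Representable-ext : ∀ {k} {f g : Fn k} → (∀ v η → f v η ≡ g v η) → Representable f → Representable g
Representable-ext e (F , total , uniq , rep) = F , total , uniq , λ v y η →
  (λ q → proj₁ (rep v y η) (trans (e v η) q)) , (λ s → trans (sym (e v η)) (proj₂ (rep v y η) s))

mainTheorem1 : (k : ℕ) (f : Vec Str k → Oracle → Str) →
    (Representable f → InPOR f) × (InPOR f → Representable f)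
mainTheorem1 k f = representable⇒POR f ,
  λ (p , e) → Representable-ext e (Readable⇒Representable (POR-readable p))
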